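{- Let $G$ be a strongly regular graph with parameters $(v,k,\lambda,\mu)$ whose negative eigenvalue $s$ has multiplicity $g\ge 3$, and let $N$ be the number of $4$-cliques ($K_4$ subgraphs) of $G$. Then for every positive integer $t$, $$\Psi_B^2\le \Psi_A\,(\Psi_{C_0}+N\,\Psi_{C_1}),$$ where, writing $Z=Z_{g,t}$ and $p=s/k$, $q=-(s+1)/(v-k-1)$: $\Psi_A=v\big(Z(1)+kZ(p)+(v-k-1)Z(q)\big)$; $\Psi_B=vk\,Z\!\big(\tfrac{1+p}{\sqrt{2+2p}}\big)+\tfrac{vk\lambda}{2}Z\!\big(\tfrac{2p}{\sqrt{2+2p}}\big)+v(v-k-1)\mu\,Z\!\big(\tfrac{p+q}{\sqrt{2+2p}}\big)+\tfrac{v(v-k-1)(k-\mu)}{2}Z\!\big(\tfrac{2q}{\sqrt{2+2p}}\big)$; $\Psi_{C_0}=\tfrac{vk}{2}\Big(Z(1)+2\lambda Z\!\big(\tfrac{1+3p}{2+2p}\big)+2(k-\lambda-1)Z\!\big(\tfrac{1+2p+q}{2+2p}\big)+2\lambda(\lambda-1)Z\!\big(\tfrac{3p+q}{2+2p}\big)+\big((\mu-1)(k-\lambda-1)-\lambda(\lambda-1)+2\lambda(k-2\lambda)\big)Z\!\big(\tfrac{2p+2q}{2+2p}\big)+2\big((k-\mu)(k-\lambda-1)-\lambda(k-2\lambda)\big)Z\!\big(\tfrac{p+3q}{2+2p}\big)+\big(\tfrac{k(v-2k+\lambda)}{2}-(k-\mu)(k-\lambda-1)+\tfrac{\lambda(k-2\lambda)}{2}\big)Z\!\big(\tfrac{4q}{2+2p}\big)\Big)$;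 $\Psi_{C_1}=6\sum_{l=0}^{4}(-1)^l\binom{4}{l}Z\!\big(\tfrac{(4-l)p+lq}{2+2p}\big)$.
   Context: A graph is strongly regular with parameters $(v,k,\lambda,\mu)$ if it has $v$ vertices, is $k$-regular, adjacent vertices have exactly $\lambda$ common neighbours and distinct non-adjacent vertices have exactly $\mu$ common neighbours. Its adjacency matrix has eigenvalues $k$, $r=\frac12(\lambda-\mu+\sqrt{(\lambda-\mu)^2+4(k-\mu)})$ and $s=\frac12(\lambda-\mu-\sqrt{(\lambda-\mu)^2+4(k-\mu)})$, the multiplicity of $s$ being $g=\frac12\big(v-1+\frac{2k+(v-1)(\lambda-\mu)}{\sqrt{(\lambda-\mu)^2+4(k-\mu)}}\big)$. For $\alpha>0$ the Gegenbauer polynomials $C_t^{(\alpha)}$ are defined by $(1-2\xi z+z^2)^{ -\alpha}=\sum_{t\ge0}C_t^{(\alpha)}(\xi)z^t$, and for $n\ge3$ one sets $Z_{n,t}(\xi)=\frac{2t+n-2}{n-2}C_t^{((n-2)/2)}(\xi)$ (the zonal harmonic of degree $t$ on the sphere $S^{n-1}$). -}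

module Defs where

open import Level using (_⊔_) renaming (suc to lsuc)
open import Algebra.Apartness.Bundles using (HeytingField; HeytingCommutativeRing)
open import Algebra.Bundles using (CommutativeRing)
open import Data.Bool.Base using (Bool; true; false; _∧_; if_then_else_)
open import Data.Fin.Base using (Fin; toℕ)
open import Data.Fin.Properties using (_<?_)
open import Data.Fin.Subset using (Subset; _∩_; ∣_∣)
open import Data.List.Base using (length; filterᵇ; cartesianProduct; allFin)
open import Data.Nat.Base as ℕ using (ℕ; zero; suc; _∸_; NonZero; >-nonZero)
open import Data.Nat.Combinatorics using (_C_)
open import Data.Nat.Properties using (m<n⇒0<n∸m)
open import Data.Product.Base using (Σ-syntax; ∃-syntax; _×_; _,_; proj₁)
open import Data.Sum.Base using (_⊎_)
open import Data.Vec.Base using (tabulate)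
open import Data.Vec.Functional using (Vector)
open import Relation.Binary.Core using (Rel)
open import Relation.Binary.Definitions using (Cotransitive)
open import Relation.Binary.PropositionalEquality.Core using (_≡_; _≢_)
open import Relation.Binary.Structures using (IsStrictPartialOrder)
open import Relation.Nullary.Decidable.Core using (does)
open import Relation.Nullary.Negation.Core using (¬_)

import Algebra.Apartness.Properties.HeytingCommutativeRing as HeytingProperties
import Algebra.Definitions.RawMonoid as RawMonoidDefinitions
import Algebra.Properties.Semiring.Exp as Exp
import Algebra.Properties.Monoid.Sum as Sum
import Relation.Binary.Reasoning.Setoid as SetoidReasoning

-- A Cauchy-complete Archimedean ordered field.  Classically these axioms
-- determine ℝ up to isomorphism; they are phrased constructively
-- (cotransitive _<_, inverses only for elements apart from 0#, Cauchy
-- sequences carrying a modulus) so that Bishop's reals satisfy them too.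
record Reals c ℓ₁ ℓ₂ ℓ₃ : Set (lsuc (c ⊔ ℓ₁ ⊔ ℓ₂ ⊔ ℓ₃)) where
  field
    heytingField : HeytingField c ℓ₁ ℓ₂

  open HeytingField heytingField public

  commutativeRing : CommutativeRing c ℓ₁
  commutativeRing = HeytingCommutativeRing.commutativeRing heytingCommutativeRing

  open CommutativeRing commutativeRing public
    using (semiring; +-rawMonoid; +-monoid)

  -- n · x is the n-fold sum x + ⋯ + x.
  open RawMonoidDefinitions +-rawMonoid public using () renaming (_×_ to infixr 8 _·_)

  ι : ℕ → Carrier
  ι n = n · 1#

  infix 4 _<_ _≤_

  field
    _<_                  : Rel Carrier ℓ₃
    isStrictPartialOrder : IsStrictPartialOrder _≈_ _<_
    <-cotrans            : Cotransitive _<_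
    <⇒#                  : ∀ {x y} → x < y → x # y
    #⇒<⊎>                : ∀ {x y} → x # y → x < y ⊎ y < x
    0<1                  : 0# < 1#
    +-monoˡ-<            : ∀ {x y} z → x < y → x + z < y + z
    *-pos                : ∀ {x y} → 0# < x → 0# < y → 0# < x * y

  _≤_ : Rel Carrier ℓ₃
  x ≤ y = ¬ (y < x)

  field
    archimedean : ∀ x → ∃[ n ] x < ι n

    -- Swapping m and n bounds |a m - a n| by 1/(j+1).
    complete : (a : ℕ → Carrier) →
      (∀ j → ∃[ M ] ∀ m n → M ℕ.≤ m → M ℕ.≤ n → suc j · (a m - a n) < 1#) →
      ∃[ L ] ∀ j → ∃[ M ] ∀ n → M ℕ.≤ n →
        suc j · (a n - L) < 1# × suc j · (L - a n) < 1#

    -- Square roots follow from completeness; they are primitive here only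
    -- so that they can be written as a function.  The value of √ at
    -- negative arguments is unspecified.
    √        : Carrier → Carrier
    √-nonneg : ∀ {x} → 0# ≤ x → 0# ≤ √ x
    √-square : ∀ {x} → 0# ≤ x → √ x * √ x ≈ x

module _ {c ℓ₁ ℓ₂ ℓ₃} (R : Reals c ℓ₁ ℓ₂ ℓ₃) where
  open Reals R
  open IsStrictPartialOrder isStrictPartialOrder
    using (asym; <-respˡ-≈; <-respʳ-≈) renaming (trans to <-trans)
  open HeytingProperties heytingCommutativeRing
    using (x-0≈x; invertibleˡ⇒#)

  0<ι : ∀ n → 0# < ι (suc n)
  0<ι zero    = <-respʳ-≈ (sym (+-identityʳ 1#)) 0<1
  0<ι (suc n) = <-trans 0<1
    (<-respˡ-≈ (+-identityˡ 1#) (<-respʳ-≈ (+-comm _ _) (+-monoˡ-< 1# (0<ι n))))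

  ι#0 : ∀ n .{{_ : NonZero n}} → ι n # 0#
  ι#0 (suc n) = #-sym (<⇒# (0<ι n))

  √#0 : ∀ {x} → 0# < x → √ x # 0#
  √#0 {x} 0<x with #⇒invertible (#-sym (<⇒# 0<x))
  ... | u , u*x≈1 , _ = invertibleˡ⇒# (u * √ x , (begin
    u * √ x * (√ x - 0#)  ≈⟨ *-congˡ (x-0≈x (√ x)) ⟩
    u * √ x * √ x         ≈⟨ *-assoc u (√ x) (√ x) ⟩
    u * (√ x * √ x)       ≈⟨ *-congˡ (√-square (asym 0<x)) ⟩
    u * x                 ≈⟨ *-congˡ (x-0≈x x) ⟨
    u * (x - 0#)          ≈⟨ u*x≈1 ⟩
    1#                    ∎))
    where
    open SetoidReasoning setoid

  -- #⇒invertible inverts y - 0#, which is ≈ y.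
  infixl 7 quotient _/ℕ_

  quotient : (x y : Carrier) → y # 0# → Carrier
  quotient x y y#0 = x * proj₁ (#⇒invertible y#0)

  _/ℕ_ : Carrier → (n : ℕ) .{{_ : NonZero n}} → Carrier
  x /ℕ n = quotient x (ι n) (ι#0 n)

  quotient-* : ∀ x y (y#0 : y # 0#) → quotient x y y#0 * y ≈ x
  quotient-* x y y#0 with #⇒invertible y#0
  ... | u , u*y≈1 , _ = begin
    x * u * y           ≈⟨ *-assoc x u y ⟩
    x * (u * y)         ≈⟨ *-congˡ (*-congˡ (x-0≈x y)) ⟨
    x * (u * (y - 0#))  ≈⟨ *-congˡ u*y≈1 ⟩
    x * 1#              ≈⟨ *-identityʳ x ⟩
    x                   ∎
    where
    open SetoidReasoning setoid

record Graph (v : ℕ) : Set where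
  field
    adj    : Fin v → Fin v → Bool
    sym    : ∀ x y → adj x y ≡ adj y x
    irrefl : ∀ x → adj x x ≡ false

  neighbours : Fin v → Subset v
  neighbours x = tabulate (adj x)

record IsStronglyRegular {v : ℕ} (G : Graph v) (k lam μ : ℕ) : Set where
  open Graph G
  field
    regular     : ∀ x → ∣ neighbours x ∣ ≡ k
    adjacent    : ∀ x y → adj x y ≡ true →
                  ∣ neighbours x ∩ neighbours y ∣ ≡ lam
    nonAdjacent : ∀ x y → x ≢ y → adj x y ≡ false →
                  ∣ neighbours x ∩ neighbours y ∣ ≡ μ

-- Each 4-clique is counted once, as its increasing list of vertices.
#K₄ : ∀ {v} → Graph v → ℕ
#K₄ {v} G = length (filterᵇ increasingClique
  (cartesianProduct (allFin v) (cartesianProduct (allFin v)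
    (cartesianProduct (allFin v) (allFin v)))))
  where
  open Graph G
  increasingClique : Fin v × Fin v × Fin v × Fin v → Bool
  increasingClique (a , b , c , d) =
    does (a <? b) ∧ does (b <? c) ∧ does (c <? d) ∧
    adj a b ∧ adj a c ∧ adj a d ∧ adj b c ∧ adj b d ∧ adj c d

module _ {c ℓ₁ ℓ₂ ℓ₃} (R : Reals c ℓ₁ ℓ₂ ℓ₃) {v : ℕ} (G : Graph v) where
  open Reals R
  open Graph G using (adj)
  open Sum +-monoid using (sum-syntax)

  adjacencyMatrix : Fin v → Fin v → Carrier
  adjacencyMatrix x y = if adj x y then 1# else 0#

  IsEigenvector : Carrier → Vector Carrier v → Set ℓ₁
  IsEigenvector θ u = ∀ x → ∑[ y < v ] (adjacencyMatrix x y * u y) ≈ θ * u x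

  -- The θ-eigenspace has a basis of n vectors.  (The matrix is symmetric,
  -- so geometric and algebraic multiplicities agree.)
  record HasMultiplicity (θ : Carrier) (n : ℕ) : Set (c ⊔ ℓ₁) where
    field
      basis       : Fin n → Vector Carrier v
      eigen       : ∀ i → IsEigenvector θ (basis i)
      independent : (a : Vector Carrier n) →
                    (∀ x → ∑[ i < n ] (a i * basis i x) ≈ 0#) →
                    ∀ i → a i ≈ 0#
      spanning    : (u : Vector Carrier v) → IsEigenvector θ u →
                    Σ[ a ∈ Vector Carrier n ] ∀ x → u x ≈ ∑[ i < n ] (a i * basis i x)

module _ {c ℓ₁ ℓ₂ ℓ₃} (R : Reals c ℓ₁ ℓ₂ ℓ₃) where
  open Reals R
  open Sum +-monoid using (sum⁺-syntax)

  infixl 7 _÷_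
  _÷_ : Carrier → (n : ℕ) .{{_ : NonZero n}} → Carrier
  _÷_ = _/ℕ_ R

  -- Formal power series in z: f t is the coefficient of zᵗ.
  Series : Set c
  Series = ℕ → Carrier

  _⊛_ : Series → Series → Series
  (f ⊛ g) t = ∑[ i ≤ t ] (f (toℕ i) * g (t ∸ toℕ i))

  oneˢ : Series
  oneˢ zero    = 1#
  oneˢ (suc _) = 0#

  powˢ : Series → ℕ → Series
  powˢ f zero    = oneˢ
  powˢ f (suc j) = f ⊛ powˢ f j

  -- β (β - 1) ⋯ (β - j + 1) / j!
  binomial : Carrier → ℕ → Carrier
  binomial β zero    = 1#
  binomial β (suc j) = binomial β j * (β - ι j) ÷ suc j

  -- (1 + y)^β = Σ_j binomial β j yʲ for a series y without constant term;
  -- yʲ then starts at zʲ, so only j ≤ t contribute to the coefficient of zᵗ.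
  [1+_]^_ : Series → Carrier → Series
  ([1+ y ]^ β) t = ∑[ j ≤ t ] (binomial β (toℕ j) * powˢ y (toℕ j) t)

  -2ξz+z² : Carrier → Series
  -2ξz+z² ξ 1 = - (2 · ξ)
  -2ξz+z² ξ 2 = 1#
  -2ξz+z² ξ _ = 0#

  gegenbauer : (α : Carrier) (t : ℕ) → Carrier → Carrier
  gegenbauer α t ξ = ([1+ -2ξz+z² ξ ]^ (- α)) t

  zonal : (n : ℕ) → 3 ℕ.≤ n → (t : ℕ) → Carrier → Carrier
  zonal n 3≤n t ξ = (ι (2 ℕ.* t ℕ.+ (n ∸ 2)) ÷ (n ∸ 2)) * gegenbauer (ι (n ∸ 2) ÷ 2) t ξ
    where instance _ = >-nonZero (m<n⇒0<n∸m 3≤n)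

module Eigenvalue {c ℓ₁ ℓ₂ ℓ₃} (R : Reals c ℓ₁ ℓ₂ ℓ₃) (k lam μ : ℕ) where
  open Reals R

  s : Carrier
  s = _÷_ R (ι lam - ι μ - √ ((ι lam - ι μ) * (ι lam - ι μ) + 4 · (ι k - ι μ))) 2

module Cosines {c ℓ₁ ℓ₂ ℓ₃} (R : Reals c ℓ₁ ℓ₂ ℓ₃) (v k lam μ : ℕ)
  (0<k : 0 ℕ.< k) (k+1<v : suc k ℕ.< v) where
  open Reals R
  open Eigenvalue R k lam μ public

  p : Carrier
  p = _÷_ R s k
    where instance _ = >-nonZero 0<k

  q : Carrier
  q = _÷_ R (- (s + 1#)) (v ∸ suc k)
    where instance _ = >-nonZero (m<n⇒0<n∸m k+1<v)

  -- Always ≥ 0.  Positivity is assumed so that the quotients below are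
  -- defined; when g ≥ 3 it excludes only disjoint unions of copies of K₂.
  2+2p : Carrier
  2+2p = ι 2 + 2 · p

module Psi {c ℓ₁ ℓ₂ ℓ₃} (R : Reals c ℓ₁ ℓ₂ ℓ₃) (v k lam μ : ℕ)
  (0<k : 0 ℕ.< k) (k+1<v : suc k ℕ.< v)
  (0<2+2p : Reals._<_ R (Reals.0# R) (Cosines.2+2p R v k lam μ 0<k k+1<v))
  (g : ℕ) (3≤g : 3 ℕ.≤ g) (t : ℕ) where
  open Reals R
  open Exp semiring using (_^_)
  open Sum +-monoid using (sum⁺-syntax)
  open Cosines R v k lam μ 0<k k+1<v public

  infixl 7 _/2
  _/2 : Carrier → Carrier
  x /2 = _÷_ R x 2

  V K L M V-K-1 : Carrier
  V = ι v
  K = ι k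
  L = ι lam
  M = ι μ
  V-K-1 = V - K - 1#

  _/√h _/h : Carrier → Carrier
  x /√h = quotient R x (√ 2+2p) (√#0 R 0<2+2p)
  x /h  = quotient R x 2+2p (#-sym (<⇒# 0<2+2p))

  Z : Carrier → Carrier
  Z = zonal R g 3≤g t

  ΨA : Carrier
  ΨA = V * (Z 1# + K * Z p + V-K-1 * Z q)

  ΨB : Carrier
  ΨB = V * K * Z ((1# + p) /√h)
     + (V * K * L) /2 * Z ((2 · p) /√h)
     + V * V-K-1 * M * Z ((p + q) /√h)
     + (V * V-K-1 * (K - M)) /2 * Z ((2 · q) /√h)

  ΨC₀ : Carrier
  ΨC₀ = (V * K) /2 *
    ( Z 1#
    + 2 · L * Z ((1# + 3 · p) /h)
    + 2 · (K - L - 1#) * Z ((1# + 2 · p + q) /h)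
    + 2 · L * (L - 1#) * Z ((3 · p + q) /h)
    + ((M - 1#) * (K - L - 1#) - L * (L - 1#) + 2 · L * (K - 2 · L))
        * Z ((2 · p + 2 · q) /h)
    + 2 · ((K - M) * (K - L - 1#) - L * (K - 2 · L)) * Z ((p + 3 · q) /h)
    + ((K * (V - 2 · K + L)) /2 - (K - M) * (K - L - 1#) + (L * (K - 2 · L)) /2)
        * Z ((4 · q) /h) )

  ΨC₁ : Carrier
  ΨC₁ = 6 · (∑[ l ≤ 4 ]
    ((- 1#) ^ toℕ l * ι (4 C toℕ l) * Z (((4 ∸ toℕ l) · p + toℕ l · q) /h)))

{-# OPTIONS --safe #-}

-- Since A² = kI + λA + μ(J - I - A), the matrix E = I + pA + q(J - I - A) has
-- columns in the s-eigenspace and satisfies E² = cE with c > 0.  It is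
-- therefore the Gram matrix of unit vectors x_a in ℝ^g, one for each vertex,
-- and x_ij = (x_i + x_j)/√(2+2p) is a unit vector for each edge ij.  The
-- homogeneous polynomials K_y(x) = ∣x∣^t Z(⟨x,y⟩/∣x∣), ∣y∣ = 1, are harmonic, and
-- for the Fischer inner product ⟨K_y,K_z⟩ is a positive multiple of Z(⟨y,z⟩),
-- because multiplication by ∣x∣² is adjoint to the Laplacian.  The theorem is
-- the Cauchy–Schwarz inequality for the sum of the K_y over the vertex vectors
-- and the sum over the edge vectors: Ψ_A, Ψ_B and Ψ_C₀ + NΨ_C₁ are the three
-- inner products, grouped by the cosines that occur.  For a pair of disjoint
-- edges the cosine depends only on the number of adjacencies between them;
-- expanding multilinearly in these four 0/1 variables, all terms but the one of
-- degree four are given by the parameters, and that one counts 4-cliques.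

module Submission where

open import Defs
open import Algebra.Bundles using (CommutativeRing; RawRing)
open import Algebra.Solver.Ring.AlmostCommutativeRing using (fromCommutativeRing; _-Raw-AlmostCommutative⟶_)
open import Data.Bool.Base using (Bool; true; false; _∧_; if_then_else_)
open import Data.Fin.Base using (Fin; zero; suc; toℕ; fromℕ<)
open import Data.Fin.Properties using (_≟_; _<?_)
open import Data.Fin.Subset using (_∩_; ∣_∣)
open import Data.Integer.Base as ℤ using (ℤ; -[1+_]; _⊖_; _◃_)
open import Data.List.Base as List using (List; []; _∷_; _++_; length; filterᵇ; cartesianProduct; allFin)
open import Data.Maybe.Base using (Maybe; just; nothing)
open import Data.Nat.Base as ℕ using (ℕ; zero; suc; z≤n; s≤s; _∸_)
open import Data.Product.Base as Product using (Σ-syntax; _,_; proj₁; proj₂)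
open import Data.Sign.Base using (Sign)
open import Data.Sum.Base using (_⊎_; inj₁; inj₂)
open import Data.Vec.Base as Vec using ()
open import Data.Vec.Functional using (Vector)
open import Relation.Binary.Definitions using (tri<; tri≈; tri>)
open import Relation.Binary.PropositionalEquality.Core as ≡ using (_≡_; _≢_)
open import Relation.Binary.Structures using (IsStrictPartialOrder)
open import Relation.Nullary.Decidable using (yes; no; does; dec-true; dec-false)
open import Relation.Nullary.Negation.Core using (¬_; contradiction)
import Algebra.Apartness.Properties.HeytingCommutativeRing as HeytingProperties
import Algebra.Definitions.RawMonoid as RawMonoidDefinitions
import Algebra.Properties.AbelianGroup as AbelianGroupProperties
import Algebra.Properties.CommutativeMonoid.Sum as CommutativeMonoidSum
import Algebra.Properties.Monoid.Sum as MonoidSum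
import Algebra.Properties.Ring as RingProperties
import Algebra.Properties.Semiring.Mult as Mult
import Algebra.Properties.Semiring.Mult.TCOptimised as OptimisedMult
import Algebra.Properties.Semiring.Sum as SemiringSum
import Algebra.Solver.Ring as RingSolver
import Data.Integer.Properties as ℤ
import Data.Nat.Properties as ℕ
import Relation.Binary.Reasoning.Setoid as SetoidReasoning

-- Harmonic analysis on the sphere is replaced by algebra. The Fischer pairing of forms given by
-- their derivatives is a finite sum of products, so positivity is a sum of squares and nothing is
-- integrated. The link with the binomial series that defines the Gegenbauer polynomials is a shared
-- three-term recurrence. The constructive axioms shape the rest. Whether a vector vanishes cannot
-- be decided, so coordinates for the eigenspace exist only up to double negation; this suffices
-- because `_≤_` is itself a negation. The value of `√` is unspecified on negative arguments, so the
-- formula for `s` says nothing until `k - μ` has been shown nonnegative by counting. Edges enter as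
-- ordered pairs weighted by the adjacency matrix. Each edge then occurs twice, and the sums come
-- out as `2 · ΨB` and four times the bracket with `ΨC₀`; the factors cancel at the end.

-- A ring solver with integer coefficients

module IntegerSolver {c ℓ} (CR : CommutativeRing c ℓ) where
  open CommutativeRing CR
  open RingProperties ring using (-0#≈0#; -‿distribˡ-*; -‿distribʳ-*; -‿involutive)
  open AbelianGroupProperties +-abelianGroup using (⁻¹-∙-comm)
  open OptimisedMult semiring using (_×_; ×-homo-+; 1+×; ×1-homo-*)
  open SetoidReasoning setoid

  private
    ⟦_⟧ : ℤ → Carrier
    ⟦ ℤ.+ n ⟧    = n × 1#
    ⟦ -[1+ n ] ⟧ = - (suc n × 1#)

    ⊖-homo : ∀ m n → ⟦ m ⊖ n ⟧ ≈ m × 1# - n × 1#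
    ⊖-homo m zero = sym (trans (+-congˡ -0#≈0#) (+-identityʳ _))
    ⊖-homo zero (suc n) = sym (+-identityˡ _)
    ⊖-homo (suc m) (suc n) = begin
      ⟦ suc m ⊖ suc n ⟧                    ≡⟨ ≡.cong ⟦_⟧ (ℤ.[1+m]⊖[1+n]≡m⊖n m n) ⟩
      ⟦ m ⊖ n ⟧                            ≈⟨ ⊖-homo m n ⟩
      m × 1# - n × 1#                      ≈⟨ +-congʳ (+-identityˡ _) ⟨
      0# + m × 1# - n × 1#                 ≈⟨ +-congʳ (+-congʳ (-‿inverseʳ 1#)) ⟨
      1# - 1# + m × 1# - n × 1#            ≈⟨ +-congʳ (+-assoc _ _ _) ⟩
      1# + (- 1# + m × 1#) - n × 1#        ≈⟨ +-congʳ (+-congˡ (+-comm _ _)) ⟩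
      1# + (m × 1# - 1#) - n × 1#          ≈⟨ +-congʳ (+-assoc _ _ _) ⟨
      1# + m × 1# - 1# - n × 1#            ≈⟨ +-assoc _ _ _ ⟩
      1# + m × 1# + (- 1# - n × 1#)        ≈⟨ +-congˡ (⁻¹-∙-comm _ _) ⟩
      1# + m × 1# - (1# + n × 1#)          ≈⟨ +-cong (1+× m 1#) (-‿cong (1+× n 1#)) ⟨
      suc m × 1# - suc n × 1#              ∎

    +-homo : ∀ i j → ⟦ i ℤ.+ j ⟧ ≈ ⟦ i ⟧ + ⟦ j ⟧
    +-homo (ℤ.+ m)  (ℤ.+ n)  = ×-homo-+ 1# m n
    +-homo (ℤ.+ m)  -[1+ n ] = ⊖-homo m (suc n)
    +-homo -[1+ m ] (ℤ.+ n)  = trans (⊖-homo n (suc m)) (+-comm _ _)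
    +-homo -[1+ m ] -[1+ n ] = begin
      - (suc (suc (m ℕ.+ n)) × 1#)       ≡⟨ ≡.cong (λ k → - (k × 1#)) (≡.cong suc (ℕ.+-suc m n)) ⟨
      - ((suc m ℕ.+ suc n) × 1#)         ≈⟨ -‿cong (×-homo-+ 1# (suc m) (suc n)) ⟩
      - (suc m × 1# + suc n × 1#)        ≈⟨ ⁻¹-∙-comm _ _ ⟨
      - (suc m × 1#) + - (suc n × 1#)    ∎

    -‿homo : ∀ i → ⟦ ℤ.- i ⟧ ≈ - ⟦ i ⟧
    -‿homo (ℤ.+ zero)  = sym -0#≈0#
    -‿homo (ℤ.+ suc n) = refl
    -‿homo -[1+ n ]    = sym (-‿involutive _)

    -◃-homo : ∀ n → ⟦ Sign.- ◃ n ⟧ ≈ - (n × 1#)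
    -◃-homo zero    = sym -0#≈0#
    -◃-homo (suc n) = refl

    +◃-homo : ∀ n → ⟦ Sign.+ ◃ n ⟧ ≈ n × 1#
    +◃-homo zero    = refl
    +◃-homo (suc n) = refl

    *-homo : ∀ i j → ⟦ i ℤ.* j ⟧ ≈ ⟦ i ⟧ * ⟦ j ⟧
    *-homo (ℤ.+ m)  (ℤ.+ n)  = trans (+◃-homo (m ℕ.* n)) (×1-homo-* m n)
    *-homo (ℤ.+ m)  -[1+ n ] = begin
      ⟦ Sign.- ◃ (m ℕ.* suc n) ⟧  ≈⟨ -◃-homo (m ℕ.* suc n) ⟩
      - ((m ℕ.* suc n) × 1#)      ≈⟨ -‿cong (×1-homo-* m (suc n)) ⟩
      - (m × 1# * suc n × 1#)     ≈⟨ -‿distribʳ-* _ _ ⟩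
      m × 1# * - (suc n × 1#)     ∎
    *-homo -[1+ m ] (ℤ.+ n)  = begin
      ⟦ Sign.- ◃ (suc m ℕ.* n) ⟧  ≈⟨ -◃-homo (suc m ℕ.* n) ⟩
      - ((suc m ℕ.* n) × 1#)      ≈⟨ -‿cong (×1-homo-* (suc m) n) ⟩
      - (suc m × 1# * n × 1#)     ≈⟨ -‿distribˡ-* _ _ ⟩
      - (suc m × 1#) * n × 1#     ∎
    *-homo -[1+ m ] -[1+ n ] = begin
      (suc m ℕ.* suc n) × 1#            ≈⟨ ×1-homo-* (suc m) (suc n) ⟩
      suc m × 1# * suc n × 1#           ≈⟨ -‿involutive _ ⟨
      - - (suc m × 1# * suc n × 1#)     ≈⟨ -‿cong (-‿distribˡ-* _ _) ⟩
      - (- (suc m × 1#) * suc n × 1#)   ≈⟨ -‿distribʳ-* _ _ ⟩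
      - (suc m × 1#) * - (suc n × 1#)   ∎

    coefficients : RawRing _ _
    coefficients = record
      { Carrier = ℤ ; _≈_ = _≡_ ; _+_ = ℤ._+_ ; _*_ = ℤ._*_ ; -_ = ℤ.-_ ; 0# = ℤ.0ℤ ; 1# = ℤ.1ℤ }

    morphism : coefficients -Raw-AlmostCommutative⟶ fromCommutativeRing CR
    morphism = record
      { ⟦_⟧ = ⟦_⟧ ; +-homo = +-homo ; *-homo = *-homo ; -‿homo = -‿homo ; 0-homo = refl ; 1-homo = refl }

    coeff≟ : ∀ i j → Maybe (⟦ i ⟧ ≈ ⟦ j ⟧)
    coeff≟ i j with i ℤ.≟ j
    ... | yes i≡j = just (reflexive (≡.cong ⟦_⟧ i≡j))
    ... | no  _   = nothing

  open RingSolver coefficients (fromCommutativeRing CR) morphism coeff≟ public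
    using (Polynomial; solve; con; _:=_; _:+_; _:*_; _:-_; :-_)

  infixr 9 _:·_
  -- Unfolds exactly as `_·_` does, so that multiples and numerals in a solver equation match the
  -- goal definitionally.
  _:·_ : ∀ {n} → ℕ → Polynomial n → Polynomial n
  zero  :· e = con ℤ.0ℤ
  suc n :· e = e :+ (n :· e)

  :ι : ∀ {n} → ℕ → Polynomial n
  :ι n = n :· con ℤ.1ℤ

  :0 :1 : ∀ {n} → Polynomial n
  :0 = con ℤ.0ℤ
  :1 = con ℤ.1ℤ

-- Finite sums, Kronecker delta and dot product

module FiniteSums {c ℓ} (CR : CommutativeRing c ℓ) where
  open CommutativeRing CR hiding (zero)
  open RingProperties ring using (-1*x≈-x)
  open Mult semiring using (×-assoc-*; ×-homo-+; ×-congʳ)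
  private
    module M = CommutativeMonoidSum +-commutativeMonoid
    module S = SemiringSum semiring
  open RawMonoidDefinitions +-rawMonoid public using () renaming (_×_ to infixr 8 _·_)
  open SetoidReasoning setoid

  -- Opaque, so that ∑ n f determines n and f during unification.
  opaque
    ∑ : ∀ n → Vector Carrier n → Carrier
    ∑ n f = M.sum f

    ∑≈sum : ∀ {n} (f : Vector Carrier n) → ∑ n f ≈ M.sum f
    ∑≈sum f = refl

    ∑-cong : ∀ {n} {f g : Vector Carrier n} → (∀ i → f i ≈ g i) → ∑ n f ≈ ∑ n g
    ∑-cong = M.sum-cong-≋

    ∑-distrib-+ : ∀ {n} (f g : Vector Carrier n) → ∑ n (λ i → f i + g i) ≈ ∑ n f + ∑ n g
    ∑-distrib-+ = M.∑-distrib-+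

    ∑-comm : ∀ {m n} (f : Fin m → Fin n → Carrier) →
             ∑ m (λ i → ∑ n (λ j → f i j)) ≈ ∑ n (λ j → ∑ m (λ i → f i j))
    ∑-comm = M.∑-comm

    *-distribˡ-∑ : ∀ {n} x (f : Vector Carrier n) → x * ∑ n f ≈ ∑ n (λ i → x * f i)
    *-distribˡ-∑ = S.*-distribˡ-sum

    *-distribʳ-∑ : ∀ {n} x (f : Vector Carrier n) → ∑ n f * x ≈ ∑ n (λ i → f i * x)
    *-distribʳ-∑ = S.*-distribʳ-sum

  infixl 10 ∑
  syntax ∑ n (λ i → x) = ∑[ i < n ] x

  ι : ℕ → Carrier
  ι n = n · 1#

  ι-+ : ∀ m n → ι (m ℕ.+ n) ≈ ι m + ι n
  ι-+ = ×-homo-+ 1#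

  ι*≈· : ∀ n x → ι n * x ≈ n · x
  ι*≈· n x = trans (×-assoc-* n 1# x) (×-congʳ n (*-identityˡ x))

  ∑-const : ∀ n x → ∑[ i < n ] x ≈ ι n * x
  ∑-const n x = trans (∑≈sum _) (trans (M.sum-replicate n) (sym (ι*≈· n x)))

  ∑-zero : ∀ {n} {f : Vector Carrier n} → (∀ i → f i ≈ 0#) → ∑ n f ≈ 0#
  ∑-zero {n} f≈0 = trans (∑-cong f≈0) (trans (∑-const n 0#) (zeroʳ _))

  ∑-suc : ∀ {n} (f : Vector Carrier (suc n)) → ∑ (suc n) f ≈ f zero + ∑[ i < n ] f (suc i)
  ∑-suc f = trans (∑≈sum f) (+-congˡ (sym (∑≈sum _)))

  ∑-last : ∀ n (f : ℕ → Carrier) → ∑[ i < suc n ] f (toℕ i) ≈ ∑[ i < n ] f (toℕ i) + f n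
  ∑-last zero    f = trans (∑-suc _) (trans (+-comm _ _) (+-congʳ (trans (∑-zero {0} (λ ())) (sym (∑-zero {0} (λ ()))))))
  ∑-last (suc n) f = trans (∑-suc _) (trans (+-congˡ (∑-last n (λ i → f (suc i))))
    (trans (sym (+-assoc _ _ _)) (+-congʳ (sym (∑-suc _)))))

  ∑-scale-+ : ∀ {n} a b (f g : Vector Carrier n) →
              ∑[ i < n ] (a * f i + b * g i) ≈ a * ∑ n f + b * ∑ n g
  ∑-scale-+ a b f g = trans (∑-distrib-+ _ _)
    (sym (+-cong (*-distribˡ-∑ a f) (*-distribˡ-∑ b g)))

  ∑-distrib-minus : ∀ {n} (f g : Vector Carrier n) → ∑[ i < n ] (f i - g i) ≈ ∑ n f - ∑ n g
  ∑-distrib-minus f g = trans (∑-distrib-+ f _) (+-congˡ (trans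
    (∑-cong (λ i → sym (-1*x≈-x (g i)))) (trans (sym (*-distribˡ-∑ (- 1#) g)) (-1*x≈-x _))))

  δ : ∀ {n} → Fin n → Fin n → Carrier
  δ i j = if does (i ≟ j) then 1# else 0#

  δ-≡ : ∀ {n} (i : Fin n) → δ i i ≈ 1#
  δ-≡ i rewrite dec-true (i ≟ i) ≡.refl = refl

  δ-≢ : ∀ {n} {i j : Fin n} → i ≢ j → δ i j ≈ 0#
  δ-≢ {i = i} {j} i≢j rewrite dec-false (i ≟ j) i≢j = refl

  δ-sym : ∀ {n} (i j : Fin n) → δ i j ≈ δ j i
  δ-sym i j with i ≟ j
  ... | yes ≡.refl = sym (δ-≡ i)
  ... | no  i≢j    = sym (δ-≢ (λ j≡i → i≢j (≡.sym j≡i)))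

  ∑-δ : ∀ {n} i (f : Vector Carrier n) → ∑[ j < n ] (δ i j * f j) ≈ f i
  ∑-δ zero    f = trans (∑-suc _) (trans (+-cong (*-identityˡ _) (∑-zero (λ j → zeroˡ _))) (+-identityʳ _))
  ∑-δ (suc i) f = trans (∑-suc _) (trans (+-cong (zeroˡ _) (trans
    (∑-cong λ j → *-congʳ (δ-suc i j)) (∑-δ i (λ j → f (suc j))))) (+-identityˡ _))
    where
    δ-suc : ∀ {n} (i j : Fin n) → δ (suc i) (suc j) ≈ δ i j
    δ-suc i j with i ≟ j
    ... | yes _ = refl
    ... | no  _ = refl

  dot : ∀ {n} → Vector Carrier n → Vector Carrier n → Carrier
  dot {n} y z = ∑[ i < n ] (y i * z i)

  dot-cong : ∀ {n} {y y′ z z′ : Vector Carrier n} →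
             (∀ i → y i ≈ y′ i) → (∀ i → z i ≈ z′ i) → dot y z ≈ dot y′ z′
  dot-cong y≈y′ z≈z′ = ∑-cong (λ i → *-cong (y≈y′ i) (z≈z′ i))

  dot-comm : ∀ {n} (y z : Vector Carrier n) → dot y z ≈ dot z y
  dot-comm y z = ∑-cong (λ i → *-comm (y i) (z i))

  dot-scale : ∀ {n} a (y z : Vector Carrier n) → dot (λ i → a * y i) z ≈ a * dot y z
  dot-scale a y z = trans (∑-cong (λ i → *-assoc _ _ _)) (sym (*-distribˡ-∑ a _))

  dot-+ : ∀ {n} (x y z : Vector Carrier n) → dot (λ i → x i + y i) z ≈ dot x z + dot y z
  dot-+ x y z = trans (∑-cong (λ i → distribʳ _ _ _)) (∑-distrib-+ _ _)

  dot-∑ : ∀ {m n} (f : Fin m → Vector Carrier n) z → dot (λ i → ∑[ j < m ] f j i) z ≈ ∑[ j < m ] dot (f j) z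
  dot-∑ f z = trans (∑-cong (λ i → *-distribʳ-∑ (z i) _)) (∑-comm _)

-- Polynomial calculus: derivatives, multiplication operators, Fischer pairing

-- Homogeneous polynomials in n variables, and more generally formal power
-- series, are represented by their iterated derivatives at the origin:
-- F (i ∷ j ∷ []) stands for (∂ᵢ ∂ⱼ F)(0).
module Polynomials {c ℓ} (CR : CommutativeRing c ℓ) (n : ℕ) where
  open CommutativeRing CR hiding (zero)
  open FiniteSums CR
  open IntegerSolver CR
  open SetoidReasoning setoid

  Poly : Set c
  Poly = List (Fin n) → Carrier

  infix 4 _≋_
  _≋_ : Poly → Poly → Set ℓ
  F ≋ G = ∀ w → F w ≈ G w

  infixr 6 _⊕_
  infixr 7 _⊙_
  _⊕_ : Poly → Poly → Poly
  (F ⊕ G) w = F w + G w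

  _⊙_ : Carrier → Poly → Poly
  (a ⊙ F) w = a * F w

  𝟙 : Poly
  𝟙 []      = 1#
  𝟙 (_ ∷ _) = 0#

  ∂ : Fin n → Poly → Poly
  ∂ i F w = F (i ∷ w)

  -- The derivative in the direction `y`.
  ∇ : Vector Carrier n → Poly → Poly
  ∇ y F w = ∑[ i < n ] (y i * F (i ∷ w))

  Δ : Poly → Poly
  Δ F w = ∑[ i < n ] F (i ∷ i ∷ w)

  -- Multiplication by the linear form x ↦ dot y x (by the product rule).
  lin : Vector Carrier n → Poly → Poly
  lin y F []      = 0#
  lin y F (i ∷ w) = y i * F w + lin y (∂ i F) w

  X : Fin n → Poly → Poly
  X i = lin (δ i)

  -- Multiplication by dot x x.
  rsq : Poly → Poly
  rsq F w = ∑[ i < n ] X i (X i F) w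

  -- On forms of degree d this operator is multiplication by d; it records the degree, for which
  -- `Poly` has no grading.
  euler : Poly → Poly
  euler F w = ∑[ i < n ] X i (∂ i F) w

  lin-cong : ∀ y {F G} → F ≋ G → lin y F ≋ lin y G
  lin-cong y F≋G []      = refl
  lin-cong y F≋G (i ∷ w) = +-cong (*-congˡ (F≋G w)) (lin-cong y (λ u → F≋G (i ∷ u)) w)

  lin-⊕ : ∀ y F G → lin y (F ⊕ G) ≋ lin y F ⊕ lin y G
  lin-⊕ y F G []      = sym (+-identityˡ 0#)
  lin-⊕ y F G (i ∷ w) = trans (+-congˡ (lin-⊕ y (∂ i F) (∂ i G) w))
    (solve 5 (λ a f g u v → a :* (f :+ g) :+ (u :+ v) := (a :* f :+ u) :+ (a :* g :+ v))
      refl (y i) (F w) (G w) _ _)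

  lin-⊙ : ∀ y a F → lin y (a ⊙ F) ≋ a ⊙ lin y F
  lin-⊙ y a F []      = sym (zeroʳ a)
  lin-⊙ y a F (i ∷ w) = trans (+-congˡ (lin-⊙ y a (∂ i F) w))
    (solve 4 (λ a b f u → b :* (a :* f) :+ a :* u := a :* (b :* f :+ u)) refl a (y i) (F w) _)

  lin-∑ : ∀ {k} y (F : Fin k → Poly) → lin y (λ w → ∑[ j < k ] F j w) ≋ λ w → ∑[ j < k ] lin y (F j) w
  lin-∑ y F []      = sym (∑-zero (λ _ → refl))
  lin-∑ y F (i ∷ w) = trans (+-cong (*-distribˡ-∑ (y i) _) (lin-∑ y (λ j → ∂ i (F j)) w))
    (sym (∑-distrib-+ _ _))

  lin-zero : ∀ y {F} → (∀ w → F w ≈ 0#) → ∀ w → lin y F w ≈ 0#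
  lin-zero y F≈0 []      = refl
  lin-zero y F≈0 (i ∷ w) = trans (+-cong (trans (*-congˡ (F≈0 w)) (zeroʳ _))
    (lin-zero y (λ u → F≈0 (i ∷ u)) w)) (+-identityˡ _)

  -- Differentiating either product yields the same two terms `y i * lin z F` and `z i * lin y F`;
  -- what remains is the claim for `∂ i F` on a shorter word.
  lin-comm : ∀ y z F → lin y (lin z F) ≋ lin z (lin y F)
  lin-comm y z F []      = refl
  lin-comm y z F (i ∷ w) = begin
    y i * lin z F w + lin y (z i ⊙ F ⊕ lin z (∂ i F)) w
      ≈⟨ +-congˡ (expand y z) ⟩
    y i * lin z F w + (z i * lin y F w + lin y (lin z (∂ i F)) w)
      ≈⟨ +-congˡ (+-congˡ (lin-comm y z (∂ i F) w)) ⟩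
    y i * lin z F w + (z i * lin y F w + lin z (lin y (∂ i F)) w)
      ≈⟨ solve 3 (λ a b c → a :+ (b :+ c) := b :+ (a :+ c)) refl _ _ _ ⟩
    z i * lin y F w + (y i * lin z F w + lin z (lin y (∂ i F)) w)
      ≈⟨ +-congˡ (expand z y) ⟨
    z i * lin y F w + lin z (y i ⊙ F ⊕ lin y (∂ i F)) w ∎
    where
    expand : ∀ y z → lin y (z i ⊙ F ⊕ lin z (∂ i F)) w ≈ z i * lin y F w + lin y (lin z (∂ i F)) w
    expand y z = trans (lin-⊕ y _ _ w) (+-congʳ (lin-⊙ y (z i) F w))

  ∑-X : ∀ y F w → ∑[ i < n ] (y i * X i F w) ≈ lin y F w
  ∑-X y F []      = ∑-zero (λ i → zeroʳ (y i))
  ∑-X y F (j ∷ w) = begin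
    ∑[ i < n ] (y i * (δ i j * F w + X i (∂ j F) w))
      ≈⟨ ∑-cong (λ i → trans (distribˡ _ _ _) (+-congʳ (trans
           (solve 3 (λ a b c → a :* (b :* c) := b :* (a :* c)) refl (y i) (δ i j) (F w))
           (*-congʳ (δ-sym i j))))) ⟩
    ∑[ i < n ] (δ j i * (y i * F w) + y i * X i (∂ j F) w)
      ≈⟨ ∑-distrib-+ _ _ ⟩
    ∑[ i < n ] (δ j i * (y i * F w)) + ∑[ i < n ] (y i * X i (∂ j F) w)
      ≈⟨ +-cong (∑-δ j _) (∑-X y (∂ j F) w) ⟩
    y j * F w + lin y (∂ j F) w ∎

  ∑-X-⊙ : ∀ y F w → ∑[ i < n ] X i (y i ⊙ F) w ≈ lin y F w
  ∑-X-⊙ y F w = trans (∑-cong (λ i → lin-⊙ (δ i) (y i) F w)) (∑-X y F w)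

  rsq-cong : ∀ {F G} → F ≋ G → rsq F ≋ rsq G
  rsq-cong F≋G w = ∑-cong (λ i → lin-cong (δ i) (lin-cong (δ i) F≋G) w)

  rsq-⊙ : ∀ a F → rsq (a ⊙ F) ≋ a ⊙ rsq F
  rsq-⊙ a F w = trans (∑-cong (λ i → trans (lin-cong (δ i) (lin-⊙ (δ i) a F) w) (lin-⊙ (δ i) a _ w)))
    (sym (*-distribˡ-∑ a _))

  rsq-zero : ∀ {F} → (∀ w → F w ≈ 0#) → ∀ w → rsq F w ≈ 0#
  rsq-zero F≈0 w = ∑-zero (λ i → lin-zero (δ i) (lin-zero (δ i) F≈0) w)

  dot-δ : ∀ (y : Vector Carrier n) i → dot y (δ i) ≈ y i
  dot-δ y i = trans (∑-cong (λ j → *-comm (y j) (δ i j))) (∑-δ i y)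

  ∇-cong : ∀ y {F G} → F ≋ G → ∇ y F ≋ ∇ y G
  ∇-cong y F≋G w = ∑-cong (λ i → *-congˡ (F≋G (i ∷ w)))

  ∇-⊕ : ∀ y F G → ∇ y (F ⊕ G) ≋ ∇ y F ⊕ ∇ y G
  ∇-⊕ y F G w = trans (∑-cong (λ i → distribˡ _ _ _)) (∑-distrib-+ _ _)

  ∇-⊙ : ∀ y a F → ∇ y (a ⊙ F) ≋ a ⊙ ∇ y F
  ∇-⊙ y a F w = trans
    (∑-cong (λ i → solve 3 (λ a b c → a :* (b :* c) := b :* (a :* c)) refl (y i) a (F (i ∷ w))))
    (sym (*-distribˡ-∑ a _))

  ∇-lin : ∀ z y F → ∇ z (lin y F) ≋ dot z y ⊙ F ⊕ lin y (∇ z F)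
  ∇-lin z y F w = begin
    ∑[ i < n ] (z i * (y i * F w + lin y (∂ i F) w))
      ≈⟨ ∑-cong (λ i → solve 4 (λ z y f u → z :* (y :* f :+ u) := f :* (z :* y) :+ z :* u)
           refl (z i) (y i) (F w) (lin y (∂ i F) w)) ⟩
    ∑[ i < n ] (F w * (z i * y i) + z i * lin y (∂ i F) w)
      ≈⟨ ∑-distrib-+ _ _ ⟩
    ∑[ i < n ] (F w * (z i * y i)) + ∑[ i < n ] (z i * lin y (∂ i F) w)
      ≈⟨ +-cong (trans (sym (*-distribˡ-∑ (F w) _)) (*-comm _ _))
           (∑-cong (λ i → sym (lin-⊙ y (z i) (∂ i F) w))) ⟩
    dot z y * F w + ∑[ i < n ] lin y (z i ⊙ ∂ i F) w
      ≈⟨ +-congˡ (lin-∑ y (λ i → z i ⊙ ∂ i F) w) ⟨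
    dot z y * F w + lin y (∇ z F) w ∎

  ∇-rsq : ∀ z F → ∇ z (rsq F) ≋ 2 · 1# ⊙ lin z F ⊕ rsq (∇ z F)
  ∇-rsq z F w = begin
    ∑[ j < n ] (z j * ∑[ i < n ] X i (X i F) (j ∷ w))
      ≈⟨ ∑-cong (λ j → *-distribˡ-∑ (z j) _) ⟩
    ∑[ j < n ] ∑[ i < n ] (z j * X i (X i F) (j ∷ w))
      ≈⟨ ∑-comm _ ⟩
    ∑[ i < n ] ∇ z (X i (X i F)) w
      ≈⟨ ∑-cong (λ i → begin
           ∇ z (X i (X i F)) w
             ≈⟨ ∇-lin z (δ i) (X i F) w ⟩
           dot z (δ i) * X i F w + X i (∇ z (X i F)) w
             ≈⟨ +-cong (*-congʳ (dot-δ z i)) (trans (lin-cong (δ i) (∇-lin z (δ i) F) w)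
                  (trans (lin-⊕ (δ i) _ _ w) (+-congʳ (trans (lin-⊙ (δ i) _ F w) (*-congʳ (dot-δ z i)))))) ⟩
           z i * X i F w + (z i * X i F w + X i (X i (∇ z F)) w)
             ≈⟨ solve 2 (λ a b → a :+ (a :+ b) := :ι 2 :* a :+ b) refl _ _ ⟩
           ι 2 * (z i * X i F w) + X i (X i (∇ z F)) w ∎) ⟩
    ∑[ i < n ] (ι 2 * (z i * X i F w) + X i (X i (∇ z F)) w)
      ≈⟨ ∑-distrib-+ _ _ ⟩
    ∑[ i < n ] (ι 2 * (z i * X i F w)) + rsq (∇ z F) w
      ≈⟨ +-congʳ (trans (sym (*-distribˡ-∑ (ι 2) _)) (*-congˡ (∑-X z F w))) ⟩
    ι 2 * lin z F w + rsq (∇ z F) w ∎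

  Δ-scale-⊕ : ∀ a b F G → Δ (a ⊙ F ⊕ b ⊙ G) ≋ a ⊙ Δ F ⊕ b ⊙ Δ G
  Δ-scale-⊕ a b F G w = ∑-scale-+ a b _ _

  Δ-lin : ∀ y F → Δ (lin y F) ≋ ι 2 ⊙ ∇ y F ⊕ lin y (Δ F)
  Δ-lin y F w = begin
    ∑[ i < n ] (y i * F (i ∷ w) + (y i * F (i ∷ w) + lin y (∂ i (∂ i F)) w))
      ≈⟨ ∑-cong (λ i → solve 2 (λ a b → a :+ (a :+ b) := :ι 2 :* a :+ b) refl _ _) ⟩
    ∑[ i < n ] (ι 2 * (y i * F (i ∷ w)) + lin y (∂ i (∂ i F)) w)
      ≈⟨ ∑-distrib-+ _ _ ⟩
    ∑[ i < n ] (ι 2 * (y i * F (i ∷ w))) + ∑[ i < n ] lin y (∂ i (∂ i F)) w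
      ≈⟨ +-cong (sym (*-distribˡ-∑ (ι 2) _)) (sym (lin-∑ y (λ i → ∂ i (∂ i F)) w)) ⟩
    ι 2 * ∇ y F w + lin y (Δ F) w ∎

  ∇-δ : ∀ i F → ∇ (δ i) F ≋ ∂ i F
  ∇-δ i F w = ∑-δ i _

  -- The commutator of the Laplacian with multiplication by the squared norm is 2n plus four times
  -- the Euler operator. This is where the dimension enters.
  Δ-rsq : ∀ F → Δ (rsq F) ≋ (ι 2 * ι n) ⊙ F ⊕ ι 4 ⊙ euler F ⊕ rsq (Δ F)
  Δ-rsq F w = begin
    ∑[ j < n ] ∑[ i < n ] X i (X i F) (j ∷ j ∷ w)
      ≈⟨ ∑-comm _ ⟩
    ∑[ i < n ] Δ (X i (X i F)) w
      ≈⟨ ∑-cong (λ i → begin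
           Δ (X i (X i F)) w
             ≈⟨ Δ-lin (δ i) (X i F) w ⟩
           ι 2 * ∇ (δ i) (X i F) w + X i (Δ (X i F)) w
             ≈⟨ +-cong (*-congˡ (trans (∇-lin (δ i) (δ i) F w) (+-cong
                    (*-congʳ (trans (dot-δ (δ i) i) (δ-≡ i))) (lin-cong (δ i) (∇-δ i F) w))))
                  (trans (lin-cong (δ i) (Δ-lin (δ i) F) w)
                    (trans (lin-⊕ (δ i) _ _ w) (+-congʳ (trans (lin-⊙ (δ i) _ _ w)
                      (*-congˡ (lin-cong (δ i) (∇-δ i F) w)))))) ⟩
           ι 2 * (1# * F w + X i (∂ i F) w) + (ι 2 * X i (∂ i F) w + X i (X i (Δ F)) w)
             ≈⟨ solve 3 (λ f e r → :ι 2 :* (:1 :* f :+ e) :+ (:ι 2 :* e :+ r)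
                  := :ι 2 :* f :+ (:ι 4 :* e :+ r)) refl _ _ _ ⟩
           ι 2 * F w + (ι 4 * X i (∂ i F) w + X i (X i (Δ F)) w) ∎) ⟩
    ∑[ i < n ] (ι 2 * F w + (ι 4 * X i (∂ i F) w + X i (X i (Δ F)) w))
      ≈⟨ trans (∑-distrib-+ _ _) (+-cong (∑-const n _) (trans (∑-distrib-+ _ _)
           (+-congʳ (sym (*-distribˡ-∑ (ι 4) _))))) ⟩
    ι n * (ι 2 * F w) + (ι 4 * euler F w + rsq (Δ F) w)
      ≈⟨ +-congʳ (solve 3 (λ a b c → a :* (b :* c) := b :* a :* c) refl _ _ _) ⟩
    ι 2 * ι n * F w + (ι 4 * euler F w + rsq (Δ F) w) ∎

  euler-lin : ∀ y F → euler (lin y F) ≋ lin y F ⊕ lin y (euler F)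
  euler-lin y F w = begin
    ∑[ i < n ] X i (y i ⊙ F ⊕ lin y (∂ i F)) w
      ≈⟨ ∑-cong (λ i → trans (lin-⊕ (δ i) _ _ w) (+-congˡ (lin-comm (δ i) y _ w))) ⟩
    ∑[ i < n ] (X i (y i ⊙ F) w + lin y (X i (∂ i F)) w)
      ≈⟨ ∑-distrib-+ _ _ ⟩
    ∑[ i < n ] X i (y i ⊙ F) w + ∑[ i < n ] lin y (X i (∂ i F)) w
      ≈⟨ +-cong (∑-X-⊙ y F w) (sym (lin-∑ y (λ i → X i (∂ i F)) w)) ⟩
    lin y F w + lin y (euler F) w ∎

  euler-scale-⊕ : ∀ a b F G → euler (a ⊙ F ⊕ b ⊙ G) ≋ a ⊙ euler F ⊕ b ⊙ euler G
  euler-scale-⊕ a b F G w = trans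
    (∑-cong (λ i → trans (lin-⊕ (δ i) _ _ w) (+-cong (lin-⊙ (δ i) a _ w) (lin-⊙ (δ i) b _ w))))
    (∑-scale-+ a b _ _)

  euler-⊙ : ∀ a F → euler (a ⊙ F) ≋ a ⊙ euler F
  euler-⊙ a F w = trans (∑-cong (λ i → lin-⊙ (δ i) a (∂ i F) w)) (sym (*-distribˡ-∑ a _))

  euler-rsq : ∀ F → euler (rsq F) ≋ ι 2 ⊙ rsq F ⊕ rsq (euler F)
  euler-rsq F w = begin
    ∑[ j < n ] X j (λ u → ∑[ i < n ] X i (X i F) (j ∷ u)) w
      ≈⟨ ∑-cong (λ j → lin-∑ (δ j) _ w) ⟩
    ∑[ j < n ] ∑[ i < n ] X j (∂ j (X i (X i F))) w
      ≈⟨ ∑-comm _ ⟩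
    ∑[ i < n ] euler (X i (X i F)) w
      ≈⟨ ∑-cong (λ i → begin
           euler (X i (X i F)) w
             ≈⟨ euler-lin (δ i) _ w ⟩
           X i (X i F) w + X i (euler (X i F)) w
             ≈⟨ +-congˡ (trans (lin-cong (δ i) (euler-lin (δ i) F) w) (lin-⊕ (δ i) _ _ w)) ⟩
           X i (X i F) w + (X i (X i F) w + X i (X i (euler F)) w)
             ≈⟨ solve 2 (λ a b → a :+ (a :+ b) := :ι 2 :* a :+ b) refl _ _ ⟩
           ι 2 * X i (X i F) w + X i (X i (euler F)) w ∎) ⟩
    ∑[ i < n ] (ι 2 * X i (X i F) w + X i (X i (euler F)) w)
      ≈⟨ trans (∑-distrib-+ _ _) (+-congʳ (sym (*-distribˡ-∑ (ι 2) _))) ⟩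
    ι 2 * rsq F w + rsq (euler F) w ∎

  -- A `Poly` is an arbitrary function on words. Only equality of mixed derivatives makes it the
  -- Taylor data of a power series, and adjacent transpositions generate all reorderings.
  record Symmetric (F : Poly) : Set ℓ where
    constructor symmetric
    field swap : ∀ u i j w → F (u ++ i ∷ j ∷ w) ≈ F (u ++ j ∷ i ∷ w)
  open Symmetric

  𝟙-symmetric : Symmetric 𝟙
  𝟙-symmetric .swap []      i j w = refl
  𝟙-symmetric .swap (_ ∷ u) i j w = refl

  ∂-symmetric : ∀ i {F} → Symmetric F → Symmetric (∂ i F)
  ∂-symmetric i f .swap u = swap f (i ∷ u)

  lin-symmetric : ∀ y {F} → Symmetric F → Symmetric (lin y F)
  lin-symmetric y f .swap []      i j w = trans
    (+-congˡ (+-congˡ (lin-cong y (swap f [] i j) w)))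
    (solve 3 (λ a b c → a :+ (b :+ c) := b :+ (a :+ c)) refl _ _ _)
  lin-symmetric y f .swap (k ∷ u) i j w =
    +-cong (*-congˡ (swap f u i j w)) (swap (lin-symmetric y (∂-symmetric k f)) u i j w)

  ∑-symmetric : ∀ {k} {F : Fin k → Poly} → (∀ a → Symmetric (F a)) → Symmetric (λ w → ∑[ a < k ] F a w)
  ∑-symmetric f .swap u i j w = ∑-cong (λ a → swap (f a) u i j w)

  ⊕-symmetric : ∀ {F G} → Symmetric F → Symmetric G → Symmetric (F ⊕ G)
  ⊕-symmetric f g .swap u i j w = +-cong (swap f u i j w) (swap g u i j w)

  ⊙-symmetric : ∀ a {F} → Symmetric F → Symmetric (a ⊙ F)
  ⊙-symmetric a f .swap u i j w = *-congˡ (swap f u i j w)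

  ∇-symmetric : ∀ y {F} → Symmetric F → Symmetric (∇ y F)
  ∇-symmetric y f = ∑-symmetric (λ i → ⊙-symmetric (y i) (∂-symmetric i f))

  rsq-symmetric : ∀ {F} → Symmetric F → Symmetric (rsq F)
  rsq-symmetric f = ∑-symmetric (λ i → lin-symmetric (δ i) (lin-symmetric (δ i) f))

  ∂-∇ : ∀ i y {F} → Symmetric F → ∂ i (∇ y F) ≋ ∇ y (∂ i F)
  ∂-∇ i y f w = ∑-cong (λ j → *-congˡ (swap f [] j i w))

  -- Symmetry carries the index `j` of the direction past both copies of `i`.
  Δ-∇ : ∀ y {F} → Symmetric F → Δ (∇ y F) ≋ ∇ y (Δ F)
  Δ-∇ y {F} f w = begin
    ∑[ i < n ] ∑[ j < n ] (y j * F (j ∷ i ∷ i ∷ w))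
      ≈⟨ ∑-comm _ ⟩
    ∑[ j < n ] ∑[ i < n ] (y j * F (j ∷ i ∷ i ∷ w))
      ≈⟨ ∑-cong (λ j → trans
           (∑-cong (λ i → *-congˡ (trans (swap f [] j i _) (swap f (i ∷ []) j i w))))
           (sym (*-distribˡ-∑ (y j) _))) ⟩
    ∑[ j < n ] (y j * ∑[ i < n ] F (i ∷ i ∷ j ∷ w)) ∎

  -- t! times the Fischer pairing (F(∂) G)(0) of the parts of degree t.
  ⟨_,_⟩_ : Poly → Poly → ℕ → Carrier
  ⟨ F , G ⟩ zero  = F [] * G []
  ⟨ F , G ⟩ suc t = ∑[ i < n ] ⟨ ∂ i F , ∂ i G ⟩ t

  pair-cong : ∀ t {F F′ G G′} → F ≋ F′ → G ≋ G′ → ⟨ F , G ⟩ t ≈ ⟨ F′ , G′ ⟩ t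
  pair-cong zero    f g = *-cong (f []) (g [])
  pair-cong (suc t) f g = ∑-cong (λ i → pair-cong t (λ w → f (i ∷ w)) (λ w → g (i ∷ w)))

  pair-comm : ∀ t F G → ⟨ F , G ⟩ t ≈ ⟨ G , F ⟩ t
  pair-comm zero    F G = *-comm _ _
  pair-comm (suc t) F G = ∑-cong (λ i → pair-comm t (∂ i F) (∂ i G))

  pair-⊕ : ∀ t F F′ G → ⟨ F ⊕ F′ , G ⟩ t ≈ ⟨ F , G ⟩ t + ⟨ F′ , G ⟩ t
  pair-⊕ zero    F F′ G = distribʳ _ _ _
  pair-⊕ (suc t) F F′ G = trans (∑-cong (λ i → pair-⊕ t (∂ i F) (∂ i F′) (∂ i G))) (∑-distrib-+ _ _)

  pair-⊙ : ∀ t a F G → ⟨ a ⊙ F , G ⟩ t ≈ a * ⟨ F , G ⟩ t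
  pair-⊙ zero    a F G = *-assoc _ _ _
  pair-⊙ (suc t) a F G = trans (∑-cong (λ i → pair-⊙ t a (∂ i F) (∂ i G))) (sym (*-distribˡ-∑ a _))

  pair-∑ : ∀ t {k} (F : Fin k → Poly) G → ⟨ (λ w → ∑[ j < k ] F j w) , G ⟩ t ≈ ∑[ j < k ] ⟨ F j , G ⟩ t
  pair-∑ zero    F G = *-distribʳ-∑ (G []) (λ j → F j [])
  pair-∑ (suc t) F G = trans (∑-cong (λ i → pair-∑ t (λ j → ∂ i (F j)) (∂ i G))) (∑-comm _)

  pair-∇ : ∀ t y F G → ∑[ i < n ] (y i * ⟨ F , ∂ i G ⟩ t) ≈ ⟨ F , ∇ y G ⟩ t
  pair-∇ t y F G = begin
    ∑[ i < n ] (y i * ⟨ F , ∂ i G ⟩ t)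
      ≈⟨ ∑-cong (λ i → trans (*-congˡ (pair-comm t F (∂ i G))) (sym (pair-⊙ t (y i) (∂ i G) F))) ⟩
    ∑[ i < n ] ⟨ y i ⊙ ∂ i G , F ⟩ t
      ≈⟨ pair-∑ t (λ i → y i ⊙ ∂ i G) F ⟨
    ⟨ ∇ y G , F ⟩ t
      ≈⟨ pair-comm t _ _ ⟩
    ⟨ F , ∇ y G ⟩ t ∎

  -- Multiplication by a linear form is adjoint to the derivative in its direction. The factor
  -- `ι (suc t)` is the ratio of the factorials contained in the two pairings.
  pair-lin : ∀ t y F {G} → Symmetric G → ⟨ lin y F , G ⟩ suc t ≈ ι (suc t) * ⟨ F , ∇ y G ⟩ t
  pair-lin t y F {G} g = begin
    ∑[ i < n ] ⟨ y i ⊙ F ⊕ lin y (∂ i F) , ∂ i G ⟩ t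
      ≈⟨ ∑-cong (λ i → trans (pair-⊕ t _ _ _) (+-congʳ (pair-⊙ t (y i) F (∂ i G)))) ⟩
    ∑[ i < n ] (y i * ⟨ F , ∂ i G ⟩ t + ⟨ lin y (∂ i F) , ∂ i G ⟩ t)
      ≈⟨ ∑-distrib-+ _ _ ⟩
    ∑[ i < n ] (y i * ⟨ F , ∂ i G ⟩ t) + ∑[ i < n ] ⟨ lin y (∂ i F) , ∂ i G ⟩ t
      ≈⟨ +-cong (pair-∇ t y F G) (rest t F g) ⟩
    ⟨ F , ∇ y G ⟩ t + ι t * ⟨ F , ∇ y G ⟩ t
      ≈⟨ solve 2 (λ a b → a :+ b :* a := (:1 :+ b) :* a) refl _ _ ⟩
    ι (suc t) * ⟨ F , ∇ y G ⟩ t ∎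
    where
    -- The product rule leaves `lin y` applied to derivatives of `F`. They have one degree less, so
    -- `pair-lin` itself applies and contributes the other `t` copies.
    rest : ∀ t F {G} → Symmetric G →
           ∑[ i < n ] ⟨ lin y (∂ i F) , ∂ i G ⟩ t ≈ ι t * ⟨ F , ∇ y G ⟩ t
    rest zero    F     g = trans (∑-zero (λ i → zeroˡ _)) (sym (zeroˡ _))
    rest (suc t) F {G} g = begin
      ∑[ i < n ] ⟨ lin y (∂ i F) , ∂ i G ⟩ suc t
        ≈⟨ ∑-cong (λ i → pair-lin t y (∂ i F) (∂-symmetric i g)) ⟩
      ∑[ i < n ] (ι (suc t) * ⟨ ∂ i F , ∇ y (∂ i G) ⟩ t)
        ≈⟨ *-distribˡ-∑ (ι (suc t)) _ ⟨
      ι (suc t) * ∑[ i < n ] ⟨ ∂ i F , ∇ y (∂ i G) ⟩ t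
        ≈⟨ *-congˡ (∑-cong (λ i → pair-cong t (λ _ → refl) (λ w → sym (∂-∇ i y g w)))) ⟩
      ι (suc t) * ⟨ F , ∇ y G ⟩ suc t ∎

  pair-rsq : ∀ t F {G} → Symmetric G →
             ⟨ rsq F , G ⟩ suc (suc t) ≈ ι (suc (suc t)) * ι (suc t) * ⟨ F , Δ G ⟩ t
  pair-rsq t F {G} g = begin
    ⟨ rsq F , G ⟩ suc (suc t)
      ≈⟨ pair-∑ (suc (suc t)) (λ i → X i (X i F)) G ⟩
    ∑[ i < n ] ⟨ X i (X i F) , G ⟩ suc (suc t)
      ≈⟨ ∑-cong (λ i → begin
           ⟨ X i (X i F) , G ⟩ suc (suc t)
             ≈⟨ pair-lin (suc t) (δ i) (X i F) g ⟩
           ι (suc (suc t)) * ⟨ X i F , ∇ (δ i) G ⟩ suc t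
             ≈⟨ *-congˡ (pair-lin t (δ i) F (∇-symmetric (δ i) g)) ⟩
           ι (suc (suc t)) * (ι (suc t) * ⟨ F , ∇ (δ i) (∇ (δ i) G) ⟩ t)
             ≈⟨ *-assoc _ _ _ ⟨
           ι (suc (suc t)) * ι (suc t) * ⟨ F , ∇ (δ i) (∇ (δ i) G) ⟩ t
             ≈⟨ *-congˡ (pair-comm t _ _) ⟩
           ι (suc (suc t)) * ι (suc t) * ⟨ ∇ (δ i) (∇ (δ i) G) , F ⟩ t
             ≈⟨ *-congˡ (pair-cong t (λ w → trans (∇-δ i (∇ (δ i) G) w) (∇-δ i G (i ∷ w))) (λ _ → refl)) ⟩
           ι (suc (suc t)) * ι (suc t) * ⟨ ∂ i (∂ i G) , F ⟩ t ∎) ⟩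
    ∑[ i < n ] (ι (suc (suc t)) * ι (suc t) * ⟨ ∂ i (∂ i G) , F ⟩ t)
      ≈⟨ *-distribˡ-∑ (ι (suc (suc t)) * ι (suc t)) _ ⟨
    ι (suc (suc t)) * ι (suc t) * ∑[ i < n ] ⟨ ∂ i (∂ i G) , F ⟩ t
      ≈⟨ *-congˡ (trans (sym (pair-∑ t (λ i → ∂ i (∂ i G)) F)) (pair-comm t _ _)) ⟩
    ι (suc (suc t)) * ι (suc t) * ⟨ F , Δ G ⟩ t ∎

  -- t! times the value at y of the part of degree t.
  eval : ℕ → Vector Carrier n → Poly → Carrier
  eval zero    y F = F []
  eval (suc t) y F = eval t y (∇ y F)

  eval-cong : ∀ t y {F G} → F ≋ G → eval t y F ≈ eval t y G
  eval-cong zero    y F≋G = F≋G []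
  eval-cong (suc t) y F≋G = eval-cong t y (∇-cong y F≋G)

  eval-⊕ : ∀ t y F G → eval t y (F ⊕ G) ≈ eval t y F + eval t y G
  eval-⊕ zero    y F G = refl
  eval-⊕ (suc t) y F G = trans (eval-cong t y (∇-⊕ y F G)) (eval-⊕ t y _ _)

  eval-⊙ : ∀ t y a F → eval t y (a ⊙ F) ≈ a * eval t y F
  eval-⊙ zero    y a F = refl
  eval-⊙ (suc t) y a F = trans (eval-cong t y (∇-⊙ y a F)) (eval-⊙ t y a _)

  eval-∑ : ∀ t y {k} (F : Fin k → Poly) → eval t y (λ w → ∑[ j < k ] F j w) ≈ ∑[ j < k ] eval t y (F j)
  eval-∑ zero    y F = refl
  eval-∑ (suc t) y F = trans
    (eval-cong t y (λ w → trans (∑-cong (λ i → *-distribˡ-∑ (y i) _)) (∑-comm _)))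
    (eval-∑ t y (λ j → ∇ y (F j)))

  -- The factor `ι (suc t)` is the ratio of the factorials by which `eval` is scaled in degrees t +
  -- 1 and t.
  eval-lin : ∀ t z y F → eval (suc t) z (lin y F) ≈ ι (suc t) * dot z y * eval t z F
  eval-lin t z y F = begin
    eval t z (∇ z (lin y F))
      ≈⟨ trans (eval-cong t z (∇-lin z y F)) (trans (eval-⊕ t z _ _) (+-congʳ (eval-⊙ t z _ F))) ⟩
    dot z y * eval t z F + eval t z (lin y (∇ z F))
      ≈⟨ +-congˡ (rest t F) ⟩
    dot z y * eval t z F + ι t * dot z y * eval t z F
      ≈⟨ solve 3 (λ a b c → a :* b :+ c :* a :* b := (:1 :+ c) :* a :* b) refl _ _ _ ⟩
    ι (suc t) * dot z y * eval t z F ∎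
    where
    rest : ∀ t F → eval t z (lin y (∇ z F)) ≈ ι t * dot z y * eval t z F
    rest zero    F = sym (trans (*-congʳ (zeroˡ _)) (zeroˡ _))
    rest (suc t) F = eval-lin t z y (∇ z F)

  eval-rsq : ∀ t z F → eval (suc (suc t)) z (rsq F) ≈ ι (suc (suc t)) * ι (suc t) * dot z z * eval t z F
  eval-rsq t z F = begin
    eval (suc (suc t)) z (rsq F)
      ≈⟨ eval-∑ (suc (suc t)) z (λ i → X i (X i F)) ⟩
    ∑[ i < n ] eval (suc (suc t)) z (X i (X i F))
      ≈⟨ ∑-cong (λ i → begin
           eval (suc (suc t)) z (X i (X i F))
             ≈⟨ eval-lin (suc t) z (δ i) (X i F) ⟩
           ι (suc (suc t)) * dot z (δ i) * eval (suc t) z (X i F)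
             ≈⟨ *-cong (*-congˡ (dot-δ z i)) (trans (eval-lin t z (δ i) F) (*-congʳ (*-congˡ (dot-δ z i)))) ⟩
           ι (suc (suc t)) * z i * (ι (suc t) * z i * eval t z F)
             ≈⟨ solve 4 (λ a b c d → a :* c :* (b :* c :* d) := a :* b :* d :* (c :* c)) refl _ _ _ _ ⟩
           ι (suc (suc t)) * ι (suc t) * eval t z F * (z i * z i) ∎) ⟩
    ∑[ i < n ] (ι (suc (suc t)) * ι (suc t) * eval t z F * (z i * z i))
      ≈⟨ *-distribˡ-∑ (ι (suc (suc t)) * ι (suc t) * eval t z F) _ ⟨
    ι (suc (suc t)) * ι (suc t) * eval t z F * dot z z
      ≈⟨ solve 4 (λ a b c d → a :* b :* c :* d := a :* b :* d :* c) refl _ _ _ _ ⟩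
    ι (suc (suc t)) * ι (suc t) * dot z z * eval t z F ∎

-- Zonal harmonic polynomials in dimension m + 2 and their reproducing property

module ZonalHarmonics {c ℓ} (CR : CommutativeRing c ℓ) (m : ℕ) where
  open CommutativeRing CR hiding (zero)
  open FiniteSums CR
  open IntegerSolver CR
  open Polynomials CR (suc (suc m))
  open SetoidReasoning setoid

  -- From (t+2) C_{t+2} = (2(t+1) + m) ξ C_{t+1} - (t + m) C_t, the Gegenbauer recurrence for the
  -- parameter m/2, multiplied by (t+1)! and written for t! C_t.
  a b : ℕ → Carrier
  a t = ι 2 * ι t + ι m
  b t = ι (suc t) * (ι t + ι m)

  -- For a unit vector y, t! times the homogeneous polynomial
  -- x ↦ ∣x∣ᵗ C_t^(m/2) (dot y x / ∣x∣).
  K : Vector Carrier (suc (suc m)) → ℕ → Poly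
  K y zero          = 𝟙
  K y (suc zero)    = ι m ⊙ lin y 𝟙
  K y (suc (suc t)) = a (suc t) ⊙ lin y (K y (suc t)) ⊕ (- b t) ⊙ rsq (K y t)

  K-symmetric : ∀ y t → Symmetric (K y t)
  K-symmetric y zero          = 𝟙-symmetric
  K-symmetric y (suc zero)    = ⊙-symmetric _ (lin-symmetric y 𝟙-symmetric)
  K-symmetric y (suc (suc t)) = ⊕-symmetric
    (⊙-symmetric _ (lin-symmetric y (K-symmetric y (suc t))))
    (⊙-symmetric _ (rsq-symmetric (K-symmetric y t)))

  private
    ∇𝟙 : ∀ y w → ∇ y 𝟙 w ≈ 0#
    ∇𝟙 y w = ∑-zero (λ i → zeroʳ (y i))

    Δ𝟙 : ∀ w → Δ 𝟙 w ≈ 0#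
    Δ𝟙 w = ∑-zero (λ i → refl)

    euler-𝟙 : ∀ w → euler 𝟙 w ≈ 0#
    euler-𝟙 w = ∑-zero (λ i → lin-zero (δ i) (λ _ → refl) w)

  -- Homogeneity of degree t, in the form in which `Δ-K` uses it to evaluate the Euler term of
  -- `Δ-rsq`.
  euler-K : ∀ y t → euler (K y t) ≋ ι t ⊙ K y t
  euler-K y zero w = trans (euler-𝟙 w) (sym (zeroˡ _))
  euler-K y (suc zero) w = begin
    euler (ι m ⊙ lin y 𝟙) w
      ≈⟨ euler-⊙ (ι m) (lin y 𝟙) w ⟩
    ι m * euler (lin y 𝟙) w
      ≈⟨ *-congˡ (trans (euler-lin y 𝟙 w) (+-congˡ (lin-zero y euler-𝟙 w))) ⟩
    ι m * (lin y 𝟙 w + 0#)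
      ≈⟨ solve 2 (λ m l → m :* (l :+ :0) := :ι 1 :* (m :* l)) refl _ _ ⟩
    ι 1 * (ι m * lin y 𝟙 w) ∎
  euler-K y (suc (suc t)) w = begin
    euler (K y (suc (suc t))) w
      ≈⟨ euler-scale-⊕ (a (suc t)) (- b t) (lin y K₁) (rsq K₀) w ⟩
    a (suc t) * euler (lin y K₁) w + - b t * euler (rsq K₀) w
      ≈⟨ +-cong
           (*-congˡ (trans (euler-lin y K₁ w) (+-congˡ (trans
             (lin-cong y (euler-K y (suc t)) w) (lin-⊙ y _ K₁ w)))))
           (*-congˡ (trans (euler-rsq K₀ w) (+-congˡ (trans
             (rsq-cong (euler-K y t) w) (rsq-⊙ _ K₀ w))))) ⟩
    a (suc t) * (lin y K₁ w + ι (suc t) * lin y K₁ w) + - b t * (ι 2 * rsq K₀ w + ι t * rsq K₀ w)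
      ≈⟨ solve 5 (λ a b t l r → a :* (l :+ (:1 :+ t) :* l) :+ b :* (:ι 2 :* r :+ t :* r)
           := (:1 :+ (:1 :+ t)) :* (a :* l :+ b :* r)) refl (a (suc t)) (- b t) (ι t) _ _ ⟩
    ι (suc (suc t)) * K y (suc (suc t)) w ∎
    where
    K₀ = K y t
    K₁ = K y (suc t)

  module _ (y : Vector Carrier (suc (suc m))) (unit : dot y y ≈ 1#) where

    private
      ∇-step : ∀ t w → ∇ y (K y (suc (suc t))) w ≈
        a (suc t) * (K y (suc t) w + lin y (∇ y (K y (suc t))) w)
        + - b t * (ι 2 * lin y (K y t) w + rsq (∇ y (K y t)) w)
      ∇-step t w = trans (∇-⊕ y (a (suc t) ⊙ lin y (K y (suc t))) (- b t ⊙ rsq (K y t)) w) (+-cong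
        (trans (∇-⊙ y _ (lin y (K y (suc t))) w) (*-congˡ (trans (∇-lin y y (K y (suc t)) w)
          (+-congʳ (trans (*-congʳ unit) (*-identityˡ _))))))
        (trans (∇-⊙ y _ (rsq (K y t)) w) (*-congˡ (∇-rsq y (K y t) w))))

    -- The derivative of a zonal harmonic along its own axis is a multiple of the one of next lower
    -- degree. `Δ (lin y F)` has a cross term `∇ y F`; through this formula it becomes a multiple of
    -- `K y t` that can cancel in `Δ-K`.
    ∇-K : ∀ t → ∇ y (K y (suc t)) ≋ b t ⊙ K y t
    ∇-K zero w = begin
      ∇ y (ι m ⊙ lin y 𝟙) w
        ≈⟨ ∇-⊙ y _ (lin y 𝟙) w ⟩
      ι m * ∇ y (lin y 𝟙) w
        ≈⟨ *-congˡ (trans (∇-lin y y 𝟙 w) (+-cong (*-congʳ unit) (lin-zero y (∇𝟙 y) w))) ⟩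
      ι m * (1# * 𝟙 w + 0#)
        ≈⟨ solve 2 (λ m o → m :* (:1 :* o :+ :0) := :ι 1 :* (:0 :+ m) :* o) refl _ _ ⟩
      b 0 * 𝟙 w ∎
    ∇-K (suc zero) w = begin
      ∇ y (K y 2) w
        ≈⟨ ∇-step 0 w ⟩
      a 1 * (ι m * lin y 𝟙 w + lin y (∇ y (K y 1)) w) + - b 0 * (ι 2 * lin y 𝟙 w + rsq (∇ y 𝟙) w)
        ≈⟨ +-cong (*-congˡ (+-congˡ (trans (lin-cong y (∇-K zero) w) (lin-⊙ y _ 𝟙 w))))
             (*-congˡ (+-congˡ (rsq-zero (∇𝟙 y) w))) ⟩
      a 1 * (ι m * lin y 𝟙 w + b 0 * lin y 𝟙 w) + - b 0 * (ι 2 * lin y 𝟙 w + 0#)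
        ≈⟨ solve 2 (λ m l →
             (:ι 2 :* :ι 1 :+ m) :* (m :* l :+ (:ι 1 :* (:0 :+ m)) :* l)
               :+ :- (:ι 1 :* (:0 :+ m)) :* (:ι 2 :* l :+ :0)
             := :ι 2 :* (:ι 1 :+ m) :* (m :* l)) refl (ι m) (lin y 𝟙 w) ⟩
      b 1 * K y 1 w ∎
    ∇-K (suc (suc t)) w = begin
      ∇ y (K y (suc (suc (suc t)))) w
        ≈⟨ ∇-step (suc t) w ⟩
      a (suc (suc t)) * (K₂ w + lin y (∇ y K₂) w) + - b (suc t) * (ι 2 * lin y K₁ w + rsq (∇ y K₁) w)
        ≈⟨ +-cong
             (*-congˡ (+-congˡ (trans (lin-cong y (∇-K (suc t)) w) (lin-⊙ y _ K₁ w))))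
             (*-congˡ (+-congˡ (trans (rsq-cong (∇-K t) w) (rsq-⊙ _ K₀ w)))) ⟩
      a (suc (suc t)) * (K₂ w + b (suc t) * lin y K₁ w) + - b (suc t) * (ι 2 * lin y K₁ w + b t * rsq K₀ w)
        -- Once `K₂` is expanded by its recurrence, both sides are combinations of `lin y K₁` and
        -- `rsq K₀`.
        ≈⟨ solve 4 (λ t m l r →
             let a₁ = :ι 2 :* (:1 :+ t) :+ m
                 a₂ = :ι 2 :* (:1 :+ (:1 :+ t)) :+ m
                 b₀ = (:1 :+ t) :* (t :+ m)
                 b₁ = (:1 :+ (:1 :+ t)) :* (:1 :+ t :+ m)
                 b₂ = (:1 :+ (:1 :+ (:1 :+ t))) :* (:1 :+ (:1 :+ t) :+ m)
                 k₂ = a₁ :* l :+ :- b₀ :* r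
             in a₂ :* (k₂ :+ b₁ :* l) :+ :- b₁ :* (:ι 2 :* l :+ b₀ :* r) := b₂ :* k₂)
             refl (ι t) (ι m) (lin y K₁ w) (rsq K₀ w) ⟩
      b (suc (suc t)) * K₂ w ∎
      where
      K₀ = K y t
      K₁ = K y (suc t)
      K₂ = K y (suc (suc t))

    -- If the two previous polynomials are harmonic, the recurrence leaves `b t * K y t` times 2
    -- (2(t+1) + m) - (2(m+2) + 4t). This is zero precisely because the dimension is m + 2.
    Δ-K : ∀ t w → Δ (K y t) w ≈ 0#
    Δ-K zero          w = Δ𝟙 w
    Δ-K (suc zero)    w = begin
      ∑[ i < _ ] (ι m * lin y 𝟙 (i ∷ i ∷ w))
        ≈⟨ *-distribˡ-∑ (ι m) _ ⟨
      ι m * Δ (lin y 𝟙) w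
        ≈⟨ *-congˡ (trans (Δ-lin y 𝟙 w) (+-cong (*-congˡ (∇𝟙 y w)) (lin-zero y Δ𝟙 w))) ⟩
      ι m * (ι 2 * 0# + 0#)
        ≈⟨ solve 1 (λ m → m :* (:ι 2 :* :0 :+ :0) := :0) refl _ ⟩
      0# ∎
    Δ-K (suc (suc t)) w = begin
      Δ (K y (suc (suc t))) w
        ≈⟨ Δ-scale-⊕ (a (suc t)) (- b t) (lin y K₁) (rsq K₀) w ⟩
      a (suc t) * Δ (lin y K₁) w + - b t * Δ (rsq K₀) w
        ≈⟨ +-cong
             (*-congˡ (trans (Δ-lin y K₁ w) (+-cong (*-congˡ (∇-K t w)) (lin-zero y (Δ-K (suc t)) w))))
             (*-congˡ (trans (Δ-rsq K₀ w) (+-congˡ (+-cong (*-congˡ (euler-K y t w)) (rsq-zero (Δ-K t) w))))) ⟩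
      a (suc t) * (ι 2 * (b t * K₀ w) + 0#)
        + - b t * (ι 2 * ι (suc (suc m)) * K₀ w + (ι 4 * (ι t * K₀ w) + 0#))
        ≈⟨ solve 4 (λ t m b k →
             (:ι 2 :* (:1 :+ t) :+ m) :* (:ι 2 :* (b :* k) :+ :0)
               :+ :- b :* (:ι 2 :* (:1 :+ (:1 :+ m)) :* k :+ (:ι 4 :* (t :* k) :+ :0))
             := :0) refl (ι t) (ι m) (b t) (K₀ w) ⟩
      0# ∎
      where
      K₀ = K y t
      K₁ = K y (suc t)

  -- Collects the leading coefficients `a` of the recurrence and the factors of `pair-lin`. The
  -- value `a 0 = m` fits the separately defined `K y 1`.
  weight : ℕ → Carrier
  weight zero    = 1#
  weight (suc t) = weight t * (a t * ι (suc t))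

  -- Multiplication by dot x x is adjoint to Δ, so against a harmonic
  -- polynomial only the leading term of K y t contributes.
  reproducing : ∀ t y {G} → Symmetric G → (∀ w → Δ G w ≈ 0#) →
                ⟨ K y t , G ⟩ t ≈ weight t * eval t y G
  reproducing zero          y g ΔG = refl
  reproducing (suc zero)    y {G} g ΔG = begin
    ⟨ ι m ⊙ lin y 𝟙 , G ⟩ 1
      ≈⟨ trans (pair-⊙ 1 (ι m) (lin y 𝟙) G) (*-congˡ (pair-lin 0 y 𝟙 g)) ⟩
    ι m * (ι 1 * (1# * ∇ y G []))
      ≈⟨ solve 2 (λ m x → m :* (:ι 1 :* (:1 :* x)) := (:1 :* ((:ι 2 :* :0 :+ m) :* :ι 1)) :* x)
           refl _ _ ⟩
    weight 1 * ∇ y G [] ∎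
  reproducing (suc (suc t)) y {G} g ΔG = begin
    ⟨ K y (suc (suc t)) , G ⟩ suc (suc t)
      ≈⟨ trans (pair-⊕ T (a (suc t) ⊙ lin y K₁) (- b t ⊙ rsq K₀) G)
           (+-cong (pair-⊙ T _ (lin y K₁) G) (pair-⊙ T _ (rsq K₀) G)) ⟩
    a (suc t) * ⟨ lin y K₁ , G ⟩ T + - b t * ⟨ rsq K₀ , G ⟩ T
      ≈⟨ +-cong (*-congˡ (trans (pair-lin (suc t) y K₁ g) (*-congˡ
             (reproducing (suc t) y (∇-symmetric y g) (λ w → trans (Δ-∇ y g w)
               (∑-zero (λ i → trans (*-congˡ (ΔG (i ∷ w))) (zeroʳ _))))))))
           (*-congˡ (trans (pair-rsq t K₀ g) (*-congˡ (pair-zero t K₀ ΔG)))) ⟩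
    a (suc t) * (ι T * (weight (suc t) * eval T y G)) + - b t * (ι T * ι (suc t) * 0#)
      ≈⟨ solve 6 (λ a b T u w e → a :* (T :* (w :* e)) :+ b :* (T :* u :* :0)
           := w :* (a :* T) :* e) refl (a (suc t)) (- b t) (ι T) (ι (suc t)) (weight (suc t)) _ ⟩
    weight T * eval T y G ∎
    where
    T = suc (suc t)
    K₀ = K y t
    K₁ = K y (suc t)
    pair-zero : ∀ t F {G} → (∀ w → G w ≈ 0#) → ⟨ F , G ⟩ t ≈ 0#
    pair-zero zero    F G≈0 = trans (*-congˡ (G≈0 [])) (zeroʳ _)
    pair-zero (suc t) F G≈0 = ∑-zero (λ i → pair-zero t (∂ i F) (λ w → G≈0 (i ∷ w)))

  pair-K : ∀ t y z → dot z z ≈ 1# → ⟨ K y t , K z t ⟩ t ≈ weight t * eval t y (K z t)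
  pair-K t y z unit = reproducing t y (K-symmetric z t) (Δ-K z unit t)

  eval-K₁ : ∀ y z → eval 1 y (K z 1) ≈ ι m * dot y z
  eval-K₁ y z = begin
    eval 1 y (ι m ⊙ lin z 𝟙)
      ≈⟨ trans (eval-⊙ 1 y (ι m) (lin z 𝟙)) (*-congˡ (eval-lin 0 y z 𝟙)) ⟩
    ι m * (ι 1 * dot y z * 1#)
      ≈⟨ solve 2 (λ m d → m :* (:ι 1 :* d :* :1) := m :* d) refl _ _ ⟩
    ι m * dot y z ∎

  eval-K₂ : ∀ t y z → dot y y ≈ 1# →
    eval (suc (suc t)) y (K z (suc (suc t))) ≈
      ι (suc (suc t)) * (a (suc t) * (dot y z * eval (suc t) y (K z (suc t)))
        - ι (suc t) * ι (suc t) * ((ι t + ι m) * eval t y (K z t)))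
  eval-K₂ t y z unit = begin
    eval T y (K z T)
      ≈⟨ trans (eval-⊕ T y (a (suc t) ⊙ lin z K₁) (- b t ⊙ rsq K₀))
           (+-cong (eval-⊙ T y _ (lin z K₁)) (eval-⊙ T y _ (rsq K₀))) ⟩
    a (suc t) * eval T y (lin z K₁) + - b t * eval T y (rsq K₀)
      ≈⟨ +-cong (*-congˡ (eval-lin (suc t) y z K₁))
           (*-congˡ (trans (eval-rsq t y K₀) (*-congʳ (*-congˡ unit)))) ⟩
    a (suc t) * (ι T * dot y z * eval (suc t) y K₁) + - b t * (ι T * ι (suc t) * 1# * eval t y K₀)
      ≈⟨ solve 7 (λ a T d e u v f → a :* (T :* d :* e) :+ :- (u :* v) :* (T :* u :* :1 :* f)
           := T :* (a :* (d :* e) :- u :* u :* (v :* f)))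
           refl (a (suc t)) (ι T) (dot y z) _ (ι (suc t)) (ι t + ι m) _ ⟩
    ι T * (a (suc t) * (dot y z * eval (suc t) y K₁) - ι (suc t) * ι (suc t) * ((ι t + ι m) * eval t y K₀)) ∎
    where
    T = suc (suc t)
    K₀ = K z t
    K₁ = K z (suc t)

-- The three-term recurrence for Gegenbauer polynomials from the binomial series

module GegenbauerRecurrence {c ℓ₁ ℓ₂ ℓ₃} (R : Reals c ℓ₁ ℓ₂ ℓ₃) where
  open Reals R hiding (zero)
  open FiniteSums commutativeRing hiding (ι; _·_)
  open IntegerSolver commutativeRing
  open SetoidReasoning setoid

  private
    shift : Series R → Series R
    shift f zero    = 0#
    shift f (suc t) = f t

    shift-cong : ∀ {f g : Series R} → (∀ t → f t ≈ g t) → ∀ t → shift f t ≈ shift g t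
    shift-cong f≈g zero    = refl
    shift-cong f≈g (suc t) = f≈g t

    shift-scale-+ : ∀ a b (f g : Series R) t →
                    shift (λ t → a * f t + b * g t) t ≈ a * shift f t + b * shift g t
    shift-scale-+ a b f g zero    = sym (solve 2 (λ a b → a :* :0 :+ b :* :0 := :0) refl a b)
    shift-scale-+ a b f g (suc t) = refl

    D : Series R → Series R
    D f t = ι t * f t

    D-shift : ∀ (f : Series R) t → D (shift f) t ≈ shift f t + shift (D f) t
    D-shift f zero    = solve 0 (:0 :* :0 := :0 :+ :0) refl
    D-shift f (suc t) = solve 2 (λ i x → (:1 :+ i) :* x := x :+ i :* x) refl (ι t) (f t)

    D-shift² : ∀ (f : Series R) t → D (shift (shift f)) t ≈ ι 2 * shift (shift f) t + shift (shift (D f)) t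
    D-shift² f t = begin
      D (shift (shift f)) t
        ≈⟨ D-shift (shift f) t ⟩
      shift (shift f) t + shift (D (shift f)) t
        ≈⟨ +-congˡ (trans (shift-cong (λ t → trans (D-shift f t) (sym (+-cong (*-identityˡ _) (*-identityˡ _)))) t)
             (shift-scale-+ 1# 1# _ _ t)) ⟩
      shift (shift f) t + (1# * shift (shift f) t + 1# * shift (shift (D f)) t)
        ≈⟨ solve 2 (λ a b → a :+ (:1 :* a :+ :1 :* b) := :ι 2 :* a :+ b) refl _ _ ⟩
      ι 2 * shift (shift f) t + shift (shift (D f)) t ∎

  module _ (ξ : Carrier) where

    private
      x : Carrier
      x = - (2 · ξ)

      P : ℕ → Series R
      P j = powˢ R (-2ξz+z² R ξ) j

      P-suc : ∀ j t → P (suc j) t ≈ x * shift (P j) t + 1# * shift (shift (P j)) t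
      P-suc j zero = solve 2 (λ x p → :0 :* p :+ :0 := x :* :0 :+ :1 :* :0) refl x (P j 0)
      P-suc j (suc zero) = solve 3 (λ x p p′ → :0 :* p :+ (x :* p′ :+ :0) := x :* p′ :+ :1 :* :0)
        refl x (P j 1) (P j 0)
      P-suc j (suc (suc t)) = begin
        0# * P j (suc (suc t)) + (x * P j (suc t) + (1# * P j t + rest))
          ≈⟨ +-congˡ (+-congˡ (+-congˡ (trans (sym (∑≈sum _)) (∑-zero {n = t} (λ i → zeroˡ _))))) ⟩
        0# * P j (suc (suc t)) + (x * P j (suc t) + (1# * P j t + 0#))
          ≈⟨ solve 3 (λ p q r → :0 :* p :+ (q :+ (r :+ :0)) := q :+ r) refl _ _ _ ⟩
        x * P j (suc t) + 1# * P j t ∎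
        where
        open MonoidSum +-monoid using (sum)
        rest : Carrier
        rest = sum {t} (λ i → 0# * P j (t ∸ suc (toℕ i)))

      shift-P : ∀ j t → shift (P (suc j)) t ≈ x * shift (shift (P j)) t + 1# * shift (shift (shift (P j))) t
      shift-P j t = trans (shift-cong (P-suc j) t) (shift-scale-+ x 1# _ _ t)

      shift²-P : ∀ j t → shift (shift (P (suc j))) t ≈
        x * shift (shift (shift (P j))) t + 1# * shift (shift (shift (shift (P j)))) t
      shift²-P j t = trans (shift-cong (shift-P j) t) (shift-scale-+ x 1# _ _ t)

      -- z d/dz (y ^ (j + 1)) = (j + 1) y ^ j (z dy/dz)
      D-P : ∀ j t → D (P (suc j)) t ≈ (ι (suc j) * x) * shift (P j) t + (ι (suc j) * ι 2) * shift (shift (P j)) t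
      D-P j t = begin
        ι t * P (suc j) t
          ≈⟨ *-congˡ (P-suc j t) ⟩
        ι t * (x * shift (P j) t + 1# * shift (shift (P j)) t)
          ≈⟨ solve 4 (λ i x a b → i :* (x :* a :+ :1 :* b) := x :* (i :* a) :+ i :* b) refl _ _ _ _ ⟩
        x * D (shift (P j)) t + D (shift (shift (P j))) t
          ≈⟨ +-cong (*-congˡ (D-shift (P j) t)) (D-shift² (P j) t) ⟩
        x * (shift (P j) t + shift (D (P j)) t) + (ι 2 * shift (shift (P j)) t + shift (shift (D (P j))) t)
          ≈⟨ rest j ⟩
        (ι (suc j) * x) * shift (P j) t + (ι (suc j) * ι 2) * shift (shift (P j)) t ∎
        where
        -- The derivative of a constant; zero is spelled as a linear combination so that
        -- `shift-scale-+` can carry it through the shifts.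
        D-P₀ : ∀ t → D (P 0) t ≈ 0# * 0# + 0# * 0#
        D-P₀ zero    = solve 0 (:0 :* :1 := :0 :* :0 :+ :0 :* :0) refl
        D-P₀ (suc t) = solve 1 (λ i → i :* :0 := :0 :* :0 :+ :0 :* :0) refl _

        rest : ∀ j → x * (shift (P j) t + shift (D (P j)) t)
                 + (ι 2 * shift (shift (P j)) t + shift (shift (D (P j))) t)
               ≈ (ι (suc j) * x) * shift (P j) t + (ι (suc j) * ι 2) * shift (shift (P j)) t
        rest zero = trans
          (+-cong (*-congˡ (+-congˡ (trans (shift-cong D-P₀ t) (shift-scale-+ 0# 0# _ _ t))))
            (+-congˡ (trans (shift-cong (λ t → trans (shift-cong D-P₀ t) (shift-scale-+ 0# 0# _ _ t)) t)
              (shift-scale-+ 0# 0# _ _ t))))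
          (solve 7 (λ x a b c d e f →
             x :* (a :+ (:0 :* c :+ :0 :* d)) :+ (:ι 2 :* b :+ (:0 :* e :+ :0 :* f))
             := (:ι 1 :* x) :* a :+ (:ι 1 :* :ι 2) :* b) refl x _ _ _ _ _ _)
        -- Everything is expressed in shifts of `P i`: the power `P (suc i)` by its recursion, its
        -- derivative by `D-P i`.
        rest (suc i) = trans
          (+-cong (*-congˡ (+-cong (shift-P i t) (trans (shift-cong (D-P i) t) (shift-scale-+ _ _ _ _ t))))
            (+-cong (*-congˡ (shift²-P i t)) (trans
              (shift-cong (λ t → trans (shift-cong (D-P i) t) (shift-scale-+ _ _ _ _ t)) t)
              (shift-scale-+ _ _ _ _ t))))
          (trans (solve 5 (λ x j b c d →
             x :* ((x :* b :+ :1 :* c) :+ (((:1 :+ j) :* x) :* b :+ ((:1 :+ j) :* :ι 2) :* c))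
               :+ (:ι 2 :* (x :* c :+ :1 :* d) :+ (((:1 :+ j) :* x) :* c :+ ((:1 :+ j) :* :ι 2) :* d))
             := ((:1 :+ (:1 :+ j)) :* x) :* (x :* b :+ :1 :* c)
               :+ ((:1 :+ (:1 :+ j)) :* :ι 2) :* (x :* c :+ :1 :* d)) refl x (ι i) _ _ _)
            (sym (+-cong (*-congˡ (shift-P i t)) (*-congˡ (shift²-P i t)))))

      P-vanish : ∀ j t → t ℕ.< j → P j t ≈ 0#
      P-vanish (suc j) t t<j = trans (P-suc j t) (trans
        (+-cong (*-congˡ (shift-vanish t t<j)) (*-congˡ (shift²-vanish t t<j)))
        (solve 1 (λ x → x :* :0 :+ :1 :* :0 := :0) refl x))
        where
        shift-vanish : ∀ t → t ℕ.< suc j → shift (P j) t ≈ 0#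
        shift-vanish zero    _           = refl
        shift-vanish (suc t) (ℕ.s≤s t<j) = P-vanish j t t<j
        shift²-vanish : ∀ t → t ℕ.< suc j → shift (shift (P j)) t ≈ 0#
        shift²-vanish zero          _           = refl
        shift²-vanish (suc zero)    _           = refl
        shift²-vanish (suc (suc t)) (ℕ.s≤s t<j) = P-vanish j t (ℕ.<⇒≤ t<j)

    module _ (β : Carrier) where

      private
        B : ℕ → Carrier
        B = binomial R β

        B-suc : ∀ j → B (suc j) * ι (suc j) ≈ B j * (β - ι j)
        B-suc j = quotient-* R _ (ι (suc j)) (ι#0 R (suc j))

        S : ℕ → Series R
        S J t = ∑[ j < J ] (B (toℕ j) * P (toℕ j) t)

        shift-S : ∀ J t → shift (S J) t ≈ ∑[ j < J ] (B (toℕ j) * shift (P (toℕ j)) t)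
        shift-S J zero    = sym (∑-zero {n = J} (λ j → zeroʳ _))
        shift-S J (suc t) = refl

        shift²-S : ∀ J t → shift (shift (S J)) t ≈ ∑[ j < J ] (B (toℕ j) * shift (shift (P (toℕ j))) t)
        shift²-S J zero          = sym (∑-zero {n = J} (λ j → zeroʳ _))
        shift²-S J (suc zero)    = sym (∑-zero {n = J} (λ j → zeroʳ _))
        shift²-S J (suc (suc t)) = refl

        -- The coefficient form of (1+y) D f = β (D y) f for f = (1+y)^β, y = xz + z² and D = z
        -- d/dz. It holds term by term, the term j + 1 on the left matching the term j on the right,
        -- so it is exact for truncated sums whose lengths differ by one.
        D-S : ∀ J t → ι t * S (suc J) t ≈
              ((β + 1# - ι t) * x) * shift (S J) t + (ι 2 * β + ι 2 - ι t) * shift (shift (S J)) t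
        D-S J t = begin
          ι t * S (suc J) t
            ≈⟨ *-congˡ (∑-suc _) ⟩
          ι t * (1# * oneˢ R t + ∑[ j < J ] (B (suc (toℕ j)) * P (suc (toℕ j)) t))
            ≈⟨ trans (distribˡ _ _ _) (+-cong (D-one t) (*-distribˡ-∑ (ι t) _)) ⟩
          0# + ∑[ j < J ] (ι t * (B (suc (toℕ j)) * P (suc (toℕ j)) t))
            ≈⟨ +-identityˡ _ ⟩
          ∑[ j < J ] (ι t * (B (suc (toℕ j)) * P (suc (toℕ j)) t))
            ≈⟨ ∑-cong {J} (λ j → term (toℕ j)) ⟩
          ∑[ j < J ] (((β + 1# - ι t) * x) * (B (toℕ j) * shift (P (toℕ j)) t)
                      + (ι 2 * β + ι 2 - ι t) * (B (toℕ j) * shift (shift (P (toℕ j))) t))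
            ≈⟨ ∑-scale-+ {J} _ _ _ _ ⟩
          ((β + 1# - ι t) * x) * ∑[ j < J ] (B (toℕ j) * shift (P (toℕ j)) t)
            + (ι 2 * β + ι 2 - ι t) * ∑[ j < J ] (B (toℕ j) * shift (shift (P (toℕ j))) t)
            ≈⟨ +-cong (*-congˡ (shift-S J t)) (*-congˡ (shift²-S J t)) ⟨
          ((β + 1# - ι t) * x) * shift (S J) t + (ι 2 * β + ι 2 - ι t) * shift (shift (S J)) t ∎
          where
          D-one : ∀ t → ι t * (1# * oneˢ R t) ≈ 0#
          D-one zero    = zeroˡ _
          D-one (suc t) = trans (*-congˡ (zeroʳ _)) (zeroʳ _)

          term : ∀ j → ι t * (B (suc j) * P (suc j) t) ≈
            ((β + 1# - ι t) * x) * (B j * shift (P j) t) + (ι 2 * β + ι 2 - ι t) * (B j * shift (shift (P j)) t)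
          term j = begin
            ι t * (B (suc j) * P (suc j) t)
              ≈⟨ solve 3 (λ i b p → i :* (b :* p) := b :* (i :* p)) refl _ _ _ ⟩
            B (suc j) * D (P (suc j)) t
              ≈⟨ *-congˡ (D-P j t) ⟩
            B (suc j) * ((ι (suc j) * x) * p₁ + (ι (suc j) * ι 2) * p₂)
              ≈⟨ solve 5 (λ b j x p q → b :* ((j :* x) :* p :+ (j :* :ι 2) :* q)
                   := b :* j :* (x :* p :+ :ι 2 :* q)) refl _ _ _ _ _ ⟩
            B (suc j) * ι (suc j) * (x * p₁ + ι 2 * p₂)
              ≈⟨ *-congʳ (B-suc j) ⟩
            B j * (β - ι j) * (x * p₁ + ι 2 * p₂)
              -- Here β - j is written as (β + 1) - (j + 1). The second part is again the derivative
              -- of `P (suc j)`, that is `t` times its coefficient, and so `j` disappears.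
              ≈⟨ solve 6 (λ b β j x p q → b :* (β :- j) :* (x :* p :+ :ι 2 :* q)
                   := b :* (β :+ :1) :* (x :* p :+ :ι 2 :* q)
                      :- b :* (((:1 :+ j) :* x) :* p :+ ((:1 :+ j) :* :ι 2) :* q)) refl _ _ _ _ _ _ ⟩
            B j * (β + 1#) * (x * p₁ + ι 2 * p₂) - B j * ((ι (suc j) * x) * p₁ + (ι (suc j) * ι 2) * p₂)
              ≈⟨ +-congˡ (-‿cong (*-congˡ (trans (sym (D-P j t)) (*-congˡ (P-suc j t))))) ⟩
            B j * (β + 1#) * (x * p₁ + ι 2 * p₂) - B j * (ι t * (x * p₁ + 1# * p₂))
              ≈⟨ solve 6 (λ b β i x p q →
                   b :* (β :+ :1) :* (x :* p :+ :ι 2 :* q) :- b :* (i :* (x :* p :+ :1 :* q))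
                   := ((β :+ :1 :- i) :* x) :* (b :* p) :+ (:ι 2 :* β :+ :ι 2 :- i) :* (b :* q))
                   refl _ _ _ _ _ _ ⟩
            ((β + 1# - ι t) * x) * (B j * p₁) + (ι 2 * β + ι 2 - ι t) * (B j * p₂) ∎
            where
            p₁ = shift (P j) t
            p₂ = shift (shift (P j)) t

      series≈S : ∀ t → ([1+_]^_ R (-2ξz+z² R ξ) β) t ≈ S (suc t) t
      series≈S t = sym (∑≈sum _)

      power₀ : ([1+_]^_ R (-2ξz+z² R ξ) β) 0 ≈ 1#
      power₀ = solve 0 (:1 :* :1 :+ :0 := :1) refl

      power₁ : ([1+_]^_ R (-2ξz+z² R ξ) β) 1 ≈ β * x
      power₁ = begin
        ([1+_]^_ R (-2ξz+z² R ξ) β) 1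
          ≈⟨ series≈S 1 ⟩
        S 2 1
          ≈⟨ solve 1 (λ s → s := :ι 1 :* s) refl _ ⟩
        ι 1 * S 2 1
          ≈⟨ D-S 1 1 ⟩
        ((β + 1# - ι 1) * x) * S 1 0 + (ι 2 * β + ι 2 - ι 1) * 0#
          ≈⟨ +-congʳ (*-congˡ (trans (sym (series≈S 0)) power₀)) ⟩
        ((β + 1# - ι 1) * x) * 1# + (ι 2 * β + ι 2 - ι 1) * 0#
          ≈⟨ solve 2 (λ β x → ((β :+ :1 :- :ι 1) :* x) :* :1 :+ (:ι 2 :* β :+ :ι 2 :- :ι 1) :* :0
               := β :* x) refl β x ⟩
        β * x ∎

      power₂ : ∀ t → ι (suc (suc t)) * ([1+_]^_ R (-2ξz+z² R ξ) β) (suc (suc t)) ≈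
        ((β + 1# - ι (suc (suc t))) * x) * ([1+_]^_ R (-2ξz+z² R ξ) β) (suc t)
        + (ι 2 * β + ι 2 - ι (suc (suc t))) * ([1+_]^_ R (-2ξz+z² R ξ) β) t
      power₂ t = trans (*-congˡ (series≈S (suc (suc t)))) (trans (D-S (suc (suc t)) (suc (suc t)))
        (+-cong (*-congˡ (sym (series≈S (suc t)))) (*-congˡ (begin
          S (suc (suc t)) t
            -- `D-S` sums one power more than the coefficient of degree `t` does by definition; that
            -- power of y starts in degree t + 1.
            ≈⟨ ∑-last (suc t) (λ j → B j * P j t) ⟩
          S (suc t) t + B (suc t) * P (suc t) t
            ≈⟨ +-congˡ (trans (*-congˡ (P-vanish (suc t) t ℕ.≤-refl)) (zeroʳ _)) ⟩
          S (suc t) t + 0#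
            ≈⟨ trans (+-identityʳ _) (sym (series≈S t)) ⟩
          ([1+_]^_ R (-2ξz+z² R ξ) β) t ∎))))

  gegenbauer₀ : ∀ α ξ → gegenbauer R α 0 ξ ≈ 1#
  gegenbauer₀ α ξ = power₀ ξ (- α)

  gegenbauer₁ : ∀ α ξ → gegenbauer R α 1 ξ ≈ ι 2 * α * ξ
  gegenbauer₁ α ξ = trans (power₁ ξ (- α))
    (solve 2 (λ α ξ → :- α :* :- (2 :· ξ) := :ι 2 :* α :* ξ) refl α ξ)

  gegenbauer₂ : ∀ α t ξ → ι (suc (suc t)) * gegenbauer R α (suc (suc t)) ξ ≈
    (ι 2 * ι (suc t) + ι 2 * α) * (ξ * gegenbauer R α (suc t) ξ) - (ι t + ι 2 * α) * gegenbauer R α t ξ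
  gegenbauer₂ α t ξ = trans (power₂ ξ (- α) t)
    (solve 5 (λ α i ξ g h →
       ((:- α :+ :1 :- (:1 :+ (:1 :+ i))) :* :- (2 :· ξ)) :* g
         :+ (:ι 2 :* :- α :+ :ι 2 :- (:1 :+ (:1 :+ i))) :* h
       := (:ι 2 :* (:1 :+ i) :+ :ι 2 :* α) :* (ξ :* g) :- (i :+ :ι 2 :* α) :* h)
       refl α (ι t) ξ _ _)

-- Constructive inequalities

module RealInequalities {c ℓ₁ ℓ₂ ℓ₃} (R : Reals c ℓ₁ ℓ₂ ℓ₃) where
  open Reals R hiding (zero)
  open FiniteSums commutativeRing hiding (ι; _·_)
  open IntegerSolver commutativeRing
  open IsStrictPartialOrder isStrictPartialOrder public
    using (asym; <-respˡ-≈; <-respʳ-≈) renaming (irrefl to <-irrefl)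
  open HeytingProperties heytingCommutativeRing using (x-0≈x)
  open SetoidReasoning setoid

  ≤-respʳ-≈ : ∀ {x y z} → x ≈ y → z ≤ x → z ≤ y
  ≤-respʳ-≈ x≈y z≤x y<z = z≤x (<-respˡ-≈ (sym x≈y) y<z)

  <⇒≤ : ∀ {x y} → x < y → x ≤ y
  <⇒≤ = asym

  ≤-refl : ∀ {x} → x ≤ x
  ≤-refl = <-irrefl refl

  -- Cotransitivity places `x` against `x + y < 0`: either `x < 0`, or `x + y < x` and hence
  -- `y < 0`.
  +-nonneg : ∀ {x y} → 0# ≤ x → 0# ≤ y → 0# ≤ x + y
  +-nonneg {x} {y} 0≤x 0≤y x+y<0 with <-cotrans x+y<0 x
  ... | inj₂ x<0 = 0≤x x<0
  ... | inj₁ x+y<x = 0≤y (<-respˡ-≈ (solve 2 (λ x y → x :+ y :- x := y) refl x y)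
                       (<-respʳ-≈ (-‿inverseʳ x) (+-monoˡ-< (- x) x+y<x)))

  x<y⇒0<y-x : ∀ {x y} → x < y → 0# < y - x
  x<y⇒0<y-x {x} x<y = <-respˡ-≈ (-‿inverseʳ x) (+-monoˡ-< (- x) x<y)

  0<y-x⇒x<y : ∀ {x y} → 0# < y - x → x < y
  0<y-x⇒x<y {x} {y} 0<y-x = <-respˡ-≈ (+-identityˡ x)
    (<-respʳ-≈ (solve 2 (λ x y → y :- x :+ x := y) refl x y) (+-monoˡ-< x 0<y-x))

  x<0⇒0<-x : ∀ {x} → x < 0# → 0# < - x
  x<0⇒0<-x {x} x<0 = <-respʳ-≈ (+-identityˡ _) (x<y⇒0<y-x x<0)

  0<-x⇒x<0 : ∀ {x} → 0# < - x → x < 0#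
  0<-x⇒x<0 0<-x = 0<y-x⇒x<y (<-respʳ-≈ (sym (+-identityˡ _)) 0<-x)

  0≤y-x⇒x≤y : ∀ {x y} → 0# ≤ y - x → x ≤ y
  0≤y-x⇒x≤y {x} {y} 0≤y-x y<x = 0≤y-x (0<-x⇒x<0 (<-respʳ-≈
    (solve 2 (λ x y → x :- y := :- (y :- x)) refl x y) (x<y⇒0<y-x y<x)))

  #0⇒0<x² : ∀ {x} → x # 0# → 0# < x * x
  #0⇒0<x² {x} x#0 with #⇒<⊎> x#0
  ... | inj₂ 0<x = *-pos 0<x 0<x
  ... | inj₁ x<0 = <-respʳ-≈ (solve 1 (λ x → :- x :* :- x := x :* x) refl x)
                     (*-pos (x<0⇒0<-x x<0) (x<0⇒0<-x x<0))

  ¬#⇒≈ : ∀ {x y} → ¬ (x # y) → x ≈ y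
  ¬#⇒≈ = proj₁ (tight _ _)

  -- The sign of `x` is undecidable. If the square were negative, `x` could not be apart from zero,
  -- so tightness would make it zero and its square as well.
  x²-nonneg : ∀ x → 0# ≤ x * x
  x²-nonneg x x²<0 = ≤-refl (<-respˡ-≈ (trans (*-congˡ x≈0) (zeroʳ x)) x²<0)
    where
    x≈0 : x ≈ 0#
    x≈0 = ¬#⇒≈ (λ x#0 → asym x²<0 (#0⇒0<x² x#0))

  x²≤0⇒x≈0 : ∀ {x} → x * x ≤ 0# → x ≈ 0#
  x²≤0⇒x≈0 x²≤0 = ¬#⇒≈ (λ x#0 → x²≤0 (#0⇒0<x² x#0))

  ≤∧≥⇒≈0 : ∀ {x} → 0# ≤ x → x ≤ 0# → x ≈ 0#
  ≤∧≥⇒≈0 0≤x x≤0 = ¬#⇒≈ (λ x#0 → case (#⇒<⊎> x#0))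
    where
    case : _ ⊎ _ → _
    case (inj₁ x<0) = 0≤x x<0
    case (inj₂ 0<x) = x≤0 0<x

  0≤⇒0<1+ : ∀ {x} → 0# ≤ x → 0# < 1# + x
  0≤⇒0<1+ {x} 0≤x with <-cotrans 0<1 (1# + x)
  ... | inj₁ 0<1+x = 0<1+x
  ... | inj₂ 1+x<1 = contradiction (<-respˡ-≈ (solve 1 (λ x → :1 :+ x :- :1 := x) refl x)
                       (<-respʳ-≈ (-‿inverseʳ 1#) (+-monoˡ-< (- 1#) 1+x<1))) 0≤x

  *-nonneg-pos : ∀ {a x} → 0# < a → 0# ≤ x → 0# ≤ a * x
  *-nonneg-pos {a} {x} 0<a 0≤x ax<0 with #⇒invertible (#-sym (<⇒# 0<a))
  ... | u , u*a≈1 , _ = 0≤x (0<-x⇒x<0 (<-respʳ-≈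
      (begin
        -- `u * u * a` is the inverse of `a` in a form whose positivity is evident.
        u * u * a * - (a * x)  ≈⟨ solve 3 (λ u a x → u :* u :* a :* :- (a :* x) := :- ((u :* (a :- :0)) :* (u :* (a :- :0)) :* x)) refl u a x ⟩
        - (u * (a - 0#) * (u * (a - 0#)) * x)  ≈⟨ -‿cong (*-congʳ (*-cong u*a≈1 u*a≈1)) ⟩
        - (1# * 1# * x)        ≈⟨ solve 1 (λ x → :- (:1 :* :1 :* x) := :- x) refl x ⟩
        - x ∎)
      (*-pos (*-pos (#0⇒0<x² u#0) 0<a) (x<0⇒0<-x ax<0))))
    where
    u#0 : u # 0#
    u#0 = HeytingProperties.invertibleˡ⇒# heytingCommutativeRing (a , (begin
      a * (u - 0#)  ≈⟨ solve 2 (λ u a → a :* (u :- :0) := u :* (a :- :0)) refl u a ⟩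
      u * (a - 0#)  ≈⟨ u*a≈1 ⟩
      1#            ∎))

  *-cancel-nonneg : ∀ {a x} → 0# < a → 0# ≤ a * x → 0# ≤ x
  *-cancel-nonneg {a} {x} 0<a 0≤ax x<0 = 0≤ax (0<-x⇒x<0 (<-respʳ-≈
    (solve 2 (λ a x → a :* :- x := :- (a :* x)) refl a x) (*-pos 0<a (x<0⇒0<-x x<0))))

  ∑-nonneg : ∀ {n} {f : Vector Carrier n} → (∀ i → 0# ≤ f i) → 0# ≤ ∑ n f
  ∑-nonneg {zero}  0≤f = ≤-respʳ-≈ (sym (∑-zero {0} (λ ()))) ≤-refl
  ∑-nonneg {suc n} 0≤f = ≤-respʳ-≈ (sym (∑-suc _)) (+-nonneg (0≤f zero) (∑-nonneg (λ i → 0≤f (suc i))))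

  dot-self≈0⇒≈0 : ∀ {n} (y : Vector Carrier n) → dot y y ≈ 0# → ∀ i → y i ≈ 0#
  dot-self≈0⇒≈0 {suc n} y y²≈0 = λ
    { zero    → x²≤0⇒x≈0 (λ 0<y₀² → +-nonneg≢ 0<y₀² rest≥0)
    ; (suc i) → dot-self≈0⇒≈0 (λ i → y (suc i)) rest≈0 i }
    where
    rest = ∑[ i < n ] (y (suc i) * y (suc i))
    rest≥0 : 0# ≤ rest
    rest≥0 = ∑-nonneg (λ i → x²-nonneg (y (suc i)))
    total : y zero * y zero + rest ≈ 0#
    total = trans (sym (∑-suc _)) y²≈0
    +-nonneg≢ : 0# < y zero * y zero → ¬ (0# ≤ rest)
    +-nonneg≢ 0<y₀² 0≤rest = 0≤rest (0<-x⇒x<0 (<-respʳ-≈ (begin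
      y zero * y zero                          ≈⟨ solve 2 (λ a b → a := a :+ b :- b) refl _ rest ⟩
      y zero * y zero + rest - rest            ≈⟨ +-congʳ total ⟩
      0# - rest                                ≈⟨ +-identityˡ _ ⟩
      - rest                                   ∎) 0<y₀²))
    rest≈0 : rest ≈ 0#
    rest≈0 = ≤∧≥⇒≈0 rest≥0 (λ 0<rest → x²-nonneg (y zero) (0<-x⇒x<0 (<-respʳ-≈ (begin
      rest                                     ≈⟨ solve 2 (λ a b → b := a :+ b :- a) refl (y zero * y zero) rest ⟩
      y zero * y zero + rest - y zero * y zero ≈⟨ +-congʳ total ⟩
      0# - y zero * y zero                     ≈⟨ +-identityˡ _ ⟩
      - (y zero * y zero)                      ∎) 0<rest)))

  -- Suppose a d < b². If a > 0, the form takes the value -a (b² - a d) < 0 at (b, -a); hence a = 0.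
  -- Then its value at (-(1 + d), b) is -b² (2 + d) < 0, again a contradiction. The second point
  -- avoids dividing by `b` or `d`.
  discriminant : ∀ a b d → (∀ x y → 0# ≤ x * x * a + 2 · (x * y * b) + y * y * d) → b * b ≤ a * d
  discriminant a b d Q≥0 ad<b² = Q≥0 (- (1# + d)) b (0<-x⇒x<0 (<-respʳ-≈ (begin
      (b * b - a * d) * (1# + (1# + d))
        ≈⟨ solve 3 (λ a b d → (b :* b :- a :* d) :* (:1 :+ (:1 :+ d))
             := :- (:- (:1 :+ d) :* :- (:1 :+ d) :* :0 :+ 2 :· (:- (:1 :+ d) :* b :* b) :+ b :* b :* d)
                :- a :* (d :* (:1 :+ (:1 :+ d)))) refl a b d ⟩
      - (- (1# + d) * - (1# + d) * 0# + 2 · (- (1# + d) * b * b) + b * b * d) - a * (d * (1# + (1# + d)))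
        ≈⟨ +-cong (-‿cong (+-congʳ (+-congʳ (*-congˡ (sym a≈0))))) (-‿cong (trans (*-congʳ a≈0) (zeroˡ _))) ⟩
      - (- (1# + d) * - (1# + d) * a + 2 · (- (1# + d) * b * b) + b * b * d) - 0#
        ≈⟨ x-0≈x _ ⟩
      - (- (1# + d) * - (1# + d) * a + 2 · (- (1# + d) * b * b) + b * b * d) ∎)
      (*-pos 0<D (0≤⇒0<1+ (<⇒≤ (0≤⇒0<1+ 0≤d))))))
    where
    0<D : 0# < b * b - a * d
    0<D = x<y⇒0<y-x ad<b²
    0≤a : 0# ≤ a
    0≤a = ≤-respʳ-≈ (solve 3 (λ a b d → :1 :* :1 :* a :+ 2 :· (:1 :* :0 :* b) :+ :0 :* :0 :* d := a) refl a b d)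
      (Q≥0 1# 0#)
    0≤d : 0# ≤ d
    0≤d = ≤-respʳ-≈ (solve 3 (λ a b d → :0 :* :0 :* a :+ 2 :· (:0 :* :1 :* b) :+ :1 :* :1 :* d := d) refl a b d)
      (Q≥0 0# 1#)
    a≈0 : a ≈ 0#
    a≈0 = ≤∧≥⇒≈0 0≤a (λ 0<a → Q≥0 b (- a) (0<-x⇒x<0 (<-respʳ-≈
      (solve 3 (λ a b d → a :* (b :* b :- a :* d)
         := :- (b :* b :* a :+ 2 :· (b :* :- a :* b) :+ :- a :* :- a :* d)) refl a b d)
      (*-pos 0<a 0<D))))

  opaque
    reciprocal : ∀ {x} → x # 0# → Σ[ u ∈ Carrier ] u * x ≈ 1#
    reciprocal {x} x#0 with #⇒invertible x#0
    ... | u , u*x≈1 , _ = u , trans (*-congˡ (sym (x-0≈x x))) u*x≈1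

-- Isometric coordinates on a finitely spanned space

module GramSchmidt {c ℓ₁ ℓ₂ ℓ₃} (R : Reals c ℓ₁ ℓ₂ ℓ₃) where
  open Reals R hiding (zero)
  open RealInequalities R
  open FiniteSums commutativeRing hiding (ι; _·_)
  open IntegerSolver commutativeRing
  open SetoidReasoning setoid

  -- Whether a basis vector vanishes is undecidable, hence the double negation.
  isometric-coordinates : ∀ n {N v} (b : Fin n → Vector Carrier v) (w : Fin N → Vector Carrier v) →
    (∀ x → Σ[ a ∈ Vector Carrier n ] ∀ k → w x k ≈ ∑[ i < n ] (a i * b i k)) →
    ¬ ¬ (Σ[ y ∈ (Fin N → Vector Carrier n) ] ∀ i j → dot (y i) (y j) ≈ dot (w i) (w j))
  isometric-coordinates zero b w span continue = continue ((λ _ ()) , λ i j → trans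
    (∑-zero {0} (λ ()))
    (sym (∑-zero (λ k → trans (*-congʳ (trans (proj₂ (span i) k) (∑-zero {0} (λ ())))) (zeroˡ _)))))
  isometric-coordinates (suc n) {N} {v} b w span continue = ¬b₀²#0 (λ b₀²#0 → apart b₀²#0)
    where
    b₀ = b zero

    -- If `dot b₀ b₀` is not apart from zero, `b₀` vanishes by tightness. The remaining vectors then
    -- span already, and the first coordinate is filled with 0.
    ¬b₀²#0 : ¬ ¬ (dot b₀ b₀ # 0#)
    ¬b₀²#0 ¬# = isometric-coordinates n (λ i → b (suc i)) w
      (λ x → (λ i → proj₁ (span x) (suc i)) , λ k → begin
        w x k
          ≈⟨ trans (proj₂ (span x) k) (∑-suc _) ⟩
        proj₁ (span x) zero * b₀ k + ∑[ i < n ] (proj₁ (span x) (suc i) * b (suc i) k)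
          ≈⟨ trans (+-congʳ (trans (*-congˡ (dot-self≈0⇒≈0 b₀ (¬#⇒≈ ¬#) k)) (zeroʳ _))) (+-identityˡ _) ⟩
        ∑[ i < n ] (proj₁ (span x) (suc i) * b (suc i) k) ∎)
      (λ (y , dot-y) → continue
        ( (λ { x zero → 0# ; x (suc i) → y x i })
        , λ i j → trans (∑-suc _) (trans (+-cong (zeroˡ _) (dot-y i j)) (+-identityˡ _))))

    -- Otherwise the component along the normalised `b₀` becomes the first coordinate, and the
    -- recursion continues with everything projected to the orthogonal complement of `b₀`.
    apart : ¬ (dot b₀ b₀ # 0#)
    apart b₀²#0 = isometric-coordinates n b′ w′ span′ (λ (y , dot-y) → continue
      ( (λ { x zero → dot (w x) e ; x (suc i) → y x i })
      , λ i j → trans (∑-suc _) (trans (+-congˡ (dot-y i j)) (sym (pythagoras i j)))))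
      where
      0<b₀² : 0# < dot b₀ b₀
      0<b₀² with #⇒<⊎> b₀²#0
      ... | inj₁ b₀²<0 = contradiction b₀²<0 (∑-nonneg (λ i → x²-nonneg (b₀ i)))
      ... | inj₂ 0<b₀² = 0<b₀²
      r = √ (dot b₀ b₀)
      u = proj₁ (reciprocal (√#0 R 0<b₀²))
      u*r≈1 : u * r ≈ 1#
      u*r≈1 = proj₂ (reciprocal (√#0 R 0<b₀²))
      e : Vector Carrier v
      e k = u * b₀ k
      dot-b₀-e : dot b₀ e ≈ r
      dot-b₀-e = begin
        dot b₀ e          ≈⟨ trans (dot-comm b₀ e) (dot-scale u b₀ b₀) ⟩
        u * dot b₀ b₀     ≈⟨ *-congˡ (sym (√-square (<⇒≤ 0<b₀²))) ⟩
        u * (r * r)       ≈⟨ *-assoc _ _ _ ⟨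
        u * r * r         ≈⟨ trans (*-congʳ u*r≈1) (*-identityˡ r) ⟩
        r                 ∎
      dot-e-e : dot e e ≈ 1#
      dot-e-e = trans (dot-scale u b₀ e) (trans (*-congˡ dot-b₀-e) u*r≈1)
      reject : Vector Carrier v → Vector Carrier v
      reject x k = x k + - dot x e * e k
      b′ : Fin n → Vector Carrier v
      b′ i = reject (b (suc i))
      w′ : Fin N → Vector Carrier v
      w′ x = reject (w x)

      dot-reject : ∀ x y → dot x y ≈ dot x e * dot y e + dot (reject x) (reject y)
      dot-reject x y = sym (begin
        dot x e * dot y e + dot (reject x) (reject y)
          ≈⟨ +-congˡ (trans (dot-+ x _ _) (+-congˡ (dot-scale (- dot x e) e (reject y)))) ⟩
        dot x e * dot y e + (dot x (reject y) + - dot x e * dot e (reject y))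
          ≈⟨ +-congˡ (+-cong (dot-rejectʳ x) (*-congˡ (dot-rejectʳ e))) ⟩
        dot x e * dot y e + ((dot y x + - dot y e * dot e x) + - dot x e * (dot y e + - dot y e * dot e e))
          ≈⟨ +-congˡ (+-cong (+-cong (dot-comm y x) (*-congˡ (dot-comm e x)))
               (*-congˡ (+-congˡ (*-congˡ dot-e-e)))) ⟩
        dot x e * dot y e + ((dot x y + - dot y e * dot x e) + - dot x e * (dot y e + - dot y e * 1#))
          ≈⟨ solve 3 (λ a b d → a :* b :+ ((d :+ :- b :* a) :+ :- a :* (b :+ :- b :* :1)) := d)
               refl (dot x e) (dot y e) (dot x y) ⟩
        dot x y ∎)
        where
        dot-rejectʳ : ∀ z → dot z (reject y) ≈ dot y z + - dot y e * dot e z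
        dot-rejectʳ z = trans (dot-comm z (reject y))
          (trans (dot-+ y _ z) (+-congˡ (dot-scale (- dot y e) e z)))

      pythagoras : ∀ i j → dot (w i) (w j) ≈ dot (w i) e * dot (w j) e + dot (w′ i) (w′ j)
      pythagoras i j = dot-reject (w i) (w j)

      span′ : ∀ x → Σ[ a ∈ Vector Carrier n ] ∀ k → w′ x k ≈ ∑[ i < n ] (a i * b′ i k)
      span′ x = (λ i → a (suc i)) , λ k → begin
        w x k + - dot (w x) e * e k
          ≈⟨ +-cong (trans (w≈ k) (∑-suc _)) (*-congʳ (-‿cong dot-w-e)) ⟩
        (a zero * b₀ k + ∑[ i < n ] (a (suc i) * b (suc i) k))
          + - (a zero * r + ∑[ i < n ] (a (suc i) * dot (b (suc i)) e)) * (u * b₀ k)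
          -- The last summand, with the factor 1 - u r, is the projection of the multiple of `b₀` to
          -- its own complement, hence zero.
          ≈⟨ solve 6 (λ a β s r t u → (a :* β :+ s) :+ :- (a :* r :+ t) :* (u :* β)
               := s :+ (:- (u :* β)) :* t :+ a :* β :* (:1 :- u :* r)) refl
               (a zero) (b₀ k) _ r _ u ⟩
        ∑[ i < n ] (a (suc i) * b (suc i) k)
          + (- e k) * ∑[ i < n ] (a (suc i) * dot (b (suc i)) e) + a zero * b₀ k * (1# - u * r)
          ≈⟨ +-congˡ (trans (*-congˡ (trans (+-congˡ (-‿cong u*r≈1)) (-‿inverseʳ 1#))) (zeroʳ _)) ⟩
        ∑[ i < n ] (a (suc i) * b (suc i) k) + (- e k) * ∑[ i < n ] (a (suc i) * dot (b (suc i)) e) + 0#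
          ≈⟨ trans (+-identityʳ _) (trans (+-congˡ (*-distribˡ-∑ (- e k) _)) (sym (∑-distrib-+ _ _))) ⟩
        ∑[ i < n ] (a (suc i) * b (suc i) k + (- e k) * (a (suc i) * dot (b (suc i)) e))
          ≈⟨ ∑-cong (λ i → solve 4 (λ a b e d → a :* b :+ (:- e) :* (a :* d) := a :* (b :+ :- d :* e)) refl
               (a (suc i)) (b (suc i) k) (e k) (dot (b (suc i)) e)) ⟩
        ∑[ i < n ] (a (suc i) * b′ i k) ∎
        where
        a = proj₁ (span x)
        w≈ = proj₂ (span x)
        dot-w-e : dot (w x) e ≈ a zero * r + ∑[ i < n ] (a (suc i) * dot (b (suc i)) e)
        dot-w-e = begin
          dot (w x) e
            ≈⟨ dot-cong w≈ (λ _ → refl) ⟩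
          dot (λ k → ∑[ i < suc n ] (a i * b i k)) e
            ≈⟨ trans (dot-∑ (λ i k → a i * b i k) e) (∑-cong (λ i → dot-scale (a i) (b i) e)) ⟩
          ∑[ i < suc n ] (a i * dot (b i) e)
            ≈⟨ trans (∑-suc _) (+-congʳ (*-congˡ dot-b₀-e)) ⟩
          a zero * r + ∑[ i < n ] (a (suc i) * dot (b (suc i)) e) ∎

-- Positive definiteness of the zonal kernel

module ZonalKernel {c ℓ₁ ℓ₂ ℓ₃} (R : Reals c ℓ₁ ℓ₂ ℓ₃) where
  open Reals R hiding (zero)
  open RealInequalities R
  open FiniteSums commutativeRing hiding (ι; _·_)
  open IntegerSolver commutativeRing
  open GegenbauerRecurrence R
  open SetoidReasoning setoid

  gegenbauer-cong : ∀ α t {ξ ξ′} → ξ ≈ ξ′ → gegenbauer R α t ξ ≈ gegenbauer R α t ξ′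
  gegenbauer-cong α t {ξ} {ξ′} ξ≈ξ′ = sum-cong-≋ {suc t} (λ j → *-congˡ {binomial R (- α) (toℕ j)} (pow-cong (toℕ j) t))
    where
    open MonoidSum +-monoid using (sum-cong-≋)
    base-cong : ∀ n → -2ξz+z² R ξ n ≈ -2ξz+z² R ξ′ n
    base-cong 0                   = refl
    base-cong 1                   = -‿cong (+-cong ξ≈ξ′ (+-congʳ ξ≈ξ′))
    base-cong 2                   = refl
    base-cong (suc (suc (suc n))) = refl
    pow-cong : ∀ j t → powˢ R (-2ξz+z² R ξ) j t ≈ powˢ R (-2ξz+z² R ξ′) j t
    pow-cong zero    t = refl
    pow-cong (suc j) t = sum-cong-≋ {suc t} (λ i → *-cong (base-cong (toℕ i)) (pow-cong j (t ∸ toℕ i)))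

  zonal-cong : ∀ g 3≤g t {ξ ξ′} → ξ ≈ ξ′ → zonal R g 3≤g t ξ ≈ zonal R g 3≤g t ξ′
  zonal-cong g 3≤g t ξ≈ξ′ = *-congˡ (gegenbauer-cong _ t ξ≈ξ′)

  +-nonneg-pos : ∀ {x y} → 0# ≤ x → 0# < y → 0# < x + y
  +-nonneg-pos {x} {y} 0≤x 0<y with <-cotrans 0<y (x + y)
  ... | inj₁ 0<x+y = 0<x+y
  ... | inj₂ x+y<y with () ← 0≤x (<-respˡ-≈ (solve 2 (λ x y → x :+ y :- y := x) refl x y)
                               (<-respʳ-≈ (-‿inverseʳ y) (+-monoˡ-< (- y) x+y<y)))

  ι-nonneg : ∀ n → 0# ≤ ι n
  ι-nonneg zero    = ≤-refl
  ι-nonneg (suc n) = <⇒≤ (0<ι R n)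

  factorial : ℕ → Carrier
  factorial zero    = 1#
  factorial (suc t) = ι (suc t) * factorial t

  factorial-pos : ∀ t → 0# < factorial t
  factorial-pos zero    = 0<1
  factorial-pos (suc t) = *-pos (0<ι R t) (factorial-pos t)

  module _ (m₀ : ℕ) where
    private
      m = suc m₀
      α = _÷_ R (ι m) 2
    open ZonalHarmonics commutativeRing m
    open Polynomials commutativeRing (suc (suc m))

    2α≈m : ι 2 * α ≈ ι m
    2α≈m = trans (*-comm _ _) (quotient-* R (ι m) (ι 2) (ι#0 R 2))

    -- One factorial belongs to the normalisation of `eval`, the other to that of `K`; both sides
    -- obey the same recurrence.
    eval-K : ∀ t y z → dot y y ≈ 1# →
             eval t y (K z t) ≈ factorial t * factorial t * gegenbauer R α t (dot y z)
    eval-K zero y z unit = trans (solve 0 (:1 := :1 :* :1 :* :1) refl) (*-congˡ (sym (gegenbauer₀ α (dot y z))))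
    eval-K (suc zero) y z unit = begin
      eval 1 y (K z 1)
        ≈⟨ eval-K₁ y z ⟩
      ι m * dot y z
        ≈⟨ *-congʳ 2α≈m ⟨
      ι 2 * α * dot y z
        ≈⟨ gegenbauer₁ α (dot y z) ⟨
      gegenbauer R α 1 (dot y z)
        ≈⟨ solve 1 (λ x → x := :ι 1 :* :1 :* (:ι 1 :* :1) :* x) refl _ ⟩
      factorial 1 * factorial 1 * gegenbauer R α 1 (dot y z) ∎
    eval-K (suc (suc t)) y z unit = begin
      eval T y (K z T)
        ≈⟨ eval-K₂ t y z unit ⟩
      ι T * ((ι 2 * u + ι m) * (ξ * eval (suc t) y (K z (suc t))) - u * u * ((ι t + ι m) * eval t y (K z t)))
        ≈⟨ *-congˡ (+-cong (*-cong (+-congˡ (sym 2α≈m)) (*-congˡ (eval-K (suc t) y z unit)))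
             (-‿cong (*-congˡ (*-cong (+-congˡ (sym 2α≈m)) (eval-K t y z unit))))) ⟩
      ι T * ((ι 2 * u + ι 2 * α) * (ξ * (u * f * (u * f) * C 1)) - u * u * ((ι t + ι 2 * α) * (f * f * C 0)))
        ≈⟨ solve 8 (λ T u a ξ f C₁ C₀ t →
             T :* ((:ι 2 :* u :+ a) :* (ξ :* (u :* f :* (u :* f) :* C₁)) :- u :* u :* ((t :+ a) :* (f :* f :* C₀)))
             := T :* (u :* f :* (u :* f)) :* ((:ι 2 :* u :+ a) :* (ξ :* C₁) :- (t :+ a) :* C₀))
             refl (ι T) u (ι 2 * α) ξ f (C 1) (C 0) (ι t) ⟩
      ι T * (u * f * (u * f)) * ((ι 2 * u + ι 2 * α) * (ξ * C 1) - (ι t + ι 2 * α) * C 0)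
        ≈⟨ *-congˡ (gegenbauer₂ α t ξ) ⟨
      ι T * (u * f * (u * f)) * (ι T * C 2)
        ≈⟨ solve 3 (λ T h C → T :* (h :* h) :* (T :* C) := T :* h :* (T :* h) :* C) refl (ι T) (u * f) (C 2) ⟩
      factorial T * factorial T * C 2 ∎
      where
      T = suc (suc t)
      u = ι (suc t)
      f = factorial t
      ξ = dot y z
      C : ℕ → Carrier
      C i = gegenbauer R α (i ℕ.+ t) ξ

    weight-pos : ∀ t → 0# < weight t
    weight-pos zero    = 0<1
    weight-pos (suc t) = *-pos (weight-pos t) (*-pos
      (+-nonneg-pos (*-nonneg-pos (0<ι R 1) (ι-nonneg t)) (0<ι R m₀)) (0<ι R t))

    module _ (t : ℕ) where
      Z : Carrier → Carrier
      Z = zonal R (suc (suc m)) (s≤s (s≤s (s≤s z≤n))) t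

      -- `Z` is σ/m times the Gegenbauer polynomial, and the pairing is `weight t` times (t!)² times
      -- it. Cross-multiplication keeps division out of the comparison of the two kernels.
      ν σ : Carrier
      ν = ι m * (weight t * (factorial t * factorial t))
      σ = ι (2 ℕ.* t ℕ.+ m)

      ν-pos : 0# < ν
      ν-pos = *-pos (0<ι R m₀) (*-pos (weight-pos t) (*-pos (factorial-pos t) (factorial-pos t)))

      σ-pos : 0# < σ
      σ-pos = <-respʳ-≈ (sym (ι-+ (2 ℕ.* t) m)) (+-nonneg-pos (ι-nonneg (2 ℕ.* t)) (0<ι R m₀))

      zonal-kernel : ∀ {y z} → dot y y ≈ 1# → dot z z ≈ 1# → ν * Z (dot y z) ≈ σ * ⟨ K y t , K z t ⟩ t
      zonal-kernel {y} {z} unit-y unit-z = begin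
        ν * Z (dot y z)
          ≈⟨ solve 5 (λ m w f q C → m :* (w :* (f :* f)) :* (q :* C) := q :* m :* (w :* (f :* f :* C)))
               refl (ι m) (weight t) (factorial t) _ _ ⟩
        _÷_ R σ m * ι m * (weight t * (factorial t * factorial t * gegenbauer R α t (dot y z)))
          ≈⟨ *-cong (quotient-* R σ (ι m) (ι#0 R m)) (*-congˡ (sym (eval-K t y z unit-y))) ⟩
        σ * (weight t * eval t y (K z t))
          ≈⟨ *-congˡ (pair-K t y z unit-z) ⟨
        σ * ⟨ K y t , K z t ⟩ t ∎

      pair-∑ʳ : ∀ {k} F (G : Fin k → Poly) → ⟨ F , (λ u → ∑[ j < k ] G j u) ⟩ t ≈ ∑[ j < k ] ⟨ F , G j ⟩ t
      pair-∑ʳ F G = trans (pair-comm t F _) (trans (pair-∑ t G F) (∑-cong (λ j → pair-comm t (G j) F)))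

      pair-nonneg : ∀ t F → 0# ≤ ⟨ F , F ⟩ t
      pair-nonneg zero    F = x²-nonneg (F [])
      pair-nonneg (suc t) F = ∑-nonneg (λ i → pair-nonneg t (∂ i F))

      pair-cauchy-schwarz : ∀ F G → ⟨ F , G ⟩ t * ⟨ F , G ⟩ t ≤ ⟨ F , F ⟩ t * ⟨ G , G ⟩ t
      pair-cauchy-schwarz F G = discriminant _ _ _ (λ x y → ≤-respʳ-≈ (begin
        ⟨ x ⊙ F ⊕ y ⊙ G , x ⊙ F ⊕ y ⊙ G ⟩ t
          ≈⟨ expand x y (x ⊙ F ⊕ y ⊙ G) ⟩
        x * ⟨ F , x ⊙ F ⊕ y ⊙ G ⟩ t + y * ⟨ G , x ⊙ F ⊕ y ⊙ G ⟩ t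
          ≈⟨ +-cong (*-congˡ (trans (pair-comm t F _) (expand x y F)))
               (*-congˡ (trans (pair-comm t G _) (expand x y G))) ⟩
        x * (x * ⟨ F , F ⟩ t + y * ⟨ G , F ⟩ t) + y * (x * ⟨ F , G ⟩ t + y * ⟨ G , G ⟩ t)
          ≈⟨ +-congʳ (*-congˡ (+-congˡ (*-congˡ (pair-comm t G F)))) ⟩
        x * (x * ⟨ F , F ⟩ t + y * ⟨ F , G ⟩ t) + y * (x * ⟨ F , G ⟩ t + y * ⟨ G , G ⟩ t)
          ≈⟨ solve 5 (λ x y a b d → x :* (x :* a :+ y :* b) :+ y :* (x :* b :+ y :* d)
               := x :* x :* a :+ 2 :· (x :* y :* b) :+ y :* y :* d) refl x y _ _ _ ⟩
        x * x * ⟨ F , F ⟩ t + 2 · (x * y * ⟨ F , G ⟩ t) + y * y * ⟨ G , G ⟩ t ∎)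
        (pair-nonneg t (x ⊙ F ⊕ y ⊙ G)))
        where
        expand : ∀ x y H → ⟨ x ⊙ F ⊕ y ⊙ G , H ⟩ t ≈ x * ⟨ F , H ⟩ t + y * ⟨ G , H ⟩ t
        expand x y H = trans (pair-⊕ t (x ⊙ F) (y ⊙ G) H) (+-cong (pair-⊙ t x F H) (pair-⊙ t y G H))

      module _ {v : ℕ} (x : Fin v → Vector Carrier (suc (suc m))) (unit-x : ∀ i → dot (x i) (x i) ≈ 1#)
        (e : Fin v → Fin v → Vector Carrier (suc (suc m))) (w : Fin v → Fin v → Carrier)
        (unit-e : ∀ i j → w i j ≈ 0# ⊎ dot (e i j) (e i j) ≈ 1#) where

        private
          ΣA = ∑[ i < v ] ∑[ j < v ] Z (dot (x i) (x j))
          ΣB = ∑[ i < v ] ∑[ j < v ] ∑[ k < v ] (w j k * Z (dot (x i) (e j k)))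
          ΣC = ∑[ i < v ] ∑[ j < v ] ∑[ a < v ] ∑[ b < v ] (w i j * (w a b * Z (dot (e i j) (e a b))))

          F H : Poly
          F u = ∑[ i < v ] K (x i) t u
          H u = ∑[ i < v ] ∑[ j < v ] (w i j ⊙ K (e i j) t) u

          pair-H : ∀ G → ⟨ G , H ⟩ t ≈ ∑[ i < v ] ∑[ j < v ] (w i j * ⟨ G , K (e i j) t ⟩ t)
          pair-H G = trans (pair-∑ʳ G _) (∑-cong (λ i → trans (pair-∑ʳ G (λ j → w i j ⊙ K (e i j) t))
            (∑-cong (λ j → trans (pair-comm t G _) (trans (pair-⊙ t (w i j) _ G) (*-congˡ (pair-comm t _ G)))))))

          scale-∑ : ∀ {k} {f h : Vector Carrier k} → (∀ i → ν * f i ≈ σ * h i) → ν * ∑ k f ≈ σ * ∑ k h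
          scale-∑ f≈h = trans (*-distribˡ-∑ ν _) (trans (∑-cong f≈h) (sym (*-distribˡ-∑ σ _)))

          -- `zonal-kernel` speaks of unit vectors only, and `e i j` is known to be one only where
          -- its weight is not zero; elsewhere both sides vanish.
          scale-w : ∀ i j {f h} → (dot (e i j) (e i j) ≈ 1# → ν * f ≈ σ * h) →
                    ν * (w i j * f) ≈ σ * (w i j * h)
          scale-w i j {f} {h} f≈h with unit-e i j
          ... | inj₁ w≈0 = trans (*-congˡ (trans (*-congʳ w≈0) (zeroˡ _))) (trans (zeroʳ _)
                             (sym (trans (*-congˡ (trans (*-congʳ w≈0) (zeroˡ _))) (zeroʳ _))))
          ... | inj₂ unit = trans (solve 3 (λ a b c → a :* (b :* c) := b :* (a :* c)) refl ν (w i j) f)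
                              (trans (*-congˡ (f≈h unit))
                                (solve 3 (λ a b c → b :* (a :* c) := a :* (b :* c)) refl σ (w i j) h))

          A≈ : ν * ΣA ≈ σ * ⟨ F , F ⟩ t
          A≈ = trans (scale-∑ (λ i → scale-∑ (λ j → zonal-kernel (unit-x i) (unit-x j))))
            (*-congˡ (sym (trans (pair-∑ t (λ i → K (x i) t) F)
              (∑-cong (λ i → pair-∑ʳ (K (x i) t) (λ j → K (x j) t))))))

          B≈ : ν * ΣB ≈ σ * ⟨ F , H ⟩ t
          B≈ = trans (scale-∑ (λ i → scale-∑ (λ j → scale-∑ (λ k →
              scale-w j k (λ unit → zonal-kernel (unit-x i) unit)))))
            (*-congˡ (sym (trans (pair-∑ t (λ i → K (x i) t) H) (∑-cong (λ i → pair-H (K (x i) t))))))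

          C≈ : ν * ΣC ≈ σ * ⟨ H , H ⟩ t
          C≈ = trans (scale-∑ (λ i → scale-∑ (λ j → scale-∑ (λ a → scale-∑ (λ b →
              scale-w i j (λ unit → scale-w a b (λ unit′ → zonal-kernel unit unit′)))))))
            (*-congˡ (sym (trans (pair-∑ t (λ i u → ∑[ j < v ] (w i j ⊙ K (e i j) t) u) H)
              (∑-cong (λ i → trans (pair-∑ t (λ j → w i j ⊙ K (e i j) t) H)
                (∑-cong (λ j → trans (pair-⊙ t (w i j) _ H) (trans (*-congˡ (pair-H (K (e i j) t)))
                  (trans (*-distribˡ-∑ (w i j) _) (∑-cong (λ a → *-distribˡ-∑ (w i j) _)))))))))))

        zonal-cauchy-schwarz : ΣB * ΣB ≤ ΣA * ΣC
        zonal-cauchy-schwarz = 0≤y-x⇒x≤y (*-cancel-nonneg (*-pos ν-pos ν-pos) (≤-respʳ-≈ (begin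
          σ * σ * (⟨ F , F ⟩ t * ⟨ H , H ⟩ t - ⟨ F , H ⟩ t * ⟨ F , H ⟩ t)
            ≈⟨ solve 4 (λ s a b d → s :* s :* (a :* d :- b :* b) := s :* a :* (s :* d) :- s :* b :* (s :* b))
                 refl σ _ _ _ ⟩
          σ * ⟨ F , F ⟩ t * (σ * ⟨ H , H ⟩ t) - σ * ⟨ F , H ⟩ t * (σ * ⟨ F , H ⟩ t)
            ≈⟨ +-cong (*-cong A≈ C≈) (-‿cong (*-cong B≈ B≈)) ⟨
          ν * ΣA * (ν * ΣC) - ν * ΣB * (ν * ΣB)
            ≈⟨ solve 4 (λ s a b d → s :* a :* (s :* d) :- s :* b :* (s :* b) := s :* s :* (a :* d :- b :* b))
                 refl ν ΣA ΣB ΣC ⟩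
          ν * ν * (ΣA * ΣC - ΣB * ΣB) ∎)
          (*-nonneg-pos (*-pos σ-pos σ-pos) (x≤y⇒0≤y-x (pair-cauchy-schwarz F H)))))
          where
          x≤y⇒0≤y-x : ∀ {x y} → x ≤ y → 0# ≤ y - x
          x≤y⇒0≤y-x x≤y y-x<0 = x≤y (0<y-x⇒x<y (<-respʳ-≈
            (solve 2 (λ x y → :- (y :- x) := x :- y) refl _ _) (x<0⇒0<-x y-x<0)))

-- Cardinalities as sums of 0/1 indicators

module Counting {c ℓ} (CR : CommutativeRing c ℓ) where
  open CommutativeRing CR hiding (zero)
  open FiniteSums CR
  open IntegerSolver CR
  open SetoidReasoning setoid

  -- x ≈ y follows from hypotheses lᵢ ≈ rᵢ once the ring solver confirms
  -- x - y ≈ ∑ aᵢ * (lᵢ - rᵢ).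
  ≈-from-difference : ∀ {x y z} → z ≈ 0# → x - y ≈ z → x ≈ y
  ≈-from-difference {x} {y} z≈0 x-y≈z = begin
    x          ≈⟨ solve 2 (λ x y → x := x :- y :+ y) refl x y ⟩
    x - y + y  ≈⟨ +-congʳ (trans x-y≈z z≈0) ⟩
    0# + y     ≈⟨ +-identityˡ y ⟩
    y          ∎

  multiple : ∀ a {l r} → l ≈ r → a * (l - r) ≈ 0#
  multiple a {l} {r} l≈r = trans (*-congˡ (trans (+-congʳ l≈r) (-‿inverseʳ r))) (zeroʳ a)

  infixr 5 _⊞_
  _⊞_ : ∀ {x y} → x ≈ 0# → y ≈ 0# → x + y ≈ 0#
  x≈0 ⊞ y≈0 = trans (+-cong x≈0 y≈0) (+-identityˡ 0#)

  bit : Bool → Carrier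
  bit b = if b then 1# else 0#

  bit-∧ : ∀ b b′ → bit (b ∧ b′) ≈ bit b * bit b′
  bit-∧ true  b′ = sym (*-identityˡ _)
  bit-∧ false b′ = sym (zeroˡ _)

  ι-∣tabulate∣ : ∀ {n} (f : Fin n → Bool) → ι ∣ Vec.tabulate f ∣ ≈ ∑[ i < n ] bit (f i)
  ι-∣tabulate∣ {zero}  f = sym (∑-zero {0} (λ ()))
  ι-∣tabulate∣ {suc n} f with f zero in eq
  ... | true  = trans (+-congˡ (ι-∣tabulate∣ (λ i → f (suc i))))
                  (sym (trans (∑-suc _) (+-congʳ (reflexive (≡.cong bit eq)))))
  ... | false = trans (ι-∣tabulate∣ (λ i → f (suc i)))
                  (sym (trans (∑-suc _) (trans (+-congʳ (reflexive (≡.cong bit eq))) (+-identityˡ _))))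

  ι-∣tabulate∩tabulate∣ : ∀ {n} (f g : Fin n → Bool) →
    ι ∣ Vec.tabulate f ∩ Vec.tabulate g ∣ ≈ ∑[ i < n ] (bit (f i) * bit (g i))
  ι-∣tabulate∩tabulate∣ f g = trans (reflexive (≡.cong (λ p → ι ∣ p ∣) (tabulate-∩ f g)))
    (trans (ι-∣tabulate∣ (λ i → f i ∧ g i)) (∑-cong (λ i → bit-∧ (f i) (g i))))
    where
    tabulate-∩ : ∀ {n} (f g : Fin n → Bool) →
                 Vec.tabulate f ∩ Vec.tabulate g ≡ Vec.tabulate (λ i → f i ∧ g i)
    tabulate-∩ {zero}  f g = ≡.refl
    tabulate-∩ {suc n} f g = ≡.cong ((f zero ∧ g zero) Vec.∷_) (tabulate-∩ (λ i → f (suc i)) (λ i → g (suc i)))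

  private
    listSum : ∀ {a} {X : Set a} → (X → Carrier) → List X → Carrier
    listSum f []       = 0#
    listSum f (x ∷ xs) = f x + listSum f xs

    ι-length-filter : ∀ {a} {X : Set a} (P : X → Bool) xs →
                      ι (length (filterᵇ P xs)) ≈ listSum (λ x → bit (P x)) xs
    ι-length-filter P []       = refl
    ι-length-filter P (x ∷ xs) with P x
    ... | true  = +-congˡ (ι-length-filter P xs)
    ... | false = trans (ι-length-filter P xs) (sym (+-identityˡ _))

    listSum-++ : ∀ {a} {X : Set a} (f : X → Carrier) xs ys → listSum f (xs ++ ys) ≈ listSum f xs + listSum f ys
    listSum-++ f []       ys = sym (+-identityˡ _)
    listSum-++ f (x ∷ xs) ys = trans (+-congˡ (listSum-++ f xs ys)) (sym (+-assoc _ _ _))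

    listSum-map : ∀ {a b} {X : Set a} {Y : Set b} (f : Y → Carrier) (g : X → Y) xs →
                  listSum f (List.map g xs) ≈ listSum (λ x → f (g x)) xs
    listSum-map f g []       = refl
    listSum-map f g (x ∷ xs) = +-congˡ (listSum-map f g xs)

    listSum-cong : ∀ {a} {X : Set a} {f g : X → Carrier} → (∀ x → f x ≈ g x) → ∀ xs → listSum f xs ≈ listSum g xs
    listSum-cong f≈g []       = refl
    listSum-cong f≈g (x ∷ xs) = +-cong (f≈g x) (listSum-cong f≈g xs)

    listSum-× : ∀ {a b} {X : Set a} {Y : Set b} (f : X Product.× Y → Carrier) xs ys →
                listSum f (cartesianProduct xs ys) ≈ listSum (λ x → listSum (λ y → f (x , y)) ys) xs
    listSum-× f []       ys = refl
    listSum-× f (x ∷ xs) ys = trans (listSum-++ f (List.map (x ,_) ys) _)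
      (+-cong (listSum-map f (x ,_) ys) (listSum-× f xs ys))

    listSum-tabulate : ∀ {a} {X : Set a} {n} (f : X → Carrier) (g : Fin n → X) →
                       listSum f (List.tabulate g) ≈ ∑[ i < n ] f (g i)
    listSum-tabulate {n = zero}  f g = sym (∑-zero {0} (λ ()))
    listSum-tabulate {n = suc n} f g = trans (+-congˡ (listSum-tabulate f (λ i → g (suc i)))) (sym (∑-suc _))

    listSum-allFin : ∀ {n} (f : Fin n → Carrier) → listSum f (allFin n) ≈ ∑[ i < n ] f i
    listSum-allFin f = listSum-tabulate f (λ i → i)

  -- Ordered against increasing 4-cliques

  module CliqueCount {v : ℕ} (G : Graph v) where
    open import Data.Fin.Base using (_<_)
    open import Data.Fin.Properties using (<-trans; <-irrefl; <-cmp)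
    open Graph G using (adj) renaming (sym to adj-sym; irrefl to adj-irrefl)

    A : Fin v → Fin v → Carrier
    A x y = bit (adj x y)

    A-sym : ∀ x y → A x y ≈ A y x
    A-sym x y = reflexive (≡.cong bit (adj-sym x y))

    private
      Weight : Set c
      Weight = Fin v → Fin v → Fin v → Fin v → Carrier

      clique : Weight
      clique a b c d = A a b * A a c * A a d * A b c * A b d * A c d

      -- Since `clique` is symmetric, permuting the arguments of the weight does not change the sum;
      -- `I-swap₁` to `I-swap₃` are the adjacent transpositions, which generate all permutations.
      I : Weight → Carrier
      I τ = ∑[ a < v ] ∑[ b < v ] ∑[ c < v ] ∑[ d < v ] (clique a b c d * τ a b c d)

      -- Only genuine cliques contribute, and irreflexivity of adjacency makes their vertices
      -- distinct.
      I-cong-distinct : ∀ {τ τ′} →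
        (∀ {a b c d} → a ≢ b → a ≢ c → a ≢ d → b ≢ c → b ≢ d → c ≢ d → τ a b c d ≈ τ′ a b c d) → I τ ≈ I τ′
      I-cong-distinct {τ} {τ′} τ≈τ′ = ∑-cong (λ a → ∑-cong (λ b → ∑-cong (λ c → ∑-cong (λ d → pointwise a b c d))))
        where
        A-diag : ∀ x → A x x ≈ 0#
        A-diag x = reflexive (≡.cong bit (adj-irrefl x))
        zero-factor : ∀ {x y z z′} → x ≈ 0# → y ≈ x * y → y * z ≈ y * z′
        zero-factor x≈0 y≈xy = trans (*-congʳ (y≈0 x≈0 y≈xy)) (trans (zeroˡ _)
            (sym (trans (*-congʳ (y≈0 x≈0 y≈xy)) (zeroˡ _))))
          where
          y≈0 : ∀ {x y} → x ≈ 0# → y ≈ x * y → y ≈ 0#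
          y≈0 x≈0 y≈xy = trans y≈xy (trans (*-congʳ x≈0) (zeroˡ _))
        pointwise : ∀ a b c d → clique a b c d * τ a b c d ≈ clique a b c d * τ′ a b c d
        pointwise a b c d with adj a b in ab | adj a c in ac | adj a d in ad | adj b c in bc | adj b d in bd | adj c d in cd
        ... | true | true | true | true | true | true = *-congˡ
              (τ≈τ′ (distinct ab) (distinct ac) (distinct ad) (distinct bc) (distinct bd) (distinct cd))
          where
          distinct : ∀ {x y} → adj x y ≡ true → x ≢ y
          distinct {x} xy ≡.refl with () ← ≡.trans (≡.sym xy) (adj-irrefl x)
        ... | false | x₂ | x₃ | x₄ | x₅ | x₆ = zero-factor {0#} refl
              (solve 5 (λ b c d e f → :0 :* b :* c :* d :* e :* f := :0 :* (:0 :* b :* c :* d :* e :* f)) refl _ _ _ _ _)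
        ... | true | false | x₃ | x₄ | x₅ | x₆ = zero-factor {0#} refl
              (solve 4 (λ c d e f → :1 :* :0 :* c :* d :* e :* f := :0 :* (:1 :* :0 :* c :* d :* e :* f)) refl _ _ _ _)
        ... | true | true | false | x₄ | x₅ | x₆ = zero-factor {0#} refl
              (solve 3 (λ d e f → :1 :* :1 :* :0 :* d :* e :* f := :0 :* (:1 :* :1 :* :0 :* d :* e :* f)) refl _ _ _)
        ... | true | true | true | false | x₅ | x₆ = zero-factor {0#} refl
              (solve 2 (λ e f → :1 :* :1 :* :1 :* :0 :* e :* f := :0 :* (:1 :* :1 :* :1 :* :0 :* e :* f)) refl _ _)
        ... | true | true | true | true | false | x₆ = zero-factor {0#} refl
              (solve 1 (λ f → :1 :* :1 :* :1 :* :1 :* :0 :* f := :0 :* (:1 :* :1 :* :1 :* :1 :* :0 :* f)) refl _)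
        ... | true | true | true | true | true | false = zero-factor {0#} refl
              (solve 0 (:1 :* :1 :* :1 :* :1 :* :1 :* :0 := :0 :* (:1 :* :1 :* :1 :* :1 :* :1 :* :0)) refl)

      I-+ : ∀ τ τ′ → I (λ a b c d → τ a b c d + τ′ a b c d) ≈ I τ + I τ′
      I-+ τ τ′ = trans (∑-cong (λ a → trans (∑-cong (λ b → trans (∑-cong (λ c →
          trans (∑-cong (λ d → distribˡ _ _ _)) (∑-distrib-+ _ _)))
        (∑-distrib-+ _ _))) (∑-distrib-+ _ _))) (∑-distrib-+ _ _)

      I-swap₁ : ∀ τ → I τ ≈ I (λ a b c d → τ b a c d)
      I-swap₁ τ = trans (∑-comm _) (I-cong′ (λ a b c d → *-congʳ (trans
          (*-congʳ (*-congʳ (*-congʳ (*-congʳ (*-congʳ (A-sym b a))))))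
          (solve 6 (λ ab bc bd ac ad cd → ab :* bc :* bd :* ac :* ad :* cd := ab :* ac :* ad :* bc :* bd :* cd)
            refl _ _ _ _ _ _))))
        where
        I-cong′ : ∀ {f g : Weight} → (∀ a b c d → f a b c d ≈ g a b c d) →
          ∑[ a < v ] ∑[ b < v ] ∑[ c < v ] ∑[ d < v ] f a b c d ≈ ∑[ a < v ] ∑[ b < v ] ∑[ c < v ] ∑[ d < v ] g a b c d
        I-cong′ f≈g = ∑-cong (λ a → ∑-cong (λ b → ∑-cong (λ c → ∑-cong (λ d → f≈g a b c d))))

      I-swap₂ : ∀ τ → I τ ≈ I (λ a b c d → τ a c b d)
      I-swap₂ τ = ∑-cong (λ a → trans (∑-comm _) (∑-cong (λ b → ∑-cong (λ c → ∑-cong (λ d → *-congʳ (trans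
          (*-congʳ (*-congʳ (*-congˡ (A-sym c b))))
          (solve 6 (λ ac ab ad bc cd bd → ac :* ab :* ad :* bc :* cd :* bd := ab :* ac :* ad :* bc :* bd :* cd)
            refl _ _ _ _ _ _)))))))

      I-swap₃ : ∀ τ → I τ ≈ I (λ a b c d → τ a b d c)
      I-swap₃ τ = ∑-cong (λ a → ∑-cong (λ b → trans (∑-comm _) (∑-cong (λ c → ∑-cong (λ d → *-congʳ (trans
          (*-congˡ (A-sym d c))
          (solve 6 (λ ab ad ac bd bc cd → ab :* ad :* ac :* bd :* bc :* cd := ab :* ac :* ad :* bc :* bd :* cd)
            refl _ _ _ _ _ _)))))))

      t : Fin v → Fin v → Carrier
      t x y = bit (does (x <? y))

      t-< : ∀ {x y} → x < y → t x y ≈ 1#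
      t-< {x} {y} x<y = reflexive (≡.cong bit (dec-true (x <? y) x<y))

      t-≮ : ∀ {x y} → ¬ (x < y) → t x y ≈ 0#
      t-≮ {x} {y} x≮y = reflexive (≡.cong bit (dec-false (x <? y) x≮y))

      t-flip : ∀ {x y} → x ≢ y → t y x ≈ 1# - t x y
      t-flip {x} {y} x≢y with <-cmp x y
      ... | tri< x<y _ y≮x = trans (t-≮ y≮x) (sym (trans (+-congˡ (-‿cong (t-< x<y))) (-‿inverseʳ 1#)))
      ... | tri≈ _ x≡y _   = contradiction x≡y x≢y
      ... | tri> x≮y _ y<x = trans (t-< y<x) (sym (trans (+-congˡ (-‿cong (t-≮ x≮y)))
                               (solve 0 (:1 :- :0 := :1) refl)))

      -- Transitivity of the order as a polynomial equation between indicators, which turns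
      -- arguments about orderings into ring identities.
      t-cyclic : ∀ x y z → t x y * t y z * t z x ≈ 0#
      t-cyclic x y z with x <? y | y <? z
      ... | no x≮y  | _       = trans (*-congʳ (trans (*-congʳ (t-≮ x≮y)) (zeroˡ _))) (zeroˡ _)
      ... | yes _   | no y≮z  = trans (*-congʳ (trans (*-congˡ (t-≮ y≮z)) (zeroʳ _))) (zeroˡ _)
      ... | yes x<y | yes y<z = trans (*-congˡ (t-≮ {z} {x} (λ z<x → <-irrefl ≡.refl (<-trans x<y (<-trans y<z z<x)))))
                                  (zeroʳ _)

      -- Of two elements d and a, both smaller than b, one is the smaller.
      t-insert-left : ∀ {a b d} → a ≢ b → a ≢ d → b ≢ d → t a b * t d b ≈ t d a * t a b + t a d * t d b
      t-insert-left {a} {b} {d} a≢b a≢d b≢d = begin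
        t a b * t d b
          ≈⟨ *-congˡ (t-flip b≢d) ⟩
        t a b * (1# - t b d)
          -- The two sides differ exactly by the impossible cyclic orders a < b < d < a and b < a <
          -- d < b.
          ≈⟨ ≈-from-difference (multiple (- 1#) (cyc₁) ⊞ multiple (- 1#) cyc₂)
               (solve 3 (λ α β γ → α :* (:1 :- β) :- ((:1 :- γ) :* α :+ γ :* (:1 :- β))
                  := :- :1 :* (α :* β :* (:1 :- γ) :- :0) :+ :- :1 :* ((:1 :- α) :* γ :* (:1 :- β) :- :0))
                  refl (t a b) (t b d) (t a d)) ⟩
        (1# - t a d) * t a b + t a d * (1# - t b d)
          ≈⟨ +-cong (*-congʳ (t-flip a≢d)) (*-congˡ (t-flip b≢d)) ⟨
        t d a * t a b + t a d * t d b ∎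
        where
        cyc₁ : t a b * t b d * (1# - t a d) ≈ 0#
        cyc₁ = trans (*-congˡ (sym (t-flip a≢d))) (t-cyclic a b d)
        cyc₂ : (1# - t a b) * t a d * (1# - t b d) ≈ 0#
        cyc₂ = trans (*-cong (*-congʳ (sym (t-flip a≢b))) (sym (t-flip b≢d))) (t-cyclic b a d)

      -- Given a < b, the element `d` lies below both, between them, or above both.
      t-insert : ∀ {a b d} → a ≢ b → a ≢ d → b ≢ d → t a b ≈ t d a * t a b + t a d * t d b + t a b * t b d
      t-insert {a} {b} {d} a≢b a≢d b≢d = begin
        t a b
          ≈⟨ solve 2 (λ x y → x := x :* (:1 :- y) :+ x :* y) refl _ (t b d) ⟩
        t a b * (1# - t b d) + t a b * t b d
          ≈⟨ +-congʳ (trans (*-congˡ (sym (t-flip b≢d))) (t-insert-left a≢b a≢d b≢d)) ⟩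
        t d a * t a b + t a d * t d b + t a b * t b d ∎

      -- Ordered cliques whose first two, three or four vertices increase. Inserting one vertex at a
      -- time yields the factors 2, 3 and 4, hence 24, without listing the 24 permutations.
      I₂ I₃ I₄ : Carrier
      I₂ = I (λ a b c d → t a b)
      I₃ = I (λ a b c d → t a b * t b c)
      I₄ = I (λ a b c d → t a b * t b c * t c d)

      I-1 : I (λ a b c d → 1#) ≈ ι 2 * I₂
      I-1 = begin
        I (λ a b c d → 1#)
          ≈⟨ I-cong-distinct (λ a≢b _ _ _ _ _ → sym (trans (+-congˡ (t-flip a≢b))
               (solve 1 (λ x → x :+ (:1 :- x) := :1) refl _))) ⟩
        I (λ a b c d → t a b + t b a)
          ≈⟨ I-+ (λ a b c d → t a b) _ ⟩
        I₂ + I (λ a b c d → t b a)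
          ≈⟨ +-congˡ (I-swap₁ _) ⟩
        I₂ + I₂
          ≈⟨ solve 1 (λ x → x :+ x := :ι 2 :* x) refl _ ⟩
        ι 2 * I₂ ∎

      I₂≈3I₃ : I₂ ≈ ι 3 * I₃
      I₂≈3I₃ = begin
        I₂
          ≈⟨ I-cong-distinct (λ a≢b a≢c _ b≢c _ _ → t-insert a≢b a≢c b≢c) ⟩
        I (λ a b c d → t c a * t a b + t a c * t c b + t a b * t b c)
          ≈⟨ trans (I-+ (λ a b c d → t c a * t a b + t a c * t c b) _) (+-congʳ (I-+ _ _)) ⟩
        I (λ a b c d → t c a * t a b) + I (λ a b c d → t a c * t c b) + I₃
          ≈⟨ +-congʳ (+-cong (trans (I-swap₂ _) (I-swap₁ _)) (I-swap₂ _)) ⟩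
        I (λ a b c d → t a b * t b c) + I (λ a b c d → t a b * t b c) + I₃
          ≈⟨ solve 1 (λ x → x :+ x :+ x := :ι 3 :* x) refl _ ⟩
        ι 3 * I₃ ∎

      I₃≈4I₄ : I₃ ≈ ι 4 * I₄
      I₃≈4I₄ = begin
        I₃
          ≈⟨ I-cong-distinct (λ a≢b a≢c a≢d b≢c b≢d c≢d → begin
               _ ≈⟨ *-congˡ (t-insert b≢c b≢d c≢d) ⟩
               _ ≈⟨ solve 6 (λ ab db bc bd dc cd → ab :* (db :* bc :+ bd :* dc :+ bc :* cd)
                      := ab :* db :* bc :+ ab :* bd :* dc :+ ab :* bc :* cd) refl _ _ _ _ _ _ ⟩
               _ ≈⟨ +-congʳ (+-congʳ (trans (*-congʳ (t-insert-left a≢b a≢d b≢d)) (distribʳ _ _ _))) ⟩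
               _ ∎) ⟩
        I (λ a b c d → t d a * t a b * t b c + t a d * t d b * t b c + t a b * t b d * t d c + t a b * t b c * t c d)
          ≈⟨ trans (I-+ (λ a b c d → t d a * t a b * t b c + t a d * t d b * t b c + t a b * t b d * t d c) _)
               (+-congʳ (trans (I-+ (λ a b c d → t d a * t a b * t b c + t a d * t d b * t b c) _) (+-congʳ (I-+ _ _)))) ⟩
        I (λ a b c d → t d a * t a b * t b c) + I (λ a b c d → t a d * t d b * t b c)
          + I (λ a b c d → t a b * t b d * t d c) + I₄
          -- In each of the other three positions `d` is renamed, by transpositions, until the four
          -- vertices increase in the order in which they are summed.
          ≈⟨ +-congʳ (+-cong (+-cong (trans (I-swap₃ _) (trans (I-swap₂ _) (I-swap₁ _)))
               (trans (I-swap₃ _) (I-swap₂ _))) (I-swap₃ _)) ⟩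
        I₄ + I₄ + I₄ + I₄
          ≈⟨ solve 1 (λ x → x :+ x :+ x :+ x := :ι 4 :* x) refl _ ⟩
        ι 4 * I₄ ∎

      #K₄≈I₄ : ι (#K₄ G) ≈ I₄
      #K₄≈I₄ = trans (ι-length-filter _ (cartesianProduct (allFin v) (cartesianProduct (allFin v)
            (cartesianProduct (allFin v) (allFin v)))))
        (trans (listSum-× _ (allFin v) _) (trans (listSum-allFin _) (∑-cong (λ a →
        trans (listSum-× _ (allFin v) _) (trans (listSum-allFin _) (∑-cong (λ b →
        trans (listSum-× _ (allFin v) (allFin v)) (trans (listSum-allFin _) (∑-cong (λ c →
        trans (listSum-allFin _) (∑-cong (λ d → bits a b c d))))))))))))
        where
        bits : ∀ a b c d →
          bit (does (a <? b) ∧ does (b <? c) ∧ does (c <? d) ∧ adj a b ∧ adj a c ∧ adj a d ∧ adj b c ∧ adj b d ∧ adj c d)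
          ≈ clique a b c d * (t a b * t b c * t c d)
        bits a b c d = trans
          (trans (bit-∧ (does (a <? b)) _) (*-congˡ (trans (bit-∧ (does (b <? c)) _) (*-congˡ
            (trans (bit-∧ (does (c <? d)) _) (*-congˡ (trans (bit-∧ (adj a b) _) (*-congˡ
            (trans (bit-∧ (adj a c) _) (*-congˡ (trans (bit-∧ (adj a d) _) (*-congˡ
            (trans (bit-∧ (adj b c) _) (*-congˡ (bit-∧ (adj b d) _))))))))))))))) 
          (solve 9 (λ p q r x₁ x₂ x₃ x₄ x₅ x₆ →
            p :* (q :* (r :* (x₁ :* (x₂ :* (x₃ :* (x₄ :* (x₅ :* x₆)))))))
            := x₁ :* x₂ :* x₃ :* x₄ :* x₅ :* x₆ :* (p :* q :* r)) refl _ _ _ _ _ _ _ _ _)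

    ∑-cliques : ∑[ a < v ] ∑[ b < v ] ∑[ c < v ] ∑[ d < v ] (A a b * A a c * A a d * A b c * A b d * A c d)
                ≈ ι 24 * ι (#K₄ G)
    ∑-cliques = begin
      ∑[ a < v ] ∑[ b < v ] ∑[ c < v ] ∑[ d < v ] clique a b c d
        ≈⟨ ∑-cong (λ a → ∑-cong (λ b → ∑-cong (λ c → ∑-cong (λ d → sym (*-identityʳ _))))) ⟩
      I (λ a b c d → 1#)
        ≈⟨ trans I-1 (*-congˡ (trans I₂≈3I₃ (*-congˡ (trans I₃≈4I₄ (*-congˡ (sym #K₄≈I₄)))))) ⟩
      ι 2 * (ι 3 * (ι 4 * ι (#K₄ G)))
        ≈⟨ solve 1 (λ x → :ι 2 :* (:ι 3 :* (:ι 4 :* x)) := :ι 24 :* x) refl _ ⟩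
      ι 24 * ι (#K₄ G) ∎

-- Sums over a vertex or an edge of a strongly regular graph

module StronglyRegularSums {c ℓ} (CR : CommutativeRing c ℓ) {v : ℕ} (G : Graph v) (k lam μ : ℕ)
  (srg : IsStronglyRegular G k lam μ) where
  open CommutativeRing CR hiding (zero)
  open FiniteSums CR
  open IntegerSolver CR
  open Counting CR
  open CliqueCount G
  open Graph G using (adj) renaming (sym to adj-sym; irrefl to adj-irrefl)
  open IsStronglyRegular srg
  open SetoidReasoning setoid

  V K L M : Carrier
  V = ι v
  K = ι k
  L = ι lam
  M = ι μ

  N : Fin v → Fin v → Carrier
  N x y = 1# - δ x y - A x y

  A-diag : ∀ x → A x x ≈ 0#
  A-diag x = reflexive (≡.cong bit (adj-irrefl x))

  A-adj : ∀ {x y} → adj x y ≡ true → A x y ≈ 1#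
  A-adj xy = reflexive (≡.cong bit xy)

  A-nonadj : ∀ {x y} → adj x y ≡ false → A x y ≈ 0#
  A-nonadj xy = reflexive (≡.cong bit xy)

  adj⇒≢ : ∀ {x y} → adj x y ≡ true → x ≢ y
  adj⇒≢ {x} xy ≡.refl with () ← ≡.trans (≡.sym xy) (adj-irrefl x)

  data Relation (x y : Fin v) : Set where
    equal       : x ≡ y → Relation x y
    adjacent′   : x ≢ y → adj x y ≡ true → Relation x y
    unconnected : x ≢ y → adj x y ≡ false → Relation x y

  relation : ∀ x y → Relation x y
  relation x y with x ≟ y | adj x y in xy
  ... | yes x≡y | _     = equal x≡y
  ... | no  x≢y | true  = adjacent′ x≢y xy
  ... | no  x≢y | false = unconnected x≢y xy

  on-adjacent : ∀ x y {e f} → (adj x y ≡ true → e ≈ f) → A x y * e ≈ A x y * f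
  on-adjacent x y e≈f with adj x y
  ... | true  = *-congˡ (e≈f ≡.refl)
  ... | false = trans (zeroˡ _) (sym (zeroˡ _))

  ∑A : ∀ x → ∑[ y < v ] A x y ≈ K
  ∑A x = trans (sym (ι-∣tabulate∣ (adj x))) (reflexive (≡.cong ι (regular x)))

  ∑Aˡ : ∀ y → ∑[ x < v ] A x y ≈ K
  ∑Aˡ y = trans (∑-cong (λ x → A-sym x y)) (∑A y)

  ∑δ : ∀ x → ∑[ y < v ] δ x y ≈ 1#
  ∑δ x = trans (∑-cong (λ y → sym (*-identityʳ _))) (∑-δ x (λ _ → 1#))

  ∑1 : ∑[ x < v ] 1# ≈ V
  ∑1 = trans (∑-const v 1#) (*-identityʳ V)

  A-idem : ∀ x y → A x y * A x y ≈ A x y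
  A-idem x y with adj x y
  ... | true  = *-identityˡ _
  ... | false = zeroˡ _

  -- Evaluates a sum once its summand has the form c * f x + (d * g x + … + 0#).
  infixr 5 _⊗_⊞⊞_
  _⊗_⊞⊞_ : ∀ c {f g : Vector Carrier v} {s t} → ∑ v f ≈ s → ∑ v g ≈ t →
            ∑[ x < v ] (c * f x + g x) ≈ c * s + t
  _⊗_⊞⊞_ c f≈s g≈t = trans (∑-distrib-+ _ _) (+-cong (trans (sym (*-distribˡ-∑ c _)) (*-congˡ f≈s)) g≈t)

  done : ∑[ x < v ] 0# ≈ 0#
  done = ∑-zero (λ _ → refl)

  ∑AA : ∀ x y → ∑[ z < v ] (A x z * A y z) ≈ δ x y * K + (A x y * L + N x y * M)
  ∑AA x y with relation x y
  ... | equal ≡.refl = begin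
    ∑[ z < v ] (A x z * A x z)  ≈⟨ trans (∑-cong (λ z → A-idem x z)) (∑A x) ⟩
    K                           ≈⟨ solve 3 (λ K L M → K := :1 :* K :+ (:0 :* L :+ (:1 :- :1 :- :0) :* M)) refl K L M ⟩
    1# * K + (0# * L + (1# - 1# - 0#) * M)
      ≈⟨ +-cong (*-congʳ (δ-≡ x)) (+-cong (*-congʳ (A-diag x))
           (*-congʳ (+-cong (+-congˡ (-‿cong (δ-≡ x))) (-‿cong (A-diag x))))) ⟨
    δ x x * K + (A x x * L + N x x * M) ∎
  ... | adjacent′ x≢y xy = begin
    ∑[ z < v ] (A x z * A y z)  ≈⟨ trans (sym (ι-∣tabulate∩tabulate∣ (adj x) (adj y))) (reflexive (≡.cong ι (adjacent x y xy))) ⟩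
    L                           ≈⟨ solve 3 (λ K L M → L := :0 :* K :+ (:1 :* L :+ (:1 :- :0 :- :1) :* M)) refl K L M ⟩
    0# * K + (1# * L + (1# - 0# - 1#) * M)
      ≈⟨ +-cong (*-congʳ (δ-≢ x≢y)) (+-cong (*-congʳ (A-adj xy))
           (*-congʳ (+-cong (+-congˡ (-‿cong (δ-≢ x≢y))) (-‿cong (A-adj xy))))) ⟨
    δ x y * K + (A x y * L + N x y * M) ∎
  ... | unconnected x≢y xy = begin
    ∑[ z < v ] (A x z * A y z)  ≈⟨ trans (sym (ι-∣tabulate∩tabulate∣ (adj x) (adj y))) (reflexive (≡.cong ι (nonAdjacent x y x≢y xy))) ⟩
    M                           ≈⟨ solve 3 (λ K L M → M := :0 :* K :+ (:0 :* L :+ (:1 :- :0 :- :0) :* M)) refl K L M ⟩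
    0# * K + (0# * L + (1# - 0# - 0#) * M)
      ≈⟨ +-cong (*-congʳ (δ-≢ x≢y)) (+-cong (*-congʳ (A-nonadj xy))
           (*-congʳ (+-cong (+-congˡ (-‿cong (δ-≢ x≢y))) (-‿cong (A-nonadj xy))))) ⟨
    δ x y * K + (A x y * L + N x y * M) ∎

  -- Walks of length two from `x`, counted in total and by endpoint through `∑AA`. A vertex must be
  -- supplied, since for v = 0 strong regularity does not constrain the parameters.
  parameter-identity : Fin v → K * (K - 1# - L) ≈ (V - K - 1#) * M
  parameter-identity x = ≈-from-difference (multiple 1# double-count)
    (solve 4 (λ V K L M → K :* (K :- :1 :- L) :- (V :- K :- :1) :* M
       := :1 :* (K :* K :- ((K :- M) :* :1 :+ ((L :- M) :* K :+ (M :* V :+ :0))))) refl V K L M)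
    where
    double-count : K * K ≈ (K - M) * 1# + ((L - M) * K + (M * V + 0#))
    double-count = begin
      K * K
        ≈⟨ trans (*-congʳ (sym (∑A x))) (*-distribʳ-∑ K _) ⟩
      ∑[ z < v ] (A x z * K)
        ≈⟨ ∑-cong (λ z → trans (*-congˡ (sym (∑Aˡ z))) (*-distribˡ-∑ (A x z) _)) ⟩
      ∑[ z < v ] ∑[ y < v ] (A x z * A y z)
        ≈⟨ ∑-comm _ ⟩
      ∑[ y < v ] ∑[ z < v ] (A x z * A y z)
        ≈⟨ ∑-cong (λ y → trans (∑AA x y) (solve 5 (λ d a K L M →
             d :* K :+ (a :* L :+ (:1 :- d :- a) :* M)
             := (K :- M) :* d :+ ((L :- M) :* a :+ (M :* :1 :+ :0))) refl (δ x y) (A x y) K L M)) ⟩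
      ∑[ y < v ] ((K - M) * δ x y + ((L - M) * A x y + (M * 1# + 0#)))
        ≈⟨ (K - M) ⊗ ∑δ x ⊞⊞ (L - M) ⊗ ∑A x ⊞⊞ M ⊗ ∑1 ⊞⊞ done ⟩
      (K - M) * 1# + ((L - M) * K + (M * V + 0#)) ∎

  Congruent : (Carrier → Carrier) → Set _
  Congruent φ = ∀ {x y} → x ≈ y → φ x ≈ φ y

  module Edge {i j : Fin v} (ij : adj i j ≡ true) where

    δij : δ i j ≈ 0#
    δij = δ-≢ (adj⇒≢ ij)

    ∑AA-edge : ∑[ z < v ] (A i z * A j z) ≈ L
    ∑AA-edge = trans (sym (ι-∣tabulate∩tabulate∣ (adj i) (adj j))) (reflexive (≡.cong ι (adjacent i j ij)))

    ∑δδ : ∑[ x < v ] (δ i x * δ j x) ≈ 0#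
    ∑δδ = trans (∑-δ i (λ x → δ j x)) (trans (δ-sym j i) δij)

    ∑δA : ∑[ x < v ] (δ i x * A j x) ≈ 1#
    ∑δA = trans (∑-δ i (λ x → A j x)) (trans (A-sym j i) (A-adj ij))

    ∑Aδ : ∑[ x < v ] (A i x * δ j x) ≈ 1#
    ∑Aδ = trans (∑-cong (λ x → *-comm _ _)) (trans (∑-δ j (λ x → A i x)) (A-adj ij))

    outside : Fin v → Carrier
    outside x = 1# - δ i x - δ j x

    -- Away from the endpoints of the edge, cosines with `i` and `j` depend on adjacency alone.
    ∑′ : Vector Carrier v → Carrier
    ∑′ f = ∑[ x < v ] (outside x * f x)

    ∑′-cong : ∀ {f g} → (∀ x → i ≢ x → j ≢ x → f x ≈ g x) → ∑′ f ≈ ∑′ g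
    ∑′-cong {f} {g} f≈g = ∑-cong pointwise
      where
      pointwise : ∀ x → outside x * f x ≈ outside x * g x
      pointwise x with i ≟ x | j ≟ x
      ... | yes ≡.refl | yes ≡.refl = contradiction ≡.refl (adj⇒≢ ij)
      ... | yes ≡.refl | no _  = trans (*-congʳ (solve 0 (:1 :- :1 :- :0 := :0) refl))
              (trans (zeroˡ _) (sym (trans (*-congʳ (solve 0 (:1 :- :1 :- :0 := :0) refl)) (zeroˡ _))))
      ... | no _  | yes ≡.refl = trans (*-congʳ (solve 0 (:1 :- :0 :- :1 := :0) refl))
              (trans (zeroˡ _) (sym (trans (*-congʳ (solve 0 (:1 :- :0 :- :1 := :0) refl)) (zeroˡ _))))
      ... | no i≢x | no j≢x = *-congˡ (f≈g x i≢x j≢x)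

    ∑′≈ : ∀ f → ∑′ f ≈ ∑ v f - f i - f j
    ∑′≈ f = begin
      ∑[ x < v ] (outside x * f x)
        ≈⟨ ∑-cong (λ x → solve 3 (λ d e f → (:1 :- d :- e) :* f
             := :1 :* f :+ (:- :1 :* (d :* f) :+ (:- :1 :* (e :* f) :+ :0))) refl _ _ _) ⟩
      ∑[ x < v ] (1# * f x + (- 1# * (δ i x * f x) + (- 1# * (δ j x * f x) + 0#)))
        ≈⟨ 1# ⊗ refl ⊞⊞ (- 1#) ⊗ ∑-δ i f ⊞⊞ (- 1#) ⊗ ∑-δ j f ⊞⊞ done ⟩
      1# * ∑ v f + (- 1# * f i + (- 1# * f j + 0#))
        ≈⟨ solve 3 (λ s x y → :1 :* s :+ (:- :1 :* x :+ (:- :1 :* y :+ :0)) := s :- x :- y) refl _ _ _ ⟩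
      ∑ v f - f i - f j ∎

    ∑′-+ : ∀ f g → ∑′ (λ x → f x + g x) ≈ ∑′ f + ∑′ g
    ∑′-+ f g = trans (∑-cong (λ x → distribˡ _ _ _)) (∑-distrib-+ _ _)

    ∑′-scale : ∀ c f → ∑′ (λ x → c * f x) ≈ c * ∑′ f
    ∑′-scale c f = trans (∑-cong (λ x → solve 3 (λ o c f → o :* (c :* f) := c :* (o :* f)) refl _ _ _))
      (sym (*-distribˡ-∑ c _))

    ∑′-comm : ∀ (f : Fin v → Fin v → Carrier) → ∑′ (λ a → ∑′ (λ b → f a b)) ≈ ∑′ (λ b → ∑′ (λ a → f a b))
    ∑′-comm f = begin
      ∑[ a < v ] (outside a * ∑[ b < v ] (outside b * f a b))
        ≈⟨ ∑-cong (λ a → *-distribˡ-∑ (outside a) _) ⟩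
      ∑[ a < v ] ∑[ b < v ] (outside a * (outside b * f a b))
        ≈⟨ ∑-comm _ ⟩
      ∑[ b < v ] ∑[ a < v ] (outside a * (outside b * f a b))
        ≈⟨ ∑-cong (λ b → trans (∑-cong (λ a → solve 3 (λ x y z → x :* (y :* z) := y :* (x :* z)) refl _ _ _))
             (sym (*-distribˡ-∑ (outside b) _))) ⟩
      ∑[ b < v ] (outside b * ∑[ a < v ] (outside a * f a b)) ∎

    ∑′1 : ∑′ (λ _ → 1#) ≈ V - ι 2
    ∑′1 = trans (∑′≈ _) (trans (+-congʳ (+-congʳ ∑1))
      (solve 1 (λ V → V :- :1 :- :1 := V :- :ι 2) refl V))

    Aij : A i j ≈ 1#
    Aij = A-adj ij

    Aji : A j i ≈ 1#
    Aji = trans (A-sym j i) Aij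

    ∑′Ai : ∑′ (A i) ≈ K - 1#
    ∑′Ai = trans (∑′≈ _) (trans (+-cong (+-cong (∑A i) (-‿cong (A-diag i))) (-‿cong Aij))
      (solve 1 (λ K → K :- :0 :- :1 := K :- :1) refl K))

    ∑′Aj : ∑′ (A j) ≈ K - 1#
    ∑′Aj = trans (∑′≈ _) (trans (+-cong (+-cong (∑A j) (-‿cong Aji)) (-‿cong (A-diag j)))
      (solve 1 (λ K → K :- :1 :- :0 := K :- :1) refl K))

    ∑′AiAj : ∑′ (λ x → A i x * A j x) ≈ L
    ∑′AiAj = trans (∑′≈ _) (trans (+-cong (+-cong ∑AA-edge
        (-‿cong (trans (*-congʳ (A-diag i)) (zeroˡ _)))) (-‿cong (trans (*-congˡ (A-diag j)) (zeroʳ _))))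
      (solve 1 (λ L → L :- :0 :- :0 := L) refl L))

    ∑′A : ∀ a → ∑′ (A a) ≈ K - A i a - A j a
    ∑′A a = trans (∑′≈ _) (+-cong (+-cong (∑A a) (-‿cong (A-sym a i))) (-‿cong (A-sym a j)))

    -- Among the λ or μ common neighbours of `a` and `i`, the excluded vertex `j` occurs exactly
    -- when it is adjacent to `a`; `i` never occurs.
    ∑′AAi : ∀ {a} → i ≢ a → ∑′ (λ b → A a b * A i b) ≈ A i a * L + (1# - A i a) * M - A j a
    ∑′AAi {a} i≢a = begin
      ∑′ (λ b → A a b * A i b)
        ≈⟨ ∑′≈ _ ⟩
      ∑[ b < v ] (A a b * A i b) - A a i * A i i - A a j * A i j
        ≈⟨ +-cong (+-cong (trans (∑-cong (λ b → *-comm _ _)) (trans (∑AA i a) (+-cong (*-congʳ (δ-≢ i≢a))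
             (+-congˡ (*-congʳ (+-congʳ (+-congˡ (-‿cong (δ-≢ i≢a)))))))))
             (-‿cong (*-congˡ (A-diag i)))) (-‿cong (*-cong (A-sym a j) Aij)) ⟩
      0# * K + (A i a * L + (1# - 0# - A i a) * M) - A a i * 0# - A j a * 1#
        ≈⟨ solve 6 (λ K L M x y z → :0 :* K :+ (x :* L :+ (:1 :- :0 :- x) :* M) :- z :* :0 :- y :* :1
             := x :* L :+ (:1 :- x) :* M :- y) refl K L M _ _ _ ⟩
      A i a * L + (1# - A i a) * M - A j a ∎

    ∑′AAj : ∀ {a} → j ≢ a → ∑′ (λ b → A a b * A j b) ≈ A j a * L + (1# - A j a) * M - A i a
    ∑′AAj {a} j≢a = begin
      ∑′ (λ b → A a b * A j b)
        ≈⟨ ∑′≈ _ ⟩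
      ∑[ b < v ] (A a b * A j b) - A a i * A j i - A a j * A j j
        ≈⟨ +-cong (+-cong (trans (∑-cong (λ b → *-comm _ _)) (trans (∑AA j a) (+-cong (*-congʳ (δ-≢ j≢a))
             (+-congˡ (*-congʳ (+-congʳ (+-congˡ (-‿cong (δ-≢ j≢a)))))))))
             (-‿cong (*-cong (A-sym a i) Aji))) (-‿cong (*-congˡ (A-diag j))) ⟩
      0# * K + (A j a * L + (1# - 0# - A j a) * M) - A i a * 1# - A a j * 0#
        ≈⟨ solve 6 (λ K L M x y z → :0 :* K :+ (y :* L :+ (:1 :- :0 :- y) :* M) :- x :* :1 :- z :* :0
             := y :* L :+ (:1 :- y) :* M :- x) refl K L M _ _ _ ⟩
      A j a * L + (1# - A j a) * M - A i a ∎

    -- A function of two bits is determined by its four values.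
    ∑′-bits : ∀ (P : Carrier → Carrier → Carrier) → ∑′ (λ a → P (A i a) (A j a)) ≈
      (V - 2 · K + L) * P 0# 0# + (K - L - 1#) * (P 1# 0# + P 0# 1#) + L * P 1# 1#
    ∑′-bits P = begin
      ∑′ (λ a → P (A i a) (A j a))
        ≈⟨ ∑-cong (λ a → *-congˡ (interpolate (adj i a) (adj j a))) ⟩
      ∑′ (λ a → P 0# 0# * 1# + ((P 1# 0# - P 0# 0#) * A i a + ((P 0# 1# - P 0# 0#) * A j a
                + (P 1# 1# - P 1# 0# - P 0# 1# + P 0# 0#) * (A i a * A j a))))
        ≈⟨ trans (∑′-+ _ _) (+-cong (trans (∑′-scale _ _) (*-congˡ ∑′1))
             (trans (∑′-+ _ _) (+-cong (trans (∑′-scale _ _) (*-congˡ ∑′Ai))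
               (trans (∑′-+ _ _) (+-cong (trans (∑′-scale _ _) (*-congˡ ∑′Aj))
                 (trans (∑′-scale _ _) (*-congˡ ∑′AiAj))))))) ⟩
      P 0# 0# * (V - ι 2) + ((P 1# 0# - P 0# 0#) * (K - 1#) + ((P 0# 1# - P 0# 0#) * (K - 1#)
        + (P 1# 1# - P 1# 0# - P 0# 1# + P 0# 0#) * L))
        ≈⟨ solve 7 (λ V K L P₀₀ P₁₀ P₀₁ P₁₁ →
             P₀₀ :* (V :- :ι 2) :+ ((P₁₀ :- P₀₀) :* (K :- :1) :+ ((P₀₁ :- P₀₀) :* (K :- :1)
               :+ (P₁₁ :- P₁₀ :- P₀₁ :+ P₀₀) :* L))
             := (V :- 2 :· K :+ L) :* P₀₀ :+ (K :- L :- :1) :* (P₁₀ :+ P₀₁) :+ L :* P₁₁) refl V K L _ _ _ _ ⟩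
      (V - 2 · K + L) * P 0# 0# + (K - L - 1#) * (P 1# 0# + P 0# 1#) + L * P 1# 1# ∎
      where
      interpolate : ∀ β γ → P (bit β) (bit γ) ≈
        P 0# 0# * 1# + ((P 1# 0# - P 0# 0#) * bit β + ((P 0# 1# - P 0# 0#) * bit γ
          + (P 1# 1# - P 1# 0# - P 0# 1# + P 0# 0#) * (bit β * bit γ)))
      interpolate false false = solve 4 (λ f g h e → f := f :* :1 :+ ((g :- f) :* :0 :+ ((h :- f) :* :0
        :+ (e :- g :- h :+ f) :* (:0 :* :0)))) refl _ _ _ _
      interpolate true  false = solve 4 (λ f g h e → g := f :* :1 :+ ((g :- f) :* :1 :+ ((h :- f) :* :0
        :+ (e :- g :- h :+ f) :* (:1 :* :0)))) refl _ _ _ _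
      interpolate false true  = solve 4 (λ f g h e → h := f :* :1 :+ ((g :- f) :* :0 :+ ((h :- f) :* :1
        :+ (e :- g :- h :+ f) :* (:0 :* :1)))) refl _ _ _ _
      interpolate true  true  = solve 4 (λ f g h e → e := f :* :1 :+ ((g :- f) :* :1 :+ ((h :- f) :* :1
        :+ (e :- g :- h :+ f) :* (:1 :* :1)))) refl _ _ _ _

  module Cosine (p q : Carrier) where

    -- The matrix I + pA + q(J - I - A).
    E : Fin v → Fin v → Carrier
    E x y = δ x y + p * A x y + q * N x y

    private
      case-sum : ∀ {φ} → Congruent φ → ∀ {d a d′ a′ r} → d ≈ d′ → a ≈ a′ →
        d′ + p * a′ + q * (1# - d′ - a′) ≈ r → φ r ≈ d′ * φ 1# + (a′ * φ p + (1# - d′ - a′) * φ q) →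
        φ (d + p * a + q * (1# - d - a)) ≈ d * φ 1# + (a * φ p + (1# - d - a) * φ q)
      case-sum φ-cong d≈d′ a≈a′ value split = trans
        (φ-cong (trans (+-cong (+-cong d≈d′ (*-congˡ a≈a′))
          (*-congˡ (+-cong (+-congˡ (-‿cong d≈d′)) (-‿cong a≈a′)))) value))
        (trans split (sym (+-cong (*-congʳ d≈d′)
          (+-cong (*-congʳ a≈a′) (*-congʳ (+-cong (+-congˡ (-‿cong d≈d′)) (-‿cong a≈a′)))))))

    -- `E x y` takes one of three values, so every function of it is linear in the three indicators.
    on-E : ∀ {φ} → Congruent φ → ∀ x y → φ (E x y) ≈ δ x y * φ 1# + (A x y * φ p + N x y * φ q)
    on-E {φ} φ-cong x y with relation x y
    ... | equal ≡.refl = case-sum φ-cong (δ-≡ x) (A-diag x)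
      (solve 2 (λ p q → :1 :+ p :* :0 :+ q :* (:1 :- :1 :- :0) := :1) refl p q)
      (solve 3 (λ f g h → f := :1 :* f :+ (:0 :* g :+ (:1 :- :1 :- :0) :* h)) refl _ _ _)
    ... | adjacent′ x≢y xy = case-sum φ-cong (δ-≢ x≢y) (A-adj xy)
      (solve 2 (λ p q → :0 :+ p :* :1 :+ q :* (:1 :- :0 :- :1) := p) refl p q)
      (solve 3 (λ f g h → g := :0 :* f :+ (:1 :* g :+ (:1 :- :0 :- :1) :* h)) refl _ _ _)
    ... | unconnected x≢y xy = case-sum φ-cong (δ-≢ x≢y) (A-nonadj xy)
      (solve 2 (λ p q → :0 :+ p :* :0 :+ q :* (:1 :- :0 :- :0) := q) refl p q)
      (solve 3 (λ f g h → h := :0 :* f :+ (:0 :* g :+ (:1 :- :0 :- :0) :* h)) refl _ _ _)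

    E-sym : ∀ x y → E x y ≈ E y x
    E-sym x y = +-cong (+-cong (δ-sym x y) (*-congˡ (A-sym x y)))
      (*-congˡ (+-cong (+-congˡ (-‿cong (δ-sym x y))) (-‿cong (A-sym x y))))

    E-diag : ∀ x → E x x ≈ 1#
    E-diag x = trans (+-cong (+-cong (δ-≡ x) (*-congˡ (A-diag x)))
        (*-congˡ (+-cong (+-congˡ (-‿cong (δ-≡ x))) (-‿cong (A-diag x)))))
      (solve 2 (λ p q → :1 :+ p :* :0 :+ q :* (:1 :- :1 :- :0) := :1) refl p q)

    E-adj : ∀ {x y} → adj x y ≡ true → E x y ≈ p
    E-adj xy = trans (+-cong (+-cong (δ-≢ (adj⇒≢ xy)) (*-congˡ (A-adj xy)))
        (*-congˡ (+-cong (+-congˡ (-‿cong (δ-≢ (adj⇒≢ xy)))) (-‿cong (A-adj xy)))))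
      (solve 2 (λ p q → :0 :+ p :* :1 :+ q :* (:1 :- :0 :- :1) := p) refl p q)

    ∑-vertices : ∀ {φ} → Congruent φ →
      ∑[ x < v ] ∑[ y < v ] φ (E x y) ≈ V * (φ 1# + K * φ p + (V - K - 1#) * φ q)
    ∑-vertices {φ} φ-cong = begin
      ∑[ x < v ] ∑[ y < v ] φ (E x y)
        ≈⟨ ∑-cong (λ x → begin
             ∑[ y < v ] φ (E x y)
               ≈⟨ ∑-cong (λ y → trans (on-E φ-cong x y) (solve 5 (λ d a f g h →
                    d :* f :+ (a :* g :+ (:1 :- d :- a) :* h)
                    := (f :- h) :* d :+ ((g :- h) :* a :+ (h :* :1 :+ :0))) refl _ _ _ _ _)) ⟩
             ∑[ y < v ] ((φ 1# - φ q) * δ x y + ((φ p - φ q) * A x y + (φ q * 1# + 0#)))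
               ≈⟨ (φ 1# - φ q) ⊗ ∑δ x ⊞⊞ (φ p - φ q) ⊗ ∑A x ⊞⊞ φ q ⊗ ∑1 ⊞⊞ done ⟩
             (φ 1# - φ q) * 1# + ((φ p - φ q) * K + (φ q * V + 0#))
               ≈⟨ solve 5 (λ V K f g h → (f :- h) :* :1 :+ ((g :- h) :* K :+ (h :* V :+ :0))
                    := f :+ K :* g :+ (V :- K :- :1) :* h) refl V K _ _ _ ⟩
             φ 1# + K * φ p + (V - K - 1#) * φ q ∎) ⟩
      ∑[ x < v ] (φ 1# + K * φ p + (V - K - 1#) * φ q)
        ≈⟨ ∑-const v _ ⟩
      V * (φ 1# + K * φ p + (V - K - 1#) * φ q) ∎

    cosine : Bool → Carrier
    cosine β = if β then p else q

    E-distinct : ∀ {x y} → x ≢ y → E x y ≈ cosine (adj x y)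
    E-distinct {x} {y} x≢y with adj x y
    ... | true  = trans (+-cong (+-congʳ (δ-≢ x≢y)) (*-congˡ (+-congʳ (+-congˡ (-‿cong (δ-≢ x≢y))))))
      (solve 2 (λ p q → :0 :+ p :* :1 :+ q :* (:1 :- :0 :- :1) := p) refl p q)
    ... | false = trans (+-cong (+-congʳ (δ-≢ x≢y)) (*-congˡ (+-congʳ (+-congˡ (-‿cong (δ-≢ x≢y))))))
      (solve 2 (λ p q → :0 :+ p :* :0 :+ q :* (:1 :- :0 :- :0) := q) refl p q)

    module _ (ψ : Carrier → Carrier) where

      -- The multilinear interpolation in the bits; `m` and `n` count how often p and q have been
      -- chosen so far.
      mixed : List Bool → ℕ → ℕ → Carrier
      mixed []       m n = ψ (m · p + n · q)
      mixed (β ∷ βs) m n = bit β * mixed βs (suc m) n + (1# - bit β) * mixed βs m (suc n)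

      cosines : List Bool → Carrier
      cosines []       = 0#
      cosines (β ∷ βs) = cosine β + cosines βs

      on-cosines : Congruent ψ → ∀ βs m n → ψ (m · p + n · q + cosines βs) ≈ mixed βs m n
      on-cosines ψ-cong []           m n = ψ-cong (+-identityʳ _)
      on-cosines ψ-cong (true ∷ βs)  m n = trans
        (trans (ψ-cong (solve 4 (λ a b p r → a :+ b :+ (p :+ r) := p :+ a :+ b :+ r) refl _ _ _ _))
          (on-cosines ψ-cong βs (suc m) n))
        (solve 2 (λ x y → x := :1 :* x :+ (:1 :- :1) :* y) refl _ _)
      on-cosines ψ-cong (false ∷ βs) m n = trans
        (trans (ψ-cong (solve 4 (λ a b q r → a :+ b :+ (q :+ r) := a :+ (q :+ b) :+ r) refl _ _ _ _))
          (on-cosines ψ-cong βs m (suc n)))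
        (solve 2 (λ x y → y := :0 :* x :+ (:1 :- :0) :* y) refl _ _)

    module _ {i j : Fin v} (ij : adj i j ≡ true) where
      open Edge ij

      -- The endpoints give the first term. Of the other vertices, L are adjacent to both ends, K -
      -- L - 1 only to `i`, as many only to `j`, and V - 2K + L to neither.
      ∑-edge-vertex : ∀ {φ} → Congruent φ →
        ∑[ x < v ] φ (E i x + E j x) ≈
          2 · φ (1# + p) + L * φ (2 · p) + 2 · (K - L - 1#) * φ (p + q) + (V - 2 · K + L) * φ (2 · q)
      ∑-edge-vertex {φ} φ-cong = begin
        ∑[ x < v ] φ (E i x + E j x)
          ≈⟨ ∑-cong (λ x → begin
               φ (E i x + E j x)
                 ≈⟨ on-E {λ r → φ (r + E j x)} (λ r≈r′ → φ-cong (+-congʳ r≈r′)) i x ⟩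
               δ i x * φ (1# + E j x) + (A i x * φ (p + E j x) + N i x * φ (q + E j x))
                 ≈⟨ +-cong (*-congˡ (on-E {λ r → φ (1# + r)} (λ r≈r′ → φ-cong (+-congˡ r≈r′)) j x))
                      (+-cong (*-congˡ (on-E {λ r → φ (p + r)} (λ r≈r′ → φ-cong (+-congˡ r≈r′)) j x))
                        (*-congˡ (on-E {λ r → φ (q + r)} (λ r≈r′ → φ-cong (+-congˡ r≈r′)) j x))) ⟩
               -- Values at commuted arguments are identified here, since the solver would treat
               -- them as different atoms.
               _ ≈⟨ +-cong (*-congˡ (+-congˡ refl)) (+-cong
                      (*-congˡ (+-cong (*-congˡ f1p) (+-congˡ refl)))
                      (*-congˡ (+-cong (*-congˡ f1q) (+-congʳ (*-congˡ fpq))))) ⟩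
               _ ≈⟨ solve 10 (λ d a e b f₁₁ f₁ₚ f₁q fₚₚ fₚq fqq →
                      d :* (e :* f₁₁ :+ (b :* f₁ₚ :+ (:1 :- e :- b) :* f₁q))
                        :+ (a :* (e :* f₁ₚ :+ (b :* fₚₚ :+ (:1 :- e :- b) :* fₚq))
                        :+ (:1 :- d :- a) :* (e :* f₁q :+ (b :* fₚq :+ (:1 :- e :- b) :* fqq)))
                      := fqq :* :1 :+ ((f₁q :- fqq) :* d :+ ((fₚq :- fqq) :* a :+ ((f₁q :- fqq) :* e
                         :+ ((fₚq :- fqq) :* b :+ ((f₁₁ :- 2 :· f₁q :+ fqq) :* (d :* e)
                         :+ ((f₁ₚ :- f₁q :- fₚq :+ fqq) :* (d :* b) :+ ((f₁ₚ :- f₁q :- fₚq :+ fqq) :* (a :* e)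
                         :+ ((fₚₚ :- 2 :· fₚq :+ fqq) :* (a :* b) :+ :0)))))))))
                      refl (δ i x) (A i x) (δ j x) (A j x) f₁₁ f₁ₚ f₁q fₚₚ fₚq fqq ⟩
               _ ∎) ⟩
        _ ≈⟨ fqq ⊗ ∑1 ⊞⊞ (f₁q - fqq) ⊗ ∑δ i ⊞⊞ (fₚq - fqq) ⊗ ∑A i ⊞⊞ (f₁q - fqq) ⊗ ∑δ j
             ⊞⊞ (fₚq - fqq) ⊗ ∑A j ⊞⊞ (f₁₁ - 2 · f₁q + fqq) ⊗ ∑δδ
             ⊞⊞ (f₁ₚ - f₁q - fₚq + fqq) ⊗ ∑δA ⊞⊞ (f₁ₚ - f₁q - fₚq + fqq) ⊗ ∑Aδ
             ⊞⊞ (fₚₚ - 2 · fₚq + fqq) ⊗ ∑AA-edge ⊞⊞ done ⟩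
        _ ≈⟨ solve 9 (λ V K L f₁₁ f₁ₚ f₁q fₚₚ fₚq fqq →
               fqq :* V :+ ((f₁q :- fqq) :* :1 :+ ((fₚq :- fqq) :* K :+ ((f₁q :- fqq) :* :1
                 :+ ((fₚq :- fqq) :* K :+ ((f₁₁ :- 2 :· f₁q :+ fqq) :* :0
                 :+ ((f₁ₚ :- f₁q :- fₚq :+ fqq) :* :1 :+ ((f₁ₚ :- f₁q :- fₚq :+ fqq) :* :1
                 :+ ((fₚₚ :- 2 :· fₚq :+ fqq) :* L :+ :0))))))))
               := 2 :· f₁ₚ :+ L :* fₚₚ :+ 2 :· (K :- L :- :1) :* fₚq :+ (V :- 2 :· K :+ L) :* fqq)
               refl V K L f₁₁ f₁ₚ f₁q fₚₚ fₚq fqq ⟩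
        2 · f₁ₚ + L * fₚₚ + 2 · (K - L - 1#) * fₚq + (V - 2 · K + L) * fqq
          ≈⟨ +-cong (+-congʳ (+-congˡ (*-congˡ (φ-cong (solve 1 (λ p → p :+ p := 2 :· p) refl p)))))
               (*-congˡ (φ-cong (solve 1 (λ p → p :+ p := 2 :· p) refl q))) ⟩
        2 · φ (1# + p) + L * φ (2 · p) + 2 · (K - L - 1#) * φ (p + q) + (V - 2 · K + L) * φ (2 · q) ∎
        where
        f₁₁ = φ (1# + 1#)
        f₁ₚ = φ (1# + p)
        f₁q = φ (1# + q)
        fₚₚ = φ (p + p)
        fₚq = φ (p + q)
        fqq = φ (q + q)
        f1p : φ (p + 1#) ≈ f₁ₚ
        f1p = φ-cong (+-comm _ _)
        f1q : φ (q + 1#) ≈ f₁q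
        f1q = φ-cong (+-comm _ _)
        fpq : φ (q + p) ≈ fₚq
        fpq = φ-cong (+-comm _ _)

      -- The edges at `i`: the edge to `j` itself, the L that close a triangle with `j`, and the
      -- rest.
      ∑-adjacent-edges : ∀ {φ} → Congruent φ →
        ∑[ b < v ] (A i b * φ (E i b + E j b)) ≈ φ (1# + p) + L * φ (2 · p) + (K - L - 1#) * φ (p + q)
      ∑-adjacent-edges {φ} φ-cong = begin
        ∑[ b < v ] (A i b * φ (E i b + E j b))
          ≈⟨ ∑-cong (λ b → begin
               A i b * φ (E i b + E j b)
                 ≈⟨ on-adjacent i b (λ ib → φ-cong (+-congʳ (E-adj ib))) ⟩
               A i b * φ (p + E j b)
                 ≈⟨ *-congˡ (on-E {λ r → φ (p + r)} (λ r≈r′ → φ-cong (+-congˡ r≈r′)) j b) ⟩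
               A i b * (δ j b * φ (p + 1#) + (A j b * φ (p + p) + N j b * φ (p + q)))
                 ≈⟨ *-congˡ (+-cong (*-congˡ (φ-cong (+-comm _ _))) (+-congʳ (*-congˡ
                      (φ-cong (solve 1 (λ p → p :+ p := 2 :· p) refl p))))) ⟩
               A i b * (δ j b * φ (1# + p) + (A j b * φ (2 · p) + N j b * φ (p + q)))
                 ≈⟨ solve 6 (λ a e b f g h → a :* (e :* f :+ (b :* g :+ (:1 :- e :- b) :* h))
                      := h :* a :+ ((f :- h) :* (a :* e) :+ ((g :- h) :* (a :* b) :+ :0)))
                      refl (A i b) (δ j b) (A j b) _ _ _ ⟩
               _ ∎) ⟩
        _ ≈⟨ φ (p + q) ⊗ ∑A i ⊞⊞ (φ (1# + p) - φ (p + q)) ⊗ ∑Aδ ⊞⊞ (φ (2 · p) - φ (p + q)) ⊗ ∑AA-edge ⊞⊞ done ⟩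
        _ ≈⟨ solve 5 (λ K L f g h → h :* K :+ ((f :- h) :* :1 :+ ((g :- h) :* L :+ :0))
               := f :+ L :* g :+ (K :- L :- :1) :* h) refl K L _ _ _ ⟩
        φ (1# + p) + L * φ (2 · p) + (K - L - 1#) * φ (p + q) ∎

-- Pairs of edges, grouped by the adjacencies between them

module EdgePairs {c ℓ} (CR : CommutativeRing c ℓ) {v : ℕ} (G : Graph v) (k lam μ : ℕ)
  (srg : IsStronglyRegular G k lam μ) (p q : CommutativeRing.Carrier CR)
  (ψ : CommutativeRing.Carrier CR → CommutativeRing.Carrier CR)
  (ψ-cong : ∀ {x y} → CommutativeRing._≈_ CR x y → CommutativeRing._≈_ CR (ψ x) (ψ y)) where
  open CommutativeRing CR hiding (zero)
  open FiniteSums CR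
  open IntegerSolver CR
  open Counting CR
  open CliqueCount G
  open StronglyRegularSums CR G k lam μ srg
  open Cosine p q
  open Graph G using (adj) renaming (sym to adj-sym)
  open SetoidReasoning setoid

  -- The index of f is the number of non-adjacencies among the four pairs. As ψ sees only this
  -- number, the forward differences taken at `f₄`, where no pair is adjacent, are the coefficients
  -- of the multilinear expansion by degree; `Δ₄` is the alternating sum in `ΨC₁`.
  f₀ f₁ f₂ f₃ f₄ Δ₁ Δ₂ Δ₃ Δ₄ : Carrier
  f₀ = ψ (4 · p + 0 · q)
  f₁ = ψ (3 · p + 1 · q)
  f₂ = ψ (2 · p + 2 · q)
  f₃ = ψ (1 · p + 3 · q)
  f₄ = ψ (0 · p + 4 · q)
  Δ₁ = f₃ - f₄
  Δ₂ = f₂ - 2 · f₃ + f₄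
  Δ₃ = f₁ - 3 · f₂ + 3 · f₃ - f₄
  Δ₄ = f₀ - 4 · f₁ + 6 · f₂ - 4 · f₃ + f₄

  -- With x = A i a and y = A j a: the sum over b of A a b * ψ (S₄ i j a b), without
  -- the term of degree four in the adjacencies between {i , j} and {a , b}, and with
  -- the terms quadratic in the adjacencies of b exchanged for those of a.
  P : Carrier → Carrier → Carrier
  P x y = (f₄ + Δ₁ * (x + y) + 2 · Δ₂ * (x * y)) * (K - x - y)
        + (Δ₁ + Δ₂ * (x + y) + 2 · Δ₃ * (x * y)) * ((x * L + (1# - x) * M - y) + (y * L + (1# - y) * M - x))

  S₄ : (i j a b : Fin v) → Carrier
  S₄ i j a b = E i a + E i b + (E j a + E j b)

  private
    module OneEdge {i j : Fin v} (ij : adj i j ≡ true) where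
      open Edge ij

      φ : Fin v → Fin v → Carrier
      φ a b = A a b * ψ (S₄ i j a b)

      φ-comm : ∀ a b → φ a b ≈ φ b a
      φ-comm a b = *-cong (A-sym a b) (ψ-cong (+-cong (+-comm _ _) (+-comm _ _)))

      φ-diag : ∀ a → φ a a ≈ 0#
      φ-diag a = trans (*-congʳ (A-diag a)) (zeroˡ _)

      -- Sorted by the degree in the adjacencies of `b`. Up to degree one (`U`) the sum over `b` is
      -- given by the parameters. A product `A a b * A i b * A j b` would count common neighbours of
      -- three vertices, which the parameters do not determine; so `R` is traded for `T`, where `a`
      -- carries the quadratic factor. `Q` is quadratic at both ends and stays.
      X Y U R T Q : Fin v → Fin v → Carrier
      X a b = A a b * A i b
      Y a b = A a b * A j b
      U a b = (f₄ + Δ₁ * (A i a + A j a) + Δ₂ * (A i a * A j a)) * A a b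
            + (Δ₁ + Δ₂ * (A i a + A j a) + Δ₃ * (A i a * A j a)) * (X a b + Y a b)
      R a b = A a b * (A i b * A j b) * (Δ₂ + Δ₃ * (A i a + A j a))
      T a b = Δ₂ * (A i a * A j a) * A a b + Δ₃ * (A i a * A j a) * (X a b + Y a b)
      Q a b = A a b * (A i a * A j a * (A i b * A j b))

      φ-outside : ∀ a b → i ≢ a → j ≢ a → i ≢ b → j ≢ b → φ a b ≈ U a b + R a b + Δ₄ * Q a b
      φ-outside a b i≢a j≢a i≢b j≢b = begin
        A a b * ψ (S₄ i j a b)
          ≈⟨ *-congˡ (ψ-cong (trans
               (+-cong (+-cong (E-distinct i≢a) (E-distinct i≢b)) (+-cong (E-distinct j≢a) (E-distinct j≢b)))
               (solve 4 (λ x y z w → x :+ y :+ (z :+ w) := :0 :+ :0 :+ (x :+ (y :+ (z :+ (w :+ :0))))) refl _ _ _ _))) ⟩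
        A a b * ψ (0 · p + 0 · q + cosines ψ (adj i a ∷ adj i b ∷ adj j a ∷ adj j b ∷ []))
          ≈⟨ *-congˡ (on-cosines ψ ψ-cong (adj i a ∷ adj i b ∷ adj j a ∷ adj j b ∷ []) 0 0) ⟩
        A a b * mixed ψ (adj i a ∷ adj i b ∷ adj j a ∷ adj j b ∷ []) 0 0
          ≈⟨ solve 10 (λ e x x′ y y′ f₀ f₁ f₂ f₃ f₄ →
               let Δ₁ = f₃ :- f₄
                   Δ₂ = f₂ :- 2 :· f₃ :+ f₄
                   Δ₃ = f₁ :- 3 :· f₂ :+ 3 :· f₃ :- f₄
                   Δ₄ = f₀ :- 4 :· f₁ :+ 6 :· f₂ :- 4 :· f₃ :+ f₄
                   step = λ x f g → x :* f :+ (:1 :- x) :* g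
               in e :* step x (step x′ (step y (step y′ f₀ f₁) (step y′ f₁ f₂)) (step y (step y′ f₁ f₂) (step y′ f₂ f₃)))
                              (step x′ (step y (step y′ f₁ f₂) (step y′ f₂ f₃)) (step y (step y′ f₂ f₃) (step y′ f₃ f₄)))
                  := (f₄ :+ Δ₁ :* (x :+ y) :+ Δ₂ :* (x :* y)) :* e
                     :+ (Δ₁ :+ Δ₂ :* (x :+ y) :+ Δ₃ :* (x :* y)) :* (e :* x′ :+ e :* y′)
                     :+ e :* (x′ :* y′) :* (Δ₂ :+ Δ₃ :* (x :+ y))
                     :+ Δ₄ :* (e :* (x :* y :* (x′ :* y′))))
               refl (A a b) (A i a) (A i b) (A j a) (A j b) f₀ f₁ f₂ f₃ f₄ ⟩
        U a b + R a b + Δ₄ * Q a b ∎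

      -- Exchanging a and b moves the degree in b to a.
      ∑′R : ∑′ (λ a → ∑′ (λ b → R a b)) ≈ ∑′ (λ a → ∑′ (λ b → T a b))
      ∑′R = trans (∑′-comm R) (∑′-cong (λ a _ _ → ∑′-cong (λ b _ _ → trans
        (*-congʳ (*-congʳ (A-sym b a)))
        (solve 7 (λ e x y x′ y′ d d′ → e :* (x :* y) :* (d :+ d′ :* (x′ :+ y′))
           := d :* (x :* y) :* e :+ d′ :* (x :* y) :* (e :* x′ :+ e :* y′)) refl _ _ _ _ _ Δ₂ Δ₃))))

      ∑′UT : ∑′ (λ a → ∑′ (λ b → U a b + T a b)) ≈ ∑′ (λ a → P (A i a) (A j a))
      ∑′UT = ∑′-cong (λ a i≢a j≢a → begin
        ∑′ (λ b → U a b + T a b)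
          ≈⟨ ∑′-cong (λ b _ _ → solve 9 (λ x y e x′ y′ f₄ Δ₁ Δ₂ Δ₃ →
               (f₄ :+ Δ₁ :* (x :+ y) :+ Δ₂ :* (x :* y)) :* e
                 :+ (Δ₁ :+ Δ₂ :* (x :+ y) :+ Δ₃ :* (x :* y)) :* (e :* x′ :+ e :* y′)
                 :+ (Δ₂ :* (x :* y) :* e :+ Δ₃ :* (x :* y) :* (e :* x′ :+ e :* y′))
               := (f₄ :+ Δ₁ :* (x :+ y) :+ 2 :· Δ₂ :* (x :* y)) :* e
                  :+ (Δ₁ :+ Δ₂ :* (x :+ y) :+ 2 :· Δ₃ :* (x :* y)) :* (e :* x′ :+ e :* y′))
               refl (A i a) (A j a) (A a b) (A i b) (A j b) f₄ Δ₁ Δ₂ Δ₃) ⟩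
        ∑′ (λ b → (f₄ + Δ₁ * (A i a + A j a) + 2 · Δ₂ * (A i a * A j a)) * A a b
                + (Δ₁ + Δ₂ * (A i a + A j a) + 2 · Δ₃ * (A i a * A j a)) * (X a b + Y a b))
          ≈⟨ trans (∑′-+ _ _) (+-cong (trans (∑′-scale _ _) (*-congˡ (∑′A a)))
               (trans (∑′-scale _ _) (*-congˡ (trans (∑′-+ _ _) (+-cong (∑′AAi i≢a) (∑′AAj j≢a)))))) ⟩
        P (A i a) (A j a) ∎)

      ∑′φ : ∑′ (λ a → ∑′ (λ b → φ a b)) ≈
        (V - 2 · K + L) * P 0# 0# + (K - L - 1#) * (P 1# 0# + P 0# 1#) + L * P 1# 1#
          + Δ₄ * ∑′ (λ a → ∑′ (λ b → Q a b))
      ∑′φ = begin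
        ∑′ (λ a → ∑′ (λ b → φ a b))
          ≈⟨ ∑′-cong (λ a i≢a j≢a → ∑′-cong (λ b i≢b j≢b → φ-outside a b i≢a j≢a i≢b j≢b)) ⟩
        ∑′ (λ a → ∑′ (λ b → U a b + R a b + Δ₄ * Q a b))
          ≈⟨ ∑′∑′-+ (λ a b → U a b + R a b) _ ⟩
        ∑′ (λ a → ∑′ (λ b → U a b + R a b)) + ∑′ (λ a → ∑′ (λ b → Δ₄ * Q a b))
          ≈⟨ +-cong (trans (∑′∑′-+ U R) (trans (+-congˡ ∑′R) (sym (∑′∑′-+ U T))))
               (trans (∑′-cong (λ a _ _ → ∑′-scale Δ₄ _)) (∑′-scale Δ₄ _)) ⟩
        ∑′ (λ a → ∑′ (λ b → U a b + T a b)) + Δ₄ * ∑′ (λ a → ∑′ (λ b → Q a b))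
          ≈⟨ +-congʳ (trans ∑′UT (∑′-bits P)) ⟩
        _ ∎
        where
        ∑′∑′-+ : ∀ (F G : Fin v → Fin v → Carrier) → ∑′ (λ a → ∑′ (λ b → F a b + G a b)) ≈
                 ∑′ (λ a → ∑′ (λ b → F a b)) + ∑′ (λ a → ∑′ (λ b → G a b))
        ∑′∑′-+ F G = trans (∑′-cong (λ a _ _ → ∑′-+ _ _)) (∑′-+ _ _)

      -- By symmetry of φ, the rows and columns of `i` and `j` contribute twice the two rows. The
      -- entries at (i, j) and (j, i) are then counted twice, and the diagonal ones vanish.
      ∑φ : ∑[ a < v ] ∑[ b < v ] φ a b ≈
        ∑′ (λ a → ∑′ (λ b → φ a b)) + 2 · (∑[ b < v ] φ i b + ∑[ b < v ] φ j b) - 2 · φ i j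
      ∑φ = ≈-from-difference
        (multiple (- 1#) expand ⊞ multiple 1# (φ-comm i j) ⊞ multiple (- 1#) (φ-diag i) ⊞ multiple (- 1#) (φ-diag j))
        (solve 8 (λ s t x y ij ji ii jj →
           s :- (t :+ 2 :· (x :+ y) :- 2 :· ij)
           := :- :1 :* (t :- (s :- x :- y :- (x :- ii :- ij) :- (y :- ji :- jj)))
                :+ (:1 :* (ij :- ji) :+ (:- :1 :* (ii :- :0) :+ :- :1 :* (jj :- :0)))) refl _ _ _ _ _ _ _ _)
        where
        expand : ∑′ (λ a → ∑′ (λ b → φ a b)) ≈
          ∑[ a < v ] ∑[ b < v ] φ a b - ∑[ b < v ] φ i b - ∑[ b < v ] φ j b
            - (∑[ b < v ] φ i b - φ i i - φ i j) - (∑[ b < v ] φ j b - φ j i - φ j j)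
        expand = begin
          ∑′ (λ a → ∑′ (λ b → φ a b))
            ≈⟨ trans (∑′≈ _) (+-cong (+-cong (∑-cong (λ a → ∑′≈ (φ a))) (-‿cong (∑′≈ (φ i)))) (-‿cong (∑′≈ (φ j)))) ⟩
          ∑[ a < v ] (∑[ b < v ] φ a b - φ a i - φ a j)
            - (∑[ b < v ] φ i b - φ i i - φ i j) - (∑[ b < v ] φ j b - φ j i - φ j j)
            ≈⟨ +-congʳ (+-congʳ (trans (∑-distrib-minus _ _) (+-cong (trans (∑-distrib-minus _ _)
                 (+-congˡ (-‿cong (∑-cong (λ a → φ-comm a i))))) (-‿cong (∑-cong (λ a → φ-comm a j)))))) ⟩
          _ ∎

      ∑φi : ∑[ b < v ] φ i b ≈ ψ (ι 2 + 2 · p) + L * ψ (1# + 3 · p) + (K - L - 1#) * ψ (1# + 2 · p + q)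
      ∑φi = begin
        ∑[ b < v ] φ i b
          ≈⟨ ∑-cong (λ b → *-congˡ (ψ-cong (trans
               (+-cong (+-congʳ (E-diag i)) (+-congʳ (trans (E-sym j i) (E-adj ij))))
               (solve 3 (λ x y p → :1 :+ x :+ (p :+ y) := :1 :+ p :+ (x :+ y)) refl _ _ p)))) ⟩
        ∑[ b < v ] (A i b * ψ (1# + p + (E i b + E j b)))
          ≈⟨ ∑-adjacent-edges ij {λ r → ψ (1# + p + r)} (λ r≈r′ → ψ-cong (+-congˡ r≈r′)) ⟩
        ψ (1# + p + (1# + p)) + L * ψ (1# + p + 2 · p) + (K - L - 1#) * ψ (1# + p + (p + q))
          ≈⟨ +-cong (+-cong
               (ψ-cong (solve 1 (λ p → :1 :+ p :+ (:1 :+ p) := :ι 2 :+ 2 :· p) refl p))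
               (*-congˡ (ψ-cong (solve 1 (λ p → :1 :+ p :+ 2 :· p := :1 :+ 3 :· p) refl p))))
               (*-congˡ (ψ-cong (solve 2 (λ p q → :1 :+ p :+ (p :+ q) := :1 :+ 2 :· p :+ q) refl p q))) ⟩
        _ ∎

      φij : φ i j ≈ ψ (ι 2 + 2 · p)
      φij = trans (*-cong Aij (ψ-cong (trans
          (+-cong (+-cong (E-diag i) (E-adj ij)) (+-cong (trans (E-sym j i) (E-adj ij)) (E-diag j)))
          (solve 1 (λ p → :1 :+ p :+ (p :+ :1) := :ι 2 :+ 2 :· p) refl p))))
        (*-identityˡ _)

  ∑-edge-edges : ∀ {i j} (ij : adj i j ≡ true) →
    ∑[ a < v ] ∑[ b < v ] (A a b * ψ (S₄ i j a b)) ≈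
      2 · ψ (ι 2 + 2 · p) + 4 · (L * ψ (1# + 3 · p)) + 4 · ((K - L - 1#) * ψ (1# + 2 · p + q))
      + ((V - 2 · K + L) * P 0# 0# + (K - L - 1#) * (P 1# 0# + P 0# 1#) + L * P 1# 1#)
      + Δ₄ * ∑[ a < v ] ∑[ b < v ] (A a b * (A i a * A j a * (A i b * A j b)))
  ∑-edge-edges {i} {j} ij = begin
    ∑[ a < v ] ∑[ b < v ] (A a b * ψ (S₄ i j a b))
      ≈⟨ ∑φ ij ⟩
    _ ≈⟨ +-cong (+-cong (∑′φ ij) (+-cong (+-cong (∑φi ij) swapped) (+-congʳ (+-cong (∑φi ij) swapped))))
           (-‿cong (+-cong (φij ij) (+-congʳ (φij ij)))) ⟩
    _ ≈⟨ solve 5 (λ u d z x y → u :+ d :+ 2 :· ((z :+ x :+ y) :+ (z :+ x :+ y)) :- 2 :· z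
           := 2 :· z :+ 4 :· x :+ 4 :· y :+ u :+ d) refl _ _ _ _ _ ⟩
    _ ≈⟨ +-congˡ (*-congˡ ∑′Q) ⟩
    _ ∎
    where
    open Edge ij
    open OneEdge
    ji : adj j i ≡ true
    ji = ≡.trans (adj-sym j i) ij
    swapped : ∑[ b < v ] (A j b * ψ (S₄ i j j b)) ≈
      ψ (ι 2 + 2 · p) + L * ψ (1# + 3 · p) + (K - L - 1#) * ψ (1# + 2 · p + q)
    swapped = trans (∑-cong (λ b → *-congˡ (ψ-cong (+-comm _ _)))) (∑φi ji)
    -- A vertex adjacent to both `i` and `j` is neither of them, so the sum may run over all
    -- vertices, as the clique count requires.
    ∑′Q : ∑′ (λ a → ∑′ (λ b → A a b * (A i a * A j a * (A i b * A j b)))) ≈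
          ∑[ a < v ] ∑[ b < v ] (A a b * (A i a * A j a * (A i b * A j b)))
    ∑′Q = trans (∑-cong (λ a → *-distribˡ-∑ (outside a) _)) (∑-cong (λ a → ∑-cong (λ b → begin
      outside a * (outside b * (A a b * (A i a * A j a * (A i b * A j b))))
        ≈⟨ solve 6 (λ o o′ e x y z → o :* (o′ :* (e :* (x :* y :* z))) := e :* ((o :* (x :* y)) :* (o′ :* z)))
             refl _ _ _ (A i a) (A j a) (A i b * A j b) ⟩
      A a b * ((outside a * (A i a * A j a)) * (outside b * (A i b * A j b)))
        ≈⟨ *-congˡ (*-cong (redundant a) (redundant b)) ⟩
      A a b * (A i a * A j a * (A i b * A j b)) ∎)))
      where
      δA≈0 : ∀ x y → δ x y * A x y ≈ 0#
      δA≈0 x y with relation x y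
      ... | equal ≡.refl       = trans (*-congˡ (A-diag x)) (zeroʳ _)
      ... | adjacent′ x≢y _    = trans (*-congʳ (δ-≢ x≢y)) (zeroˡ _)
      ... | unconnected x≢y _  = trans (*-congʳ (δ-≢ x≢y)) (zeroˡ _)
      redundant : ∀ x → outside x * (A i x * A j x) ≈ A i x * A j x
      redundant x = ≈-from-difference
        (multiple (- A j x) (δA≈0 i x) ⊞ multiple (- A i x) (δA≈0 j x))
        (solve 4 (λ d e a b → (:1 :- d :- e) :* (a :* b) :- a :* b
           := :- b :* (d :* a :- :0) :+ :- a :* (e :* b :- :0)) refl (δ i x) (δ j x) (A i x) (A j x))

  ∑-edges : ∀ (f : Fin v → Fin v → Carrier) s → (∀ {i j} → adj i j ≡ true → f i j ≈ s) →
            ∑[ i < v ] ∑[ j < v ] (A i j * f i j) ≈ V * (K * s)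
  ∑-edges f s f≈s = trans (∑-cong (λ i → trans
      (∑-cong (λ j → on-adjacent i j f≈s))
      (trans (sym (*-distribʳ-∑ s _)) (*-congʳ (∑A i)))))
    (∑-const v _)

  ∑-edge-pairs :
    ∑[ i < v ] ∑[ j < v ] ∑[ a < v ] ∑[ b < v ] (A i j * (A a b * ψ (S₄ i j a b))) ≈
      V * (K * (2 · ψ (ι 2 + 2 · p) + 4 · (L * ψ (1# + 3 · p)) + 4 · ((K - L - 1#) * ψ (1# + 2 · p + q))
        + ((V - 2 · K + L) * P 0# 0# + (K - L - 1#) * (P 1# 0# + P 0# 1#) + L * P 1# 1#)))
      + Δ₄ * (ι 24 * ι (#K₄ G))
  ∑-edge-pairs = begin
    ∑[ i < v ] ∑[ j < v ] ∑[ a < v ] ∑[ b < v ] (A i j * (A a b * ψ (S₄ i j a b)))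
      ≈⟨ ∑-cong (λ i → ∑-cong (λ j → trans
           (trans (∑-cong (λ a → sym (*-distribˡ-∑ (A i j) _))) (sym (*-distribˡ-∑ (A i j) _)))
           (trans (on-adjacent i j ∑-edge-edges)
             (solve 4 (λ e s d t → e :* (s :+ d :* t) := e :* s :+ d :* (e :* t)) refl _ _ _ _)))) ⟩
    ∑[ i < v ] ∑[ j < v ] (A i j * c₀ + Δ₄ * (A i j * τ i j))
      ≈⟨ trans (∑-cong (λ i → ∑-distrib-+ _ _)) (∑-distrib-+ _ _) ⟩
    ∑[ i < v ] ∑[ j < v ] (A i j * c₀) + ∑[ i < v ] ∑[ j < v ] (Δ₄ * (A i j * τ i j))
      ≈⟨ +-cong (∑-edges (λ _ _ → c₀) c₀ (λ _ → refl))
           (trans (∑-cong (λ i → sym (*-distribˡ-∑ Δ₄ _))) (sym (*-distribˡ-∑ Δ₄ _))) ⟩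
    V * (K * c₀) + Δ₄ * ∑[ i < v ] ∑[ j < v ] (A i j * τ i j)
      -- With the weight `A i j`, the term of degree four is the indicator that i, j, a, b form a
      -- clique.
      ≈⟨ +-congˡ (*-congˡ (trans (∑-cong (λ i → ∑-cong (λ j → trans (*-distribˡ-∑ (A i j) _)
           (∑-cong (λ a → trans (*-distribˡ-∑ (A i j) _) (∑-cong (λ b →
             solve 6 (λ ij ab ia ja ib jb → ij :* (ab :* (ia :* ja :* (ib :* jb)))
               := ij :* ia :* ib :* ja :* jb :* ab) refl _ _ _ _ _ _))))))) ∑-cliques)) ⟩
    V * (K * c₀) + Δ₄ * (ι 24 * ι (#K₄ G)) ∎
    where
    c₀ : Carrier
    c₀ = 2 · ψ (ι 2 + 2 · p) + 4 · (L * ψ (1# + 3 · p)) + 4 · ((K - L - 1#) * ψ (1# + 2 · p + q))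
        + ((V - 2 · K + L) * P 0# 0# + (K - L - 1#) * (P 1# 0# + P 0# 1#) + L * P 1# 1#)
    τ : Fin v → Fin v → Carrier
    τ i j = ∑[ a < v ] ∑[ b < v ] (A a b * (A i a * A j a * (A i b * A j b)))

-- Inequalities between the parameters and the quadratic equation for s

module ParameterIdentities {c ℓ₁ ℓ₂ ℓ₃} (R : Reals c ℓ₁ ℓ₂ ℓ₃) (v k lam μ : ℕ) (G : Graph v)
  (srg : IsStronglyRegular G k lam μ) (0<k : 0 ℕ.< k) (k+1<v : suc k ℕ.< v) where
  open Reals R hiding (zero)
  open RealInequalities R
  open FiniteSums commutativeRing hiding (ι; _·_)
  open IntegerSolver commutativeRing
  open Counting commutativeRing
  open CliqueCount G
  open StronglyRegularSums commutativeRing G k lam μ srg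
  open SetoidReasoning setoid

  W : Carrier
  W = V - K - 1#

  vertex : Fin v
  vertex = fromℕ< (ℕ.<-trans (s≤s z≤n) k+1<v)

  ι-∸≈W : ι (v ∸ suc k) ≈ W
  ι-∸≈W = ≈-from-difference
    (multiple 1# (trans (sym (ι-+ (suc k) (v ∸ suc k))) (reflexive (≡.cong ι (ℕ.m+[n∸m]≡n (ℕ.<⇒≤ k+1<v))))))
    (solve 3 (λ w V K → w :- (V :- K :- :1) := :1 :* (:1 :+ K :+ w :- V)) refl _ V K)

  pos : ∀ {n} → 0 ℕ.< n → 0# < ι n
  pos (s≤s {n = n} _) = 0<ι R n

  0<K : 0# < K
  0<K = pos 0<k

  0<W : 0# < W
  0<W = <-respʳ-≈ ι-∸≈W (pos (ℕ.m<n⇒0<n∸m k+1<v))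

  cancel : ∀ {x y z} → 0# < z → x * z ≈ y * z → x ≈ y
  cancel {x} {y} {z} 0<z xz≈yz with reciprocal (#-sym (<⇒# 0<z))
  ... | u , uz≈1 = ≈-from-difference (multiple u xz≈yz ⊞ multiple (y - x) uz≈1)
    (solve 4 (λ x y z u → x :- y := u :* (x :* z :- y :* z) :+ (y :- x) :* (u :* z :- :1)) refl x y z u)

  bit-nonneg : ∀ β {x} → 0# ≤ x → 0# ≤ bit β * x
  bit-nonneg true  0≤x = ≤-respʳ-≈ (sym (*-identityˡ _)) 0≤x
  bit-nonneg false 0≤x = ≤-respʳ-≈ (sym (zeroˡ _)) ≤-refl

  -- `W * (K - M)` counts the pairs (y, z) in which `y` is a non-neighbour of `vertex` and `z` a
  -- neighbour of `vertex` but not of `y`. The count is a sum of nonnegative terms, and `W` is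
  -- positive.
  0≤K-M : 0# ≤ K - M
  0≤K-M = *-cancel-nonneg 0<W (≤-respʳ-≈ (begin
    ∑[ y < v ] (N vertex y * ∑[ z < v ] (A vertex z * (1# - A y z)))
      ≈⟨ ∑-cong (λ y → begin
           N vertex y * ∑[ z < v ] (A vertex z * (1# - A y z))
             ≈⟨ *-congˡ (trans (∑-cong (λ z → solve 2 (λ a b → a :* (:1 :- b)
                    := :1 :* a :+ (:- :1 :* (a :* b) :+ :0)) refl (A vertex z) (A y z)))
                  (1# ⊗ ∑A vertex ⊞⊞ (- 1#) ⊗ ∑AA vertex y ⊞⊞ done)) ⟩
           N vertex y * (1# * K + (- 1# * (δ vertex y * K + (A vertex y * L + N vertex y * M)) + 0#))
             ≈⟨ on-N y ⟩
           (K - M) * 1# + (- (K - M) * δ vertex y + (- (K - M) * A vertex y + 0#)) ∎) ⟩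
    _ ≈⟨ (K - M) ⊗ ∑1 ⊞⊞ (- (K - M)) ⊗ ∑δ vertex ⊞⊞ (- (K - M)) ⊗ ∑A vertex ⊞⊞ done ⟩
    _ ≈⟨ solve 3 (λ V K M → (K :- M) :* V :+ (:- (K :- M) :* :1 :+ (:- (K :- M) :* K :+ :0))
           := (V :- K :- :1) :* (K :- M)) refl V K M ⟩
    W * (K - M) ∎)
    (∑-nonneg (λ y → N-nonneg y (∑-nonneg (λ z → bit-nonneg _ (1-bit-nonneg _))))))
    where
    1-bit-nonneg : ∀ β → 0# ≤ 1# - bit β
    1-bit-nonneg true  = ≤-respʳ-≈ (sym (-‿inverseʳ 1#)) ≤-refl
    1-bit-nonneg false = ≤-respʳ-≈ (solve 0 (:1 := :1 :- :0) refl) (<⇒≤ 0<1)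

    N-bit : ∀ x y → (N x y ≈ 0# ⊎ N x y ≈ 1#)
    N-bit x y with relation x y
    ... | equal ≡.refl       = inj₁ (trans (+-cong (+-congˡ (-‿cong (δ-≡ x))) (-‿cong (A-diag x)))
                                 (solve 0 (:1 :- :1 :- :0 := :0) refl))
    ... | adjacent′ x≢y xy   = inj₁ (trans (+-cong (+-congˡ (-‿cong (δ-≢ x≢y))) (-‿cong (A-adj xy)))
                                 (solve 0 (:1 :- :0 :- :1 := :0) refl))
    ... | unconnected x≢y xy = inj₂ (trans (+-cong (+-congˡ (-‿cong (δ-≢ x≢y))) (-‿cong (A-nonadj xy)))
                                 (solve 0 (:1 :- :0 :- :0 := :1) refl))

    N-nonneg : ∀ y {x} → 0# ≤ x → 0# ≤ N vertex y * x
    N-nonneg y 0≤x with N-bit vertex y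
    ... | inj₁ N≈0 = ≤-respʳ-≈ (sym (trans (*-congʳ N≈0) (zeroˡ _))) ≤-refl
    ... | inj₂ N≈1 = ≤-respʳ-≈ (sym (trans (*-congʳ N≈1) (*-identityˡ _))) 0≤x

    N*δ : ∀ x y → N x y * δ x y ≈ 0#
    N*δ x y with relation x y
    ... | equal ≡.refl      = trans (*-cong (trans (+-cong (+-congˡ (-‿cong (δ-≡ x))) (-‿cong (A-diag x)))
                                (solve 0 (:1 :- :1 :- :0 := :0) refl)) refl) (zeroˡ _)
    ... | adjacent′ x≢y _   = trans (*-congˡ (δ-≢ x≢y)) (zeroʳ _)
    ... | unconnected x≢y _ = trans (*-congˡ (δ-≢ x≢y)) (zeroʳ _)

    N*A : ∀ x y → N x y * A x y ≈ 0#
    N*A x y with relation x y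
    ... | equal ≡.refl       = trans (*-congˡ (A-diag x)) (zeroʳ _)
    ... | adjacent′ x≢y xy   = trans (*-cong (trans (+-cong (+-congˡ (-‿cong (δ-≢ x≢y))) (-‿cong (A-adj xy)))
                                 (solve 0 (:1 :- :0 :- :1 := :0) refl)) refl) (zeroˡ _)
    ... | unconnected x≢y xy = trans (*-congˡ (A-nonadj xy)) (zeroʳ _)

    on-N : ∀ y → N vertex y * (1# * K + (- 1# * (δ vertex y * K + (A vertex y * L + N vertex y * M)) + 0#)) ≈
      (K - M) * 1# + (- (K - M) * δ vertex y + (- (K - M) * A vertex y + 0#))
    on-N y = ≈-from-difference (multiple (M - K) (N*δ vertex y) ⊞ multiple (M - L) (N*A vertex y))
      (solve 5 (λ d a K L M → let n = :1 :- d :- a in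
         n :* (:1 :* K :+ (:- :1 :* (d :* K :+ (a :* L :+ n :* M)) :+ :0))
           :- ((K :- M) :* :1 :+ (:- (K :- M) :* d :+ (:- (K :- M) :* a :+ :0)))
         := (M :- K) :* (n :* d :- :0) :+ (M :- L) :* (n :* a :- :0))
         refl (δ vertex y) (A vertex y) K L M)

  -- The quadratic formula, cleared of the denominator 4. `0≤K-M` makes the discriminant
  -- nonnegative, the range in which `√-square` applies.
  half-root : ∀ {s} → s * ι 2 ≈ L - M - √ ((L - M) * (L - M) + 4 · (K - M)) → s * s ≈ (L - M) * s + (K - M)
  half-root {s} 2s≈ = cancel (0<ι R 3) (≈-from-difference
    (multiple (s * ι 2 - (L - M) - r) 2s≈ ⊞ multiple 1# (√-square 0≤disc))
    (solve 5 (λ s L M K r → s :* s :* :ι 4 :- ((L :- M) :* s :+ (K :- M)) :* :ι 4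
       := (s :* :ι 2 :- (L :- M) :- r) :* (s :* :ι 2 :- (L :- M :- r))
          :+ :1 :* (r :* r :- ((L :- M) :* (L :- M) :+ 4 :· (K :- M)))) refl s L M K r))
    where
    disc = (L - M) * (L - M) + 4 · (K - M)
    r = √ disc
    0≤disc : 0# ≤ disc
    0≤disc = +-nonneg (x²-nonneg _) (≤-respʳ-≈ (solve 1 (λ x → :ι 4 :* x := 4 :· x) refl _)
      (*-nonneg-pos (0<ι R 3) 0≤K-M))

-- The projection onto the s-eigenspace and the embedding in the sphere

module Spectrum {c ℓ₁ ℓ₂ ℓ₃} (R : Reals c ℓ₁ ℓ₂ ℓ₃) (v k lam μ : ℕ) (G : Graph v)
  (srg : IsStronglyRegular G k lam μ) (0<k : 0 ℕ.< k) (k+1<v : suc k ℕ.< v) where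
  open Reals R hiding (zero)
  open RealInequalities R
  open FiniteSums commutativeRing hiding (ι; _·_)
  open IntegerSolver commutativeRing
  open Counting commutativeRing
  open CliqueCount G
  open StronglyRegularSums commutativeRing G k lam μ srg
  open ParameterIdentities R v k lam μ G srg 0<k k+1<v
  open SetoidReasoning setoid

  module _ (p q s : Carrier) (pK≈s : p * K ≈ s) (qW≈-[s+1] : q * W ≈ - (s + 1#))
    (s² : s * s ≈ (L - M) * s + (K - M)) where
    open Cosine p q

    -- The entry of A E = s E at an adjacent pair; `nonadjacent-cosine` is the entry at a
    -- non-adjacent one. After multiplication by K or W, each follows from the parameter identity
    -- and the quadratic equation for s.
    adjacent-cosine : 1# + p * L + q * (K - 1# - L) ≈ s * p
    adjacent-cosine = cancel 0<K (≈-from-difference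
      (multiple (L - s) pK≈s ⊞ multiple M qW≈-[s+1] ⊞ multiple q (parameter-identity vertex) ⊞ multiple (- 1#) s²)
      (solve 7 (λ p q s K L M W → (:1 :+ p :* L :+ q :* (K :- :1 :- L)) :* K :- s :* p :* K
         := (L :- s) :* (p :* K :- s) :+ (M :* (q :* W :- :- (s :+ :1)) :+ (q :* (K :* (K :- :1 :- L) :- W :* M)
            :+ :- :1 :* (s :* s :- ((L :- M) :* s :+ (K :- M)))))) refl p q s K L M W))

    nonadjacent-cosine : p * M + q * (K - M) ≈ s * q
    nonadjacent-cosine = cancel 0<W (≈-from-difference
      (multiple (K - 1# - L) pK≈s ⊞ multiple (K - M - s) qW≈-[s+1] ⊞ multiple (- p) (parameter-identity vertex)
        ⊞ multiple 1# s²)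
      (solve 7 (λ p q s K L M W → (p :* M :+ q :* (K :- M)) :* W :- s :* q :* W
         := (K :- :1 :- L) :* (p :* K :- s) :+ ((K :- M :- s) :* (q :* W :- :- (s :+ :1))
            :+ (:- p :* (K :* (K :- :1 :- L) :- W :* M)
            :+ :1 :* (s :* s :- ((L :- M) :* s :+ (K :- M)))))) refl p q s K L M W))

    ∑AE : ∀ x z → ∑[ y < v ] (A x y * E y z) ≈ s * E x z
    ∑AE x z = begin
      ∑[ y < v ] (A x y * E y z)
        ≈⟨ ∑-cong (λ y → trans (*-congˡ (E-sym y z)) (solve 5 (λ a d b p q → a :* (d :+ p :* b :+ q :* (:1 :- d :- b))
             := (:1 :- q) :* (d :* a) :+ ((p :- q) :* (a :* b) :+ (q :* a :+ :0)))
             refl (A x y) (δ z y) (A z y) p q)) ⟩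
      _ ≈⟨ (1# - q) ⊗ ∑-δ z (A x) ⊞⊞ (p - q) ⊗ ∑AA x z ⊞⊞ q ⊗ ∑A x ⊞⊞ done ⟩
      -- One equation for each relation between `x` and `z`: equal, adjacent, non-adjacent.
      _ ≈⟨ ≈-from-difference
             (multiple (δ x z) pK≈s ⊞ multiple (A x z) adjacent-cosine ⊞ multiple (N x z) nonadjacent-cosine)
             (solve 8 (λ d a p q s K L M → let n = :1 :- d :- a in
               ((:1 :- q) :* a :+ ((p :- q) :* (d :* K :+ (a :* L :+ n :* M)) :+ (q :* K :+ :0)))
                 :- s :* (d :+ p :* a :+ q :* n)
               := d :* (p :* K :- s) :+ (a :* (:1 :+ p :* L :+ q :* (K :- :1 :- L) :- s :* p)
                  :+ n :* (p :* M :+ q :* (K :- M) :- s :* q)))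
               refl (δ x z) (A x z) p q s K L M) ⟩
      s * E x z ∎

    -- A column adds up to 1 + pK + qW = 1 + s - (s + 1). This removes the contribution of the
    -- all-ones matrix to E².
    ∑E : ∀ z → ∑[ y < v ] E y z ≈ 0#
    ∑E z = begin
      ∑[ y < v ] E y z
        ≈⟨ ∑-cong (λ y → trans (E-sym y z) (solve 4 (λ d a p q → d :+ p :* a :+ q :* (:1 :- d :- a)
             := (:1 :- q) :* d :+ ((p :- q) :* a :+ (q :* :1 :+ :0))) refl (δ z y) (A z y) p q)) ⟩
      _ ≈⟨ (1# - q) ⊗ ∑δ z ⊞⊞ (p - q) ⊗ ∑A z ⊞⊞ q ⊗ ∑1 ⊞⊞ done ⟩
      _ ≈⟨ ≈-from-difference (multiple 1# pK≈s ⊞ multiple 1# qW≈-[s+1])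
             (solve 5 (λ p q s K V →
               ((:1 :- q) :* :1 :+ ((p :- q) :* K :+ (q :* V :+ :0))) :- :0
               := :1 :* (p :* K :- s) :+ :1 :* (q :* (V :- K :- :1) :- :- (s :+ :1))) refl p q s K V) ⟩
      0# ∎

    -- E = (1 - q) I + (p - q) A + q J acts on its own columns by this number, because A acts there
    -- as s and J as 0. It is also the squared length 1 + K p² + W q² of a column, hence positive.
    scale : Carrier
    scale = 1# - q + (p - q) * s

    0<scale : 0# < scale
    0<scale = <-respʳ-≈ (≈-from-difference (multiple p pK≈s ⊞ multiple q qW≈-[s+1])
        (solve 5 (λ p q s K W → :1 :+ (K :* (p :* p) :+ W :* (q :* q)) :- (:1 :- q :+ (p :- q) :* s)
           := p :* (p :* K :- s) :+ q :* (q :* W :- :- (s :+ :1))) refl p q s K W))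
      (0≤⇒0<1+ (+-nonneg (*-nonneg-pos 0<K (x²-nonneg p)) (*-nonneg-pos 0<W (x²-nonneg q))))

    ∑EE : ∀ x z → dot (λ y → E y x) (λ y → E y z) ≈ scale * E x z
    ∑EE x z = begin
      ∑[ y < v ] (E y x * E y z)
        ≈⟨ ∑-cong (λ y → trans (*-congʳ (E-sym y x)) (solve 5 (λ d a e p q → (d :+ p :* a :+ q :* (:1 :- d :- a)) :* e
             := (:1 :- q) :* (d :* e) :+ ((p :- q) :* (a :* e) :+ (q :* e :+ :0)))
             refl (δ x y) (A x y) (E y z) p q)) ⟩
      _ ≈⟨ (1# - q) ⊗ ∑-δ x (λ y → E y z) ⊞⊞ (p - q) ⊗ ∑AE x z ⊞⊞ q ⊗ ∑E z ⊞⊞ done ⟩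
      _ ≈⟨ solve 4 (λ p q s e → (:1 :- q) :* e :+ ((p :- q) :* (s :* e) :+ (q :* :0 :+ :0))
             := (:1 :- q :+ (p :- q) :* s) :* e) refl p q s (E x z) ⟩
      scale * E x z ∎

    spherical-embedding : ∀ {g} → HasMultiplicity R G s g →
      ¬ ¬ (Σ[ x ∈ (Fin v → Vector Carrier g) ] ∀ i j → dot (x i) (x j) ≈ E i j)
    spherical-embedding {g} multiplicity continue =
      GramSchmidt.isometric-coordinates R g basis (λ z y → E y z) span
        -- Columns of E have inner products `scale` times the entries of E, so the coordinates are
        -- divided by the square root of `scale`.
        (λ (y , dot-y) → continue ((λ i t → u * y i t) , λ i j → begin
          dot (λ t → u * y i t) (λ t → u * y j t)
            ≈⟨ trans (dot-scale u (y i) _) (*-congˡ (trans (dot-comm (y i) _) (dot-scale u (y j) (y i)))) ⟩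
          u * (u * dot (y j) (y i))
            ≈⟨ *-congˡ (*-congˡ (trans (dot-y j i) (trans (∑EE j i) (*-cong (sym (√-square (<⇒≤ 0<scale))) (E-sym j i))))) ⟩
          u * (u * (r * r * E i j))
            ≈⟨ normalise u r (E i j) u*r≈1 ⟩
          E i j ∎))
      where
      open HasMultiplicity multiplicity
      normalise : ∀ u r e → u * r ≈ 1# → u * (u * (r * r * e)) ≈ e
      normalise u r e u*r≈1 = ≈-from-difference (multiple ((u * r + 1#) * e) u*r≈1)
        (solve 3 (λ u r e → u :* (u :* (r :* r :* e)) :- e := (u :* r :+ :1) :* e :* (u :* r :- :1)) refl u r e)
      r = √ scale
      u = proj₁ (reciprocal (√#0 R 0<scale))
      u*r≈1 = proj₂ (reciprocal (√#0 R 0<scale))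
      span : ∀ z → Σ[ a ∈ Vector Carrier g ] ∀ y → E y z ≈ ∑[ i < g ] (a i * basis i y)
      span z = proj₁ combination , λ y → trans (proj₂ combination y) (sym (∑≈sum (λ i → proj₁ combination i * basis i y)))
        where
        combination = spanning (λ y → E y z) (λ x → trans (sym (∑≈sum (λ y → A x y * E y z))) (∑AE x z))

module CosineEquations {c ℓ₁ ℓ₂ ℓ₃} (R : Reals c ℓ₁ ℓ₂ ℓ₃) (v k lam μ : ℕ) (G : Graph v)
  (srg : IsStronglyRegular G k lam μ) (0<k : 0 ℕ.< k) (k+1<v : suc k ℕ.< v) where
  open Reals R hiding (zero)
  open StronglyRegularSums commutativeRing G k lam μ srg using (K; L; M)
  open ParameterIdentities R v k lam μ G srg 0<k k+1<v
  open Cosines R v k lam μ 0<k k+1<v using (s; p; q)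

  pK≈s : p * K ≈ s
  pK≈s = quotient-* R s K _

  qW≈-[s+1] : q * W ≈ - (s + 1#)
  qW≈-[s+1] = trans (*-congˡ (sym ι-∸≈W)) (quotient-* R (- (s + 1#)) (ι (v ∸ suc k)) _)

  s² : s * s ≈ (L - M) * s + (K - M)
  s² = half-root (quotient-* R _ (ι 2) (ι#0 R 2))

-- Polynomial identities matching the sums with the stated coefficients

module PsiIdentities {c ℓ₁ ℓ₂ ℓ₃} (R : Reals c ℓ₁ ℓ₂ ℓ₃) where
  open Reals R hiding (zero)
  open IntegerSolver commutativeRing
  open Counting commutativeRing
  open SetoidReasoning setoid

  -- Counting from an edge gives K (K - L - 1) and K (V - 2K + L), where `ΨB` has W M and W (K - M)
  -- with W = V - K - 1; the parameter identity equates them. Treating one half as a variable `hf`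
  -- with `hf * 2 = 1` keeps the claim polynomial.
  double-B : ∀ V K L M hf fa fb fc fd → hf * ι 2 ≈ 1# → K * (K - 1# - L) ≈ (V - K - 1#) * M →
    V * (K * (2 · fa + L * fb + 2 · (K - L - 1#) * fc + (V - 2 · K + L) * fd)) ≈
    2 · (V * K * fa + V * K * L * hf * fb + V * (V - K - 1#) * M * fc + V * (V - K - 1#) * (K - M) * hf * fd)
  double-B V K L M hf fa fb fc fd half identity = ≈-from-difference
    (multiple (- (V * K * L * fb + V * (V - K - 1#) * (K - M) * fd)) half ⊞ multiple (2 · V * fc - V * fd) identity)
    (solve 9 (λ V K L M hf fa fb fc fd →
       V :* (K :* (2 :· fa :+ L :* fb :+ 2 :· (K :- L :- :1) :* fc :+ (V :- 2 :· K :+ L) :* fd))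
       :- 2 :· (V :* K :* fa :+ V :* K :* L :* hf :* fb :+ V :* (V :- K :- :1) :* M :* fc
                :+ V :* (V :- K :- :1) :* (K :- M) :* hf :* fd)
       := :- (V :* K :* L :* fb :+ V :* (V :- K :- :1) :* (K :- M) :* fd) :* (hf :* :ι 2 :- :1)
          :+ (2 :· V :* fc :- V :* fd) :* (K :* (K :- :1 :- L) :- (V :- K :- :1) :* M))
       refl V K L M hf fa fb fc fd)

  clear-halves : ∀ a hf b x y z f → hf * ι 2 ≈ 1# →
    a * (2 · b + (x - 2 · y + z) * f) ≈ 4 · (a * hf * (b + (x * hf - y + z * hf) * f))
  clear-halves a hf b x y z f half = ≈-from-difference
    (multiple (- (2 · (a * (b - y * f)) + a * (x + z) * f * (2 · hf + 1#))) half)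
    (solve 7 (λ a hf b x y z f →
       a :* (2 :· b :+ (x :- 2 :· y :+ z) :* f) :- 4 :· (a :* hf :* (b :+ (x :* hf :- y :+ z :* hf) :* f))
       := :- (2 :· (a :* (b :- y :* f)) :+ a :* (x :+ z) :* f :* (2 :· hf :+ :1)) :* (hf :* :ι 2 :- :1))
       refl a hf b x y z f)

  module _ (V K L M z z₁ z₂ f₁ f₂ f₃ f₄ : Carrier) where
    Δ₁ Δ₂ Δ₃ : Carrier
    Δ₁ = f₃ - f₄
    Δ₂ = f₂ - 2 · f₃ + f₄
    Δ₃ = f₁ - 3 · f₂ + 3 · f₃ - f₄

    P : Carrier → Carrier → Carrier
    P x y = (f₄ + Δ₁ * (x + y) + 2 · Δ₂ * (x * y)) * (K - x - y)
          + (Δ₁ + Δ₂ * (x + y) + 2 · Δ₃ * (x * y)) * ((x * L + (1# - x) * M - y) + (y * L + (1# - y) * M - x))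

    -- The coefficients agree identically except those of `f₃` and `f₄`, which are off by opposite
    -- multiples of the parameter identity.
    quadruple-C₀ : K * (K - 1# - L) ≈ (V - K - 1#) * M →
      2 · z + 4 · (L * z₁) + 4 · ((K - L - 1#) * z₂)
        + ((V - 2 · K + L) * P 0# 0# + (K - L - 1#) * (P 1# 0# + P 0# 1#) + L * P 1# 1#) ≈
      2 · (z + 2 · L * z₁ + 2 · (K - L - 1#) * z₂ + 2 · L * (L - 1#) * f₁
           + ((M - 1#) * (K - L - 1#) - L * (L - 1#) + 2 · L * (K - 2 · L)) * f₂
           + 2 · ((K - M) * (K - L - 1#) - L * (K - 2 · L)) * f₃)
      + (K * (V - 2 · K + L) - 2 · ((K - M) * (K - L - 1#)) + L * (K - 2 · L)) * f₄
    quadruple-C₀ identity = ≈-from-difference (multiple (- (2 · (f₃ - f₄))) identity)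
      (solve 11 (λ V K L M z z₁ z₂ f₁ f₂ f₃ f₄ →
        let Δ₁ = f₃ :- f₄
            Δ₂ = f₂ :- 2 :· f₃ :+ f₄
            Δ₃ = f₁ :- 3 :· f₂ :+ 3 :· f₃ :- f₄
            P = λ x y → (f₄ :+ Δ₁ :* (x :+ y) :+ 2 :· Δ₂ :* (x :* y)) :* (K :- x :- y)
              :+ (Δ₁ :+ Δ₂ :* (x :+ y) :+ 2 :· Δ₃ :* (x :* y))
                 :* ((x :* L :+ (:1 :- x) :* M :- y) :+ (y :* L :+ (:1 :- y) :* M :- x))
        in (2 :· z :+ 4 :· (L :* z₁) :+ 4 :· ((K :- L :- :1) :* z₂)
            :+ ((V :- 2 :· K :+ L) :* P :0 :0 :+ (K :- L :- :1) :* (P :1 :0 :+ P :0 :1) :+ L :* P :1 :1))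
           :- (2 :· (z :+ 2 :· L :* z₁ :+ 2 :· (K :- L :- :1) :* z₂ :+ 2 :· L :* (L :- :1) :* f₁
               :+ ((M :- :1) :* (K :- L :- :1) :- L :* (L :- :1) :+ 2 :· L :* (K :- 2 :· L)) :* f₂
               :+ 2 :· ((K :- M) :* (K :- L :- :1) :- L :* (K :- 2 :· L)) :* f₃)
             :+ (K :* (V :- 2 :· K :+ L) :- 2 :· ((K :- M) :* (K :- L :- :1)) :+ L :* (K :- 2 :· L)) :* f₄)
           := :- (2 :· (f₃ :- f₄)) :* (K :* (K :- :1 :- L) :- (V :- K :- :1) :* M))
        refl V K L M z z₁ z₂ f₁ f₂ f₃ f₄)

-- The sums over vertex and edge vectors, and the bound

module Conclusion {c ℓ₁ ℓ₂ ℓ₃} (R : Reals c ℓ₁ ℓ₂ ℓ₃) (v k lam μ : ℕ) (G : Graph v)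
  (srg : IsStronglyRegular G k lam μ) (0<k : 0 ℕ.< k) (k+1<v : suc k ℕ.< v)
  (0<2+2p : Reals._<_ R (Reals.0# R) (Cosines.2+2p R v k lam μ 0<k k+1<v)) (m : ℕ) (t : ℕ) where
  open Reals R hiding (zero)
  open RealInequalities R
  open FiniteSums commutativeRing hiding (ι; _·_)
  open IntegerSolver commutativeRing
  open Counting commutativeRing
  open CliqueCount G
  open StronglyRegularSums commutativeRing G k lam μ srg hiding (V; K; L; M)
  open Psi R v k lam μ 0<k k+1<v 0<2+2p (suc (suc (suc m))) (s≤s (s≤s (s≤s z≤n))) t
  open Cosine p q
  open SetoidReasoning setoid

  private
    inverse : ∀ {y} (y#0 : y # 0#) → proj₁ (#⇒invertible y#0) * y ≈ 1#
    inverse {y} y#0 = trans (*-congʳ (sym (*-identityˡ _))) (quotient-* R 1# y y#0)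

    half u w : Carrier
    half = proj₁ (#⇒invertible (ι#0 R 2))
    u = proj₁ (#⇒invertible (√#0 R 0<2+2p))
    w = proj₁ (#⇒invertible (#-sym (<⇒# 0<2+2p)))

    u² : u * u ≈ w
    u² = square u w (√ 2+2p) 2+2p (inverse (√#0 R 0<2+2p)) (inverse (#-sym (<⇒# 0<2+2p))) (√-square (<⇒≤ 0<2+2p))
      where
      square : ∀ u w r h → u * r ≈ 1# → w * h ≈ 1# → r * r ≈ h → u * u ≈ w
      square u w r h ur≈1 wh≈1 r²≈h = ≈-from-difference
        (multiple (w * (u * r + 1#)) ur≈1 ⊞ multiple (- (u * u)) wh≈1 ⊞ multiple (- (u * u * w)) r²≈h)
        (solve 4 (λ u w r h → u :* u :- w := w :* (u :* r :+ :1) :* (u :* r :- :1)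
           :+ (:- (u :* u) :* (w :* h :- :1) :+ :- (u :* u :* w) :* (r :* r :- h))) refl u w r h)

    identity : K * (K - 1# - L) ≈ (V - K - 1#) * M
    identity = parameter-identity (ParameterIdentities.vertex R v k lam μ G srg 0<k k+1<v)

    Z-cong : ∀ {x y} → x ≈ y → Z x ≈ Z y
    Z-cong = ZonalKernel.zonal-cong R (suc (suc (suc m))) (s≤s (s≤s (s≤s z≤n))) t

    Zu Zw : Carrier → Carrier
    Zu x = Z (x * u)
    Zw x = Z (x * w)

    Zu-cong : ∀ {x y} → x ≈ y → Zu x ≈ Zu y
    Zu-cong x≈y = Z-cong (*-congʳ x≈y)

    Zw-cong : ∀ {x y} → x ≈ y → Zw x ≈ Zw y
    Zw-cong x≈y = Z-cong (*-congʳ x≈y)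

  module _ (x : Fin v → Vector Carrier (suc (suc (suc m)))) (dot-x : ∀ i j → dot (x i) (x j) ≈ E i j) where
    open EdgePairs commutativeRing G k lam μ srg p q Zw Zw-cong using (S₄; ∑-edges; ∑-edge-pairs; Δ₄)

    private
      e : Fin v → Fin v → Vector Carrier (suc (suc (suc m)))
      e i j l = u * (x i l + x j l)

      dot-e : ∀ i j z → dot (e i j) z ≈ u * (dot (x i) z + dot (x j) z)
      dot-e i j z = trans (dot-scale u _ z) (*-congˡ (dot-+ (x i) (x j) z))

      dot-x-e : ∀ a i j → dot (x a) (e i j) ≈ (E i a + E j a) * u
      dot-x-e a i j = trans (dot-comm (x a) (e i j)) (trans (dot-e i j (x a))
        (trans (*-comm _ _) (*-congʳ (+-cong (dot-x i a) (dot-x j a)))))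

      dot-e-e : ∀ i j a b → dot (e i j) (e a b) ≈ S₄ i j a b * w
      dot-e-e i j a b = begin
        dot (e i j) (e a b)
          ≈⟨ trans (dot-e i j (e a b)) (*-congˡ (+-cong (dot-x-e i a b) (dot-x-e j a b))) ⟩
        u * ((E a i + E b i) * u + (E a j + E b j) * u)
          ≈⟨ *-congˡ (sym (distribʳ u _ _)) ⟩
        u * ((E a i + E b i + (E a j + E b j)) * u)
          ≈⟨ trans (*-comm _ _) (*-assoc _ _ _) ⟩
        (E a i + E b i + (E a j + E b j)) * (u * u)
          ≈⟨ *-cong (+-cong (+-cong (E-sym a i) (E-sym b i)) (+-cong (E-sym a j) (E-sym b j))) u² ⟩
        S₄ i j a b * w ∎

      unit-e : ∀ i j → A i j ≈ 0# ⊎ dot (e i j) (e i j) ≈ 1#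
      unit-e i j = by-cases (Graph.adj G i j) ≡.refl
        where
        by-cases : ∀ β → Graph.adj G i j ≡ β → A i j ≈ 0# ⊎ dot (e i j) (e i j) ≈ 1#
        by-cases false ij = inj₁ (A-nonadj ij)
        by-cases true  ij = inj₂ (begin
          dot (e i j) (e i j)
            ≈⟨ dot-e-e i j i j ⟩
          S₄ i j i j * w
            ≈⟨ *-congʳ (+-cong (+-cong (E-diag i) (E-adj ij)) (+-cong (trans (E-sym j i) (E-adj ij)) (E-diag j))) ⟩
          (1# + p + (p + 1#)) * w
            ≈⟨ *-congʳ (2+2p≈ p) ⟩
          2+2p * w
            ≈⟨ trans (*-comm _ _) (inverse (#-sym (<⇒# 0<2+2p))) ⟩
          1# ∎)
          where
          2+2p≈ : ∀ p → 1# + p + (p + 1#) ≈ ι 2 + 2 · p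
          2+2p≈ = solve 1 (λ p → :1 :+ p :+ (p :+ :1) := :ι 2 :+ 2 :· p) refl

      ΨA≈ : ∑[ i < v ] ∑[ j < v ] Z (dot (x i) (x j)) ≈ ΨA
      ΨA≈ = trans (∑-cong (λ i → ∑-cong (λ j → Z-cong (dot-x i j)))) (∑-vertices {Z} Z-cong)

      -- The factor 2 arises because every edge is summed in both orientations; for pairs of edges
      -- in `ΨC≈` it becomes 4.
      ΨB≈ : ∑[ a < v ] ∑[ i < v ] ∑[ j < v ] (A i j * Z (dot (x a) (e i j))) ≈ 2 · ΨB
      ΨB≈ = begin
        ∑[ a < v ] ∑[ i < v ] ∑[ j < v ] (A i j * Z (dot (x a) (e i j)))
          ≈⟨ ∑-cong (λ a → ∑-cong (λ i → ∑-cong (λ j → *-congˡ (Z-cong (dot-x-e a i j))))) ⟩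
        ∑[ a < v ] ∑[ i < v ] ∑[ j < v ] (A i j * Zu (E i a + E j a))
          ≈⟨ trans (∑-comm _) (∑-cong (λ i → trans (∑-comm _) (∑-cong (λ j → sym (*-distribˡ-∑ (A i j) _))))) ⟩
        ∑[ i < v ] ∑[ j < v ] (A i j * ∑[ a < v ] Zu (E i a + E j a))
          ≈⟨ ∑-edges (λ i j → ∑[ a < v ] Zu (E i a + E j a)) _ (λ ij → ∑-edge-vertex ij {Zu} Zu-cong) ⟩
        V * (K * (2 · Zu (1# + p) + L * Zu (2 · p) + 2 · (K - L - 1#) * Zu (p + q) + (V - 2 · K + L) * Zu (2 · q)))
          ≈⟨ PsiIdentities.double-B R V K L M half (Zu (1# + p)) (Zu (2 · p)) (Zu (p + q)) (Zu (2 · q))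
               (inverse (ι#0 R 2)) identity ⟩
        2 · ΨB ∎

      f₁≈ : Zw (3 · p + 1 · q) ≈ Zw (3 · p + q)
      f₁≈ = Zw-cong (+-congˡ (+-identityʳ q))

      f₃≈ : Zw (1 · p + 3 · q) ≈ Zw (p + 3 · q)
      f₃≈ = Zw-cong (+-congʳ (+-identityʳ p))

      f₄≈ : Zw (0 · p + 4 · q) ≈ Zw (4 · q)
      f₄≈ = Zw-cong (+-identityˡ _)

      Z1≈ : Zw (ι 2 + 2 · p) ≈ Z 1#
      Z1≈ = Z-cong (trans (*-comm _ _) (inverse (#-sym (<⇒# 0<2+2p))))

      -- Abstracts the four values whose arguments agree with those in `ΨC₀` only up to `_≈_`, such
      -- as `1 · p` against p or (2 + 2p)/(2 + 2p) against 1.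
      C₀ : (z f₁ f₃ f₄ : Carrier) → Carrier
      C₀ z f₁ f₃ f₄ = (V * K) /2 *
        ( z
        + 2 · L * Zw (1# + 3 · p)
        + 2 · (K - L - 1#) * Zw (1# + 2 · p + q)
        + 2 · L * (L - 1#) * f₁
        + ((M - 1#) * (K - L - 1#) - L * (L - 1#) + 2 · L * (K - 2 · L)) * Zw (2 · p + 2 · q)
        + 2 · ((K - M) * (K - L - 1#) - L * (K - 2 · L)) * f₃
        + ((K * (V - 2 · K + L)) /2 - (K - M) * (K - L - 1#) + (L * (K - 2 · L)) /2) * f₄ )

      C₀-cong : ∀ {z z′ f₁ f₁′ f₃ f₃′ f₄ f₄′} → z ≈ z′ → f₁ ≈ f₁′ → f₃ ≈ f₃′ → f₄ ≈ f₄′ →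
                C₀ z f₁ f₃ f₄ ≈ C₀ z′ f₁′ f₃′ f₄′
      C₀-cong z≈ f₁≈ f₃≈ f₄≈ = *-congˡ (+-cong (+-cong (+-congʳ (+-cong (+-congʳ (+-congʳ z≈))
        (*-congˡ f₁≈))) (*-congˡ f₃≈)) (*-congˡ f₄≈))

      ΨC₁≈ : ΨC₁ ≈ 6 · Δ₄
      ΨC₁≈ = alternate _ _ _ _ _
        where
        alternate : ∀ f₀ f₁ f₂ f₃ f₄ →
          -- The form to which the powers of -1, the binomial coefficients and the sum in `ΨC₁`
          -- compute.
          6 · (1# * ι 1 * f₀ + (- 1# * 1# * ι 4 * f₁ + (- 1# * (- 1# * 1#) * ι 6 * f₂
            + (- 1# * (- 1# * (- 1# * 1#)) * ι 4 * f₃ + (- 1# * (- 1# * (- 1# * (- 1# * 1#))) * ι 1 * f₄ + 0#)))))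
          ≈ 6 · (f₀ - 4 · f₁ + 6 · f₂ - 4 · f₃ + f₄)
        alternate = solve 5 (λ f₀ f₁ f₂ f₃ f₄ →
          let n = :- :1 in
          6 :· (:1 :* :ι 1 :* f₀ :+ (n :* :1 :* :ι 4 :* f₁ :+ (n :* (n :* :1) :* :ι 6 :* f₂
            :+ (n :* (n :* (n :* :1)) :* :ι 4 :* f₃ :+ (n :* (n :* (n :* (n :* :1))) :* :ι 1 :* f₄ :+ :0)))))
          := 6 :· (f₀ :- 4 :· f₁ :+ 6 :· f₂ :- 4 :· f₃ :+ f₄)) refl

      ΨC≈ : ∑[ i < v ] ∑[ j < v ] ∑[ a < v ] ∑[ b < v ] (A i j * (A a b * Z (dot (e i j) (e a b))))
            ≈ 4 · (ΨC₀ + ι (#K₄ G) * ΨC₁)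
      ΨC≈ = begin
        ∑[ i < v ] ∑[ j < v ] ∑[ a < v ] ∑[ b < v ] (A i j * (A a b * Z (dot (e i j) (e a b))))
          ≈⟨ ∑-cong (λ i → ∑-cong (λ j → ∑-cong (λ a → ∑-cong (λ b →
               *-congˡ (*-congˡ (Z-cong (dot-e-e i j a b))))))) ⟩
        ∑[ i < v ] ∑[ j < v ] ∑[ a < v ] ∑[ b < v ] (A i j * (A a b * Zw (S₄ i j a b)))
          ≈⟨ ∑-edge-pairs ⟩
        _ ≈⟨ +-cong (trans (sym (*-assoc V K _)) (trans (*-congˡ
                 (PsiIdentities.quadruple-C₀ R V K L M (Zw (ι 2 + 2 · p)) (Zw (1# + 3 · p)) (Zw (1# + 2 · p + q))
                   (Zw (3 · p + 1 · q)) (Zw (2 · p + 2 · q)) (Zw (1 · p + 3 · q)) (Zw (0 · p + 4 · q)) identity))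
                 (trans (PsiIdentities.clear-halves R (V * K) half _ (K * (V - 2 · K + L)) ((K - M) * (K - L - 1#))
                     (L * (K - 2 · L)) (Zw (0 · p + 4 · q)) (inverse (ι#0 R 2)))
                   (·-cong (C₀-cong Z1≈ f₁≈ f₃≈ f₄≈))))) refl ⟩
        4 · ΨC₀ + Δ₄ * (ι 24 * ι (#K₄ G))
          ≈⟨ regroup ΨC₀ Δ₄ (ι (#K₄ G)) ⟩
        4 · (ΨC₀ + ι (#K₄ G) * (6 · Δ₄))
          ≈⟨ ·-cong (+-congˡ (*-congˡ (sym ΨC₁≈))) ⟩
        4 · (ΨC₀ + ι (#K₄ G) * ΨC₁) ∎
        where
        ·-cong : ∀ {x y} → x ≈ y → 4 · x ≈ 4 · y
        ·-cong x≈y = +-cong x≈y (+-cong x≈y (+-cong x≈y (+-congʳ x≈y)))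
        regroup : ∀ a d n → 4 · a + d * (ι 24 * n) ≈ 4 · (a + n * (6 · d))
        regroup = solve 3 (λ a d n → 4 :· a :+ d :* (:ι 24 :* n) := 4 :· (a :+ n :* (6 :· d))) refl

    bound : ΨB * ΨB ≤ ΨA * (ΨC₀ + ι (#K₄ G) * ΨC₁)
    -- The orientation factors agree on both sides, 2² against 4, so a strict reverse inequality
    -- multiplied by 4 contradicts Cauchy-Schwarz.
    bound RHS<ΨB² = ZonalKernel.zonal-cauchy-schwarz R m t x (λ i → trans (dot-x i i) (E-diag i)) e A unit-e
      (<-respˡ-≈ (trans (rescale-right ΨA _) (*-cong (sym ΨA≈) (sym ΨC≈)))
        (<-respʳ-≈ (trans (rescale-left ΨB) (*-cong (sym ΨB≈) (sym ΨB≈)))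
          (*-monoˡ-< (0<ι R 3) RHS<ΨB²)))
      where
      rescale-left : ∀ b → ι 4 * (b * b) ≈ 2 · b * (2 · b)
      rescale-left = solve 1 (λ b → :ι 4 :* (b :* b) := 2 :· b :* (2 :· b)) refl
      rescale-right : ∀ a d → ι 4 * (a * d) ≈ a * (4 · d)
      rescale-right = solve 2 (λ a d → :ι 4 :* (a :* d) := a :* (4 :· d)) refl
      *-monoˡ-< : ∀ {a x y} → 0# < a → x < y → a * x < a * y
      *-monoˡ-< {a} {x} {y} 0<a x<y = 0<y-x⇒x<y (<-respʳ-≈
        (solve 3 (λ a x y → a :* (y :- x) := a :* y :- a :* x) refl a x y) (*-pos 0<a (x<y⇒0<y-x x<y)))

mainTheorem3 :
    ∀ {c ℓ₁ ℓ₂ ℓ₃} (R : Reals c ℓ₁ ℓ₂ ℓ₃) →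
    let open Reals R in
    (v k lam μ : ℕ) (G : Graph v) →
    IsStronglyRegular G k lam μ →
    (0<k : 0 ℕ.< k) (k+1<v : suc k ℕ.< v) →
    let open Cosines R v k lam μ 0<k k+1<v in
    (0<2+2p : 0# < 2+2p) →
    (g : ℕ) → HasMultiplicity R G s g → (3≤g : 3 ℕ.≤ g) →
    (t : ℕ) → 1 ℕ.≤ t →
    let open Psi R v k lam μ 0<k k+1<v 0<2+2p g 3≤g t in
    ΨB * ΨB ≤ ΨA * (ΨC₀ + ι (#K₄ G) * ΨC₁)
mainTheorem3 R v k lam μ G srg 0<k k+1<v 0<2+2p (suc (suc (suc m))) multiplicity (s≤s (s≤s (s≤s z≤n))) t _ RHS<ΨB² =
  -- With the assumed reverse inequality at hand the goal is absurdity, so the doubly negated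
  -- embedding may be used as if it were given.
  Spectrum.spherical-embedding R v k lam μ G srg 0<k k+1<v
    (Cosines.p R v k lam μ 0<k k+1<v) (Cosines.q R v k lam μ 0<k k+1<v) (Cosines.s R v k lam μ 0<k k+1<v)
    (CosineEquations.pK≈s R v k lam μ G srg 0<k k+1<v)
    (CosineEquations.qW≈-[s+1] R v k lam μ G srg 0<k k+1<v)
    (CosineEquations.s² R v k lam μ G srg 0<k k+1<v)
    multiplicity
    (λ (x , dot-x) → Conclusion.bound R v k lam μ G srg 0<k k+1<v 0<2+2p m t x dot-x RHS<ΨB²)
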